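{- The satisfiability problem for $\mathcal{FL}^23\mathrm{T}$, the two-variable fluted fragment with three transitive relations, is undecidable.
   Context: Signatures are purely relational and formulas contain no equality. Fix variables $x_1, x_2, \ldots$. The sets $\mathcal{FL}^{[m]}$ ($m \geq 0$) are defined inductively: (i) every atom whose argument list is exactly $x_\ell, \ldots, x_m$ (in this order, a contiguous subsequence of $x_1,x_2,\ldots$; possibly empty for 0-ary predicates) is in $\mathcal{FL}^{[m]}$; (ii) $\mathcal{FL}^{[m]}$ is closed under Boolean combinations; (iii) if $\psi \in \mathcal{FL}^{[m+1]}$ then $\exists x_{m+1}\psi$ and $\forall x_{m+1}\psi$ are in $\mathcal{FL}^{[m]}$. The fluted fragment $\mathcal{FL}$ is $\bigcup_m \mathcal{FL}^{[m]}$, and $\mathcal{FL}^2$ is the set of fluted formulas using at most two variables. $\mathcal{FL}^23\mathrm{T}$ is $\mathcal{FL}^2$ over a signature containing three distinguished binary predicates that are required to be interpreted as transitive relations (other predicates are unrestricted). -}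

module Defs where

open import Data.Nat using (ℕ; zero; suc; _+_; _≡ᵇ_)
open import Data.Bool using (Bool; true; false; not; _∧_; _∨_; if_then_else_)
open import Data.Fin using (Fin; toℕ)
open import Data.List using (List; []; _∷_)
open import Data.Maybe using (Maybe; just; nothing)
open import Data.Product using (Σ; _×_; _,_; proj₁; proj₂)
open import Relation.Nullary using (¬_)
open import Relation.Binary.PropositionalEquality using (_≡_)
open import Function.Bundles using (_⇔_)

-- Syntax of FL²3T (sentences).
--
-- Purely relational signature, no equality.  Predicate symbols of each
-- arity 0,1,2 are indexed by ℕ; in addition there are three distinguished
-- binary predicates  T 0, T 1, T 2  (Fin 3), to be interpreted transitively.
-- Since at most two variables are used, only arities ≤ 2 can occur.
--
-- FL2 = formulas of FL^[2] (free variables x₁,x₂, no quantifier since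
--       x₃ is not available), FL1 = FL^[1] restricted to two variables,
-- FL0 = FL^[0] restricted to two variables (the sentences).
-- Atoms respect the fluted ordering: in FL^[2] a unary atom is p(x₂),
-- a binary atom is p(x₁,x₂); in FL^[1] a unary atom is p(x₁).

data FL2 : Set where
  nul  : ℕ → FL2
  un   : ℕ → FL2               -- p(x₂)
  bin  : ℕ → FL2               -- p(x₁,x₂)   (ordinary binary)
  tr   : Fin 3 → FL2           -- T(x₁,x₂)   (distinguished transitive)
  neg  : FL2 → FL2
  and  : FL2 → FL2 → FL2
  or   : FL2 → FL2 → FL2

data FL1 : Set where
  nul  : ℕ → FL1
  un   : ℕ → FL1               -- p(x₁)
  neg  : FL1 → FL1
  and  : FL1 → FL1 → FL1
  or   : FL1 → FL1 → FL1
  ex   : FL2 → FL1             -- ∃x₂ ψ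
  all  : FL2 → FL1             -- ∀x₂ ψ

data FL0 : Set where
  nul  : ℕ → FL0
  neg  : FL0 → FL0
  and  : FL0 → FL0 → FL0
  or   : FL0 → FL0 → FL0
  ex   : FL1 → FL0
  all  : FL1 → FL0

record Structure : Set₁ where
  field
    Dom   : Set
    elem  : Dom                          -- domains are nonempty
    P0    : ℕ → Bool
    P1    : ℕ → Dom → Bool
    P2    : ℕ → Dom → Dom → Bool
    T     : Fin 3 → Dom → Dom → Bool
    T-trans : ∀ i a b c → T i a b ≡ true → T i b c ≡ true → T i a c ≡ true

module _ (M : Structure) where
  open Structure M

  eval2 : FL2 → Dom → Dom → Bool
  eval2 (nul p)   a b = P0 p
  eval2 (un p)    a b = P1 p b
  eval2 (bin p)   a b = P2 p a b
  eval2 (tr i)    a b = T i a b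
  eval2 (neg φ)   a b = not (eval2 φ a b)
  eval2 (and φ ψ) a b = eval2 φ a b ∧ eval2 ψ a b
  eval2 (or φ ψ)  a b = eval2 φ a b ∨ eval2 ψ a b

  -- Tarski conditions a truth-value assignment on FL1 must satisfy
  Clause1 : (FL1 → Dom → Bool) → FL1 → Dom → Set
  Clause1 v (nul p)   a = v (nul p) a ≡ P0 p
  Clause1 v (un p)    a = v (un p) a ≡ P1 p a
  Clause1 v (neg φ)   a = v (neg φ) a ≡ not (v φ a)
  Clause1 v (and φ ψ) a = v (and φ ψ) a ≡ (v φ a ∧ v ψ a)
  Clause1 v (or φ ψ)  a = v (or φ ψ) a ≡ (v φ a ∨ v ψ a)
  Clause1 v (ex ψ)    a = (v (ex ψ) a ≡ true) ⇔ Σ Dom (λ b → eval2 ψ a b ≡ true)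
  Clause1 v (all ψ)   a = (v (all ψ) a ≡ true) ⇔ (∀ b → eval2 ψ a b ≡ true)

  Clause0 : (FL1 → Dom → Bool) → (FL0 → Bool) → FL0 → Set
  Clause0 v1 v (nul p)   = v (nul p) ≡ P0 p
  Clause0 v1 v (neg φ)   = v (neg φ) ≡ not (v φ)
  Clause0 v1 v (and φ ψ) = v (and φ ψ) ≡ (v φ ∧ v ψ)
  Clause0 v1 v (or φ ψ)  = v (or φ ψ) ≡ (v φ ∨ v ψ)
  Clause0 v1 v (ex ψ)    = (v (ex ψ) ≡ true) ⇔ Σ Dom (λ a → v1 ψ a ≡ true)
  Clause0 v1 v (all ψ)   = (v (all ψ) ≡ true) ⇔ (∀ a → v1 ψ a ≡ true)

  record Valuation : Set where
    field
      val1 : FL1 → Dom → Bool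
      val0 : FL0 → Bool
      ok1  : ∀ φ a → Clause1 val1 φ a
      ok0  : ∀ φ → Clause0 val1 val0 φ

  _⊨_ : FL0 → Set
  _⊨_ φ = Σ Valuation (λ V → Valuation.val0 V φ ≡ true)

Satisfiable : FL0 → Set₁
Satisfiable φ = Σ Structure (λ M → _⊨_ M φ)

-- Gödel numbering of sentences (Cantor pairing)

tri : ℕ → ℕ
tri zero    = zero
tri (suc n) = suc n + tri n

pair : ℕ → ℕ → ℕ
pair a b = tri (a + b) + b

code2 : FL2 → ℕ
code2 (nul p)   = pair 0 p
code2 (un p)    = pair 1 p
code2 (bin p)   = pair 2 p
code2 (tr i)    = pair 3 (toℕ i)
code2 (neg φ)   = pair 4 (code2 φ)
code2 (and φ ψ) = pair 5 (pair (code2 φ) (code2 ψ))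
code2 (or φ ψ)  = pair 6 (pair (code2 φ) (code2 ψ))

code1 : FL1 → ℕ
code1 (nul p)   = pair 0 p
code1 (un p)    = pair 1 p
code1 (neg φ)   = pair 2 (code1 φ)
code1 (and φ ψ) = pair 3 (pair (code1 φ) (code1 ψ))
code1 (or φ ψ)  = pair 4 (pair (code1 φ) (code1 ψ))
code1 (ex ψ)    = pair 5 (code2 ψ)
code1 (all ψ)   = pair 6 (code2 ψ)

code0 : FL0 → ℕ
code0 (nul p)   = pair 0 p
code0 (neg φ)   = pair 1 (code0 φ)
code0 (and φ ψ) = pair 2 (pair (code0 φ) (code0 ψ))
code0 (or φ ψ)  = pair 3 (pair (code0 φ) (code0 ψ))
code0 (ex ψ)    = pair 4 (code1 ψ)
code0 (all ψ)   = pair 5 (code1 ψ)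

SAT : ℕ → Set₁
SAT n = Σ FL0 (λ φ → (code0 φ ≡ n) × Satisfiable φ)

-- Model of computation: register (counter) machines with unboundedly
-- many registers indexed by ℕ.

data Instr : Set where
  INC : ℕ → ℕ → Instr        -- INC r j   : R[r] := R[r]+1 ; goto j
  DEC : ℕ → ℕ → ℕ → Instr    -- DEC r j k : if R[r] = 0 then goto k
                             --             else R[r] := R[r]-1 ; goto j

Program : Set
Program = List Instr

Config : Set
Config = ℕ × (ℕ → ℕ)        -- program counter, register contents

nth : {A : Set} → List A → ℕ → Maybe A
nth []       _       = nothing
nth (x ∷ xs) zero    = just x
nth (x ∷ xs) (suc n) = nth xs n

update : (ℕ → ℕ) → ℕ → ℕ → (ℕ → ℕ)
update R r v s = if s ≡ᵇ r then v else R s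

step : Program → Config → Config
step P (pc , R) with nth P pc
... | nothing = (pc , R)
... | just (INC r j) = (j , update R r (suc (R r)))
... | just (DEC r j k) with R r
...   | zero  = (k , R)
...   | suc v = (j , update R r v)

run : Program → ℕ → Config → Config
run P zero    c = c
run P (suc n) c = run P n (step P c)

Halted : Program → Config → Set
Halted P c = nth P (proj₁ c) ≡ nothing

initial : ℕ → Config
initial n = (0 , λ r → if r ≡ᵇ 0 then n else 0)

Computes : Program → ℕ → ℕ → Set
Computes P n out =
  Σ ℕ (λ k → Halted P (run P k (initial n)) × (proj₂ (run P k (initial n)) 0 ≡ out))

Decides : Program → (ℕ → Set₁) → Set₁
Decides P S = ∀ n → (S n → Computes P n 1) × (¬ S n → Computes P n 0)

Decidable-set : (ℕ → Set₁) → Set₁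
Decidable-set S = Σ Program (λ P → Decides P S)

{-# OPTIONS --safe #-}
-- Three transitive relations suffice to force a growing grid.  A single path of elements runs
-- through the rows boustrophedon; the squares between two rows are grouped into bricks coloured
-- with three colours so that bricks of the same colour are disjoint.  If T is the colour of a
-- brick containing neighbours a, b of one row and the cells a′, b′ facing them in the next row,
-- and a → b, b → b′, b′ → a′ are already T-edges, then transitivity yields the missing edge
-- a → a′, which is identified by column labels and handed over to the adjacent brick.  Along vertical edges the rows display the
-- successive configurations of a counter machine.
--
-- Undecidability is obtained by diagonalisation: given a program P, a sentence φ is built
-- whose machine computes the code of φ, runs P on it, and then contradicts a positive answer
-- or halts after a negative one.  In the halting case φ has a finite model, for which a
-- truth-value assignment can be computed.
module Submission where

open import Defs
open import Relation.Nullary using (¬_; Dec; yes; no)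
open import Relation.Nullary.Decidable using (does)
open import Relation.Binary.PropositionalEquality using (_≡_; refl; sym; trans; cong; cong₂; subst; subst₂)
open import Data.Nat
open import Data.Nat.Properties
open import Data.Nat.Tactic.RingSolver using (solve-∀)
open import Data.Bool.Properties using (not-involutive)
open import Data.Bool using (Bool; true; false; not; _∧_; _∨_; if_then_else_)
open import Data.Fin using (Fin; zero; suc; toℕ; fromℕ<)
open import Data.Fin.Properties using (toℕ-fromℕ<; toℕ<n; any?; toℕ-injective)
open import Data.Vec using (Vec; []; _∷_; lookup; _[_]≔_; replicate)
open import Relation.Binary.Definitions using (tri<; tri≈; tri>)
open import Data.List using (List; []; _∷_; _++_; map)
open import Data.List.Membership.Propositional using (_∈_)
open import Data.List.Membership.Propositional.Properties using (∈-++⁻; ∈-++⁺ˡ; ∈-++⁺ʳ; ∈-map⁺)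
open import Data.List.Properties using (++-assoc)
open import Data.List.Relation.Unary.Any using (here; there)
open import Data.Maybe using (Maybe; just; nothing)
open import Data.Maybe.Properties using (just-injective)
open import Data.Product using (Σ; ∃; _×_; _,_; proj₁; proj₂)
open import Data.Sum using (_⊎_; inj₁; inj₂)
open import Data.Empty using (⊥; ⊥-elim)
open import Function.Bundles using (_⇔_; mk⇔; Equivalence)

-- Signature

-- In a fluted formula a unary atom under both quantifiers speaks of the second element only, and no
-- relation can be read backwards. Information therefore travels only from a cell to its `next`
-- neighbour and from a row to the row above it. Row k has 4k+4 cells; cell m of row k+1 faces cell
-- p of row k when p + m = 4k+3, so the last four cells of a row face nothing below them. The period
-- four is what three colours require: `T 1` and `T 2` alternate between strips, but `T 0` has to
-- serve every strip. Its squares above a row use columns 0 and 1 of that row and those below it use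
-- columns 2 and 3, so they never meet. A register is displayed as the border between the cells with
-- bit 1 and those with bit 0, and its value is the distance of the border from a marked centre.
-- Counting then amounts to copying bits along a diagonal instead of a vertical edge, and
-- transitivity supplies diagonals as well. The run starts with empty registers. A number is handed
-- to the machine by a chain of states `boot n` that writes it in unary; the sentence can thus
-- contain its own diagonal argument.

data Col : Set where
  c0 c1 c2 c3 : Col

data PC : Set where
  good bad exit   : PC
  main prog boot  : ℕ → PC

data Flag : Set where
  first under ext origin live nop : Flag
  par : Bool → Flag
  col : Col → Flag

data Pr : Set where
  fl : Flag → Pr
  bit zer inc dec keep : ℕ → Pr
  at : PC → Pr

-- Residue 0 modulo 9 holds the finitely many unindexed predicates, and each other residue one
-- indexed family. The numbers of `at (boot n)` and `at (boot (suc n))` thus differ by 9, which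
-- `bootStep` exploits.
indexed : ℕ → ℕ → ℕ
indexed t zero    = t
indexed t (suc n) = 9 + indexed t n

encode : Pr → ℕ
encode (fl first)       = indexed 0 0
encode (fl under)       = indexed 0 1
encode (fl ext)         = indexed 0 2
encode (fl origin)      = indexed 0 3
encode (fl live)        = indexed 0 4
encode (fl nop)         = indexed 0 5
encode (fl (par false)) = indexed 0 6
encode (fl (par true))  = indexed 0 7
encode (fl (col c0))    = indexed 0 8
encode (fl (col c1))    = indexed 0 9
encode (fl (col c2))    = indexed 0 10
encode (fl (col c3))    = indexed 0 11
encode (at good)        = indexed 0 12
encode (at bad)         = indexed 0 13
encode (at exit)        = indexed 0 14
encode (bit r)          = indexed 1 r
encode (zer r)          = indexed 2 r
encode (inc r)          = indexed 3 r
encode (dec r)          = indexed 4 r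
encode (keep r)         = indexed 5 r
encode (at (main n))    = indexed 6 n
encode (at (prog n))    = indexed 7 n
encode (at (boot n))    = indexed 8 n

split : ℕ → ℕ × ℕ
split (suc (suc (suc (suc (suc (suc (suc (suc (suc n))))))))) with split n
... | t , m = t , suc m
split n = n , 0

split-indexed : ∀ t n → t < 9 → split (indexed t n) ≡ (t , n)
split-indexed t (suc n) t<9 rewrite split-indexed t n t<9 = refl
split-indexed 0 zero _ = refl
split-indexed 1 zero _ = refl
split-indexed 2 zero _ = refl
split-indexed 3 zero _ = refl
split-indexed 4 zero _ = refl
split-indexed 5 zero _ = refl
split-indexed 6 zero _ = refl
split-indexed 7 zero _ = refl
split-indexed 8 zero _ = refl
split-indexed (suc (suc (suc (suc (suc (suc (suc (suc (suc t))))))))) zero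
  (s≤s (s≤s (s≤s (s≤s (s≤s (s≤s (s≤s (s≤s (s≤s ())))))))))

decode′ : ℕ × ℕ → Pr
decode′ (0 , 0)  = fl first
decode′ (0 , 1)  = fl under
decode′ (0 , 2)  = fl ext
decode′ (0 , 3)  = fl origin
decode′ (0 , 4)  = fl live
decode′ (0 , 5)  = fl nop
decode′ (0 , 6)  = fl (par false)
decode′ (0 , 7)  = fl (par true)
decode′ (0 , 8)  = fl (col c0)
decode′ (0 , 9)  = fl (col c1)
decode′ (0 , 10) = fl (col c2)
decode′ (0 , 11) = fl (col c3)
decode′ (0 , 12) = at good
decode′ (0 , 13) = at bad
decode′ (0 , _)  = at exit
decode′ (1 , r)  = bit r
decode′ (2 , r)  = zer r
decode′ (3 , r)  = inc r
decode′ (4 , r)  = dec r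
decode′ (5 , r)  = keep r
decode′ (6 , r)  = at (main r)
decode′ (7 , r)  = at (prog r)
decode′ (_ , r)  = at (boot r)

decode : ℕ → Pr
decode n = decode′ (split n)

decode-encode : ∀ p → decode (encode p) ≡ p
decode-encode (fl first)       = refl
decode-encode (fl under)       = refl
decode-encode (fl ext)         = refl
decode-encode (fl origin)      = refl
decode-encode (fl live)        = refl
decode-encode (fl nop)         = refl
decode-encode (fl (par false)) = refl
decode-encode (fl (par true))  = refl
decode-encode (fl (col c0))    = refl
decode-encode (fl (col c1))    = refl
decode-encode (fl (col c2))    = refl
decode-encode (fl (col c3))    = refl
decode-encode (at good)        = refl
decode-encode (at bad)         = refl
decode-encode (at exit)        = refl
decode-encode (bit r)          = cong decode′ (split-indexed 1 r (<ᵇ⇒< 1 9 _))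
decode-encode (zer r)          = cong decode′ (split-indexed 2 r (<ᵇ⇒< 2 9 _))
decode-encode (inc r)          = cong decode′ (split-indexed 3 r (<ᵇ⇒< 3 9 _))
decode-encode (dec r)          = cong decode′ (split-indexed 4 r (<ᵇ⇒< 4 9 _))
decode-encode (keep r)         = cong decode′ (split-indexed 5 r (<ᵇ⇒< 5 9 _))
decode-encode (at (main r))    = cong decode′ (split-indexed 6 r (<ᵇ⇒< 6 9 _))
decode-encode (at (prog r))    = cong decode′ (split-indexed 7 r (<ᵇ⇒< 7 9 _))
decode-encode (at (boot r))    = cong decode′ (split-indexed 8 r (<ᵇ⇒< 8 9 _))

-- Clauses, their sentences and their semantics

infixr 6 _∧ᵘ_ _∧ᵇ_
infixr 5 _∨ᵘ_
infixr 4 _∧ᵗ_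

data U : Set where
  atom      : Pr → U
  ¬ᵘ_       : U → U
  _∧ᵘ_ _∨ᵘ_ : U → U → U

data B : Set where
  snd  : U → B
  rel  : ℕ → B
  tra  : Fin 3 → B
  _∧ᵇ_ : B → B → B

data Clause : Set where
  unary  : U → U → Clause
  forces : U → B → B → Clause
  needs  : U → B → Clause
  start  : U → Clause

data Th : Set₁ where
  cl   : Clause → Th
  _∧ᵗ_ : Th → Th → Th
  ⋀    : {A : Set} → List A → (A → Th) → Th

U₁ : U → FL1
U₁ (atom p) = un (encode p)
U₁ (¬ᵘ u)   = neg (U₁ u)
U₁ (u ∧ᵘ v) = and (U₁ u) (U₁ v)
U₁ (u ∨ᵘ v) = or (U₁ u) (U₁ v)

U₂ : U → FL2
U₂ (atom p) = un (encode p)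
U₂ (¬ᵘ u)   = neg (U₂ u)
U₂ (u ∧ᵘ v) = and (U₂ u) (U₂ v)
U₂ (u ∨ᵘ v) = or (U₂ u) (U₂ v)

B₂ : B → FL2
B₂ (snd u)  = U₂ u
B₂ (rel i)  = bin i
B₂ (tra i)  = tr i
B₂ (b ∧ᵇ c) = and (B₂ b) (B₂ c)

-- The guard `γ` concerns the first element and has to stay outside the inner quantifier. The
-- disjuncts are ordered for the self-referential sentence: in its `unary` clauses the consequent is
-- constant and the guard varies, so the code arises by prefixing constants with `wrap`.
clause : Clause → FL0
clause (unary γ β)    = all (or (U₁ β) (neg (U₁ γ)))
clause (forces γ δ ψ) = all (or (all (or (neg (B₂ δ)) (B₂ ψ))) (neg (U₁ γ)))
clause (needs γ δ)    = all (or (ex (B₂ δ)) (neg (U₁ γ)))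
clause (start γ)      = ex (U₁ γ)

sentence : Th → FL0
sentence (cl c)       = clause c
sentence (s ∧ᵗ t)     = and (sentence s) (sentence t)
sentence (⋀ [] f)     = or (nul 0) (neg (nul 0))
sentence (⋀ (x ∷ xs) f) = and (sentence (f x)) (sentence (⋀ xs f))

module Semantics {D : Set} (I : Pr → D → Bool) (J : ℕ → D → D → Bool)
                 (T : Fin 3 → D → D → Bool) where

  ⟦_⟧ : U → D → Set
  ⟦ atom p ⟧ x = I p x ≡ true
  ⟦ ¬ᵘ u ⟧ x   = ¬ ⟦ u ⟧ x
  ⟦ u ∧ᵘ v ⟧ x = ⟦ u ⟧ x × ⟦ v ⟧ x
  ⟦ u ∨ᵘ v ⟧ x = ⟦ u ⟧ x ⊎ ⟦ v ⟧ x

  ⟦_⟧₂ : B → D → D → Set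
  ⟦ snd u ⟧₂ x y  = ⟦ u ⟧ y
  ⟦ rel i ⟧₂ x y  = J i x y ≡ true
  ⟦ tra i ⟧₂ x y  = T i x y ≡ true
  ⟦ b ∧ᵇ c ⟧₂ x y = ⟦ b ⟧₂ x y × ⟦ c ⟧₂ x y

  Clause⊨ : Clause → Set
  Clause⊨ (unary γ β)    = ∀ x → ⟦ γ ⟧ x → ⟦ β ⟧ x
  Clause⊨ (forces γ δ ψ) = ∀ x y → ⟦ γ ⟧ x → ⟦ δ ⟧₂ x y → ⟦ ψ ⟧₂ x y
  Clause⊨ (needs γ δ)    = ∀ x → ⟦ γ ⟧ x → ∃ λ y → ⟦ δ ⟧₂ x y
  Clause⊨ (start γ)      = ∃ λ x → ⟦ γ ⟧ x

  Th⊨ : Th → Set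
  Th⊨ (cl c)   = Clause⊨ c
  Th⊨ (s ∧ᵗ t) = Th⊨ s × Th⊨ t
  Th⊨ (⋀ xs f) = ∀ a → a ∈ xs → Th⊨ (f a)

  dec-≡true : ∀ b → Dec (b ≡ true)
  dec-≡true true  = yes refl
  dec-≡true false = no λ ()

  ⟦_⟧? : ∀ u x → Dec (⟦ u ⟧ x)
  ⟦ atom p ⟧? x = dec-≡true (I p x)
  ⟦ ¬ᵘ u ⟧? x with ⟦ u ⟧? x
  ... | yes h = no λ n → n h
  ... | no n  = yes n
  ⟦ u ∧ᵘ v ⟧? x with ⟦ u ⟧? x | ⟦ v ⟧? x
  ... | yes a | yes b = yes (a , b)
  ... | no a  | _     = no λ h → a (proj₁ h)
  ... | yes _ | no b  = no λ h → b (proj₂ h)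
  ⟦ u ∨ᵘ v ⟧? x with ⟦ u ⟧? x | ⟦ v ⟧? x
  ... | yes a | _     = yes (inj₁ a)
  ... | no _  | yes b = yes (inj₂ b)
  ... | no a  | no b  = no λ { (inj₁ h) → a h ; (inj₂ h) → b h }

_↔ᵇ_ : Bool → Set → Set
b ↔ᵇ A = (b ≡ true → A) × (A → b ≡ true)

false≢true : ¬ false ≡ true
false≢true ()

not↔ : ∀ {b A} → b ↔ᵇ A → not b ↔ᵇ (¬ A)
not↔ {true}  (f , g) = (λ ()) , λ n → ⊥-elim (n (f refl))
not↔ {false} (f , g) = (λ _ a → false≢true (g a)) , λ _ → refl

∧↔ : ∀ {b c A C} → b ↔ᵇ A → c ↔ᵇ C → (b ∧ c) ↔ᵇ (A × C)
∧↔ {true}  (f , g) (h , i) = (λ e → f refl , h e) , λ p → i (proj₂ p)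
∧↔ {false} (f , g) (h , i) = (λ ()) , λ p → g (proj₁ p)

∨↔ : ∀ {b c A C} → b ↔ᵇ A → c ↔ᵇ C → (b ∨ c) ↔ᵇ (A ⊎ C)
∨↔ {true}  (f , g) (h , i) = (λ _ → inj₁ (f refl)) , λ _ → refl
∨↔ {false} {c} (f , g) (h , i) = (λ e → inj₂ (h e)) , λ { (inj₁ a) → ⊥-elim (false≢true (g a)) ; (inj₂ x) → i x }

∨-not↔ : ∀ {b c A C} → b ↔ᵇ A → c ↔ᵇ C → (b ∨ not c) ↔ᵇ (C → A)
∨-not↔ {true}  (f , g) _ = (λ _ _ → f refl) , λ _ → refl
∨-not↔ {false} {true}  (f , g) (h , i) = (λ ()) , λ k → g (k (h refl))
∨-not↔ {false} {false} (f , g) (h , i) = (λ _ c → ⊥-elim (false≢true (i c))) , λ _ → refl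

not-∨↔ : ∀ {b c A C} → b ↔ᵇ A → c ↔ᵇ C → (not c ∨ b) ↔ᵇ (C → A)
not-∨↔ {b} {true}  (f , g) (h , i) = (λ e _ → f e) , λ k → g (k (h refl))
not-∨↔ {b} {false} (f , g) (h , i) = (λ _ c → ⊥-elim (false≢true (i c))) , λ _ → refl

-- `I` has to match `P1` only along `encode`, which suits both directions: the refutation reads `I`
-- off an arbitrary structure, and the construction defines the structure from `I`.
module Truth (M : Structure) (V : Valuation M) (I : Pr → Structure.Dom M → Bool)
             (agree : ∀ p x → Structure.P1 M (encode p) x ≡ I p x) where
  open Structure M
  open Valuation V
  open Semantics I P2 T public

  ≡↔ : ∀ {a b A} → a ≡ b → b ↔ᵇ A → a ↔ᵇ A
  ≡↔ refl h = h

  map↔ : ∀ {b A C} → (A → C) → (C → A) → b ↔ᵇ A → b ↔ᵇ C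
  map↔ f g (h , i) = (λ e → f (h e)) , λ c → i (g c)

  U₁↔ : ∀ u x → val1 (U₁ u) x ↔ᵇ ⟦ u ⟧ x
  U₁↔ (atom p) x = ≡↔ (trans (ok1 (un (encode p)) x) (agree p x)) ((λ e → e) , λ e → e)
  U₁↔ (¬ᵘ u) x   = ≡↔ (ok1 (neg (U₁ u)) x) (not↔ (U₁↔ u x))
  U₁↔ (u ∧ᵘ v) x = ≡↔ (ok1 (and (U₁ u) (U₁ v)) x) (∧↔ (U₁↔ u x) (U₁↔ v x))
  U₁↔ (u ∨ᵘ v) x = ≡↔ (ok1 (or (U₁ u) (U₁ v)) x) (∨↔ (U₁↔ u x) (U₁↔ v x))

  U₂↔ : ∀ u x y → eval2 M (U₂ u) x y ↔ᵇ ⟦ u ⟧ y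
  U₂↔ (atom p) x y = ≡↔ (agree p y) ((λ e → e) , λ e → e)
  U₂↔ (¬ᵘ u) x y   = not↔ (U₂↔ u x y)
  U₂↔ (u ∧ᵘ v) x y = ∧↔ (U₂↔ u x y) (U₂↔ v x y)
  U₂↔ (u ∨ᵘ v) x y = ∨↔ (U₂↔ u x y) (U₂↔ v x y)

  B₂↔ : ∀ b x y → eval2 M (B₂ b) x y ↔ᵇ ⟦ b ⟧₂ x y
  B₂↔ (snd u) x y  = U₂↔ u x y
  B₂↔ (rel i) x y  = (λ e → e) , λ e → e
  B₂↔ (tra i) x y  = (λ e → e) , λ e → e
  B₂↔ (b ∧ᵇ c) x y = ∧↔ (B₂↔ b x y) (B₂↔ c x y)

  guarded↔ : ∀ γ φ x {A} → val1 φ x ↔ᵇ A → val1 (or φ (neg (U₁ γ))) x ↔ᵇ (⟦ γ ⟧ x → A)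
  guarded↔ γ φ x h = ≡↔ (ok1 (or φ (neg (U₁ γ))) x)
    (≡↔ (cong (val1 φ x ∨_) (ok1 (neg (U₁ γ)) x)) (∨-not↔ h (U₁↔ γ x)))

  all↔ : ∀ φ {A : Dom → Set} → (∀ x → val1 φ x ↔ᵇ A x) → val0 (all φ) ↔ᵇ (∀ x → A x)
  all↔ φ h = (λ e x → proj₁ (h x) (Equivalence.to (ok0 (all φ)) e x))
           , λ k → Equivalence.from (ok0 (all φ)) λ x → proj₂ (h x) (k x)

  clause↔ : ∀ c → val0 (clause c) ↔ᵇ Clause⊨ c
  clause↔ (unary γ β) = all↔ _ λ x → guarded↔ γ (U₁ β) x (U₁↔ β x)
  clause↔ (forces γ δ ψ) =
    map↔ (λ h x y g d → h x g y d) (λ h x g y d → h x y g d)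
      (all↔ _ λ x → guarded↔ γ _ x
        ( (λ e y → proj₁ (body x y) (Equivalence.to (ok1 (all _) x) e y))
        , λ k → Equivalence.from (ok1 (all _) x) λ y → proj₂ (body x y) (k y)))
    where
    body : ∀ x y → eval2 M (or (neg (B₂ δ)) (B₂ ψ)) x y ↔ᵇ (⟦ δ ⟧₂ x y → ⟦ ψ ⟧₂ x y)
    body x y = not-∨↔ (B₂↔ ψ x y) (B₂↔ δ x y)
  clause↔ (needs γ δ) = all↔ _ λ x → guarded↔ γ _ x
    ( (λ e → let y , h = Equivalence.to (ok1 (ex (B₂ δ)) x) e in y , proj₁ (B₂↔ δ x y) h)
    , λ { (y , h) → Equivalence.from (ok1 (ex (B₂ δ)) x) (y , proj₂ (B₂↔ δ x y) h) })
  clause↔ (start γ) =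
      (λ e → let x , h = Equivalence.to (ok0 (ex (U₁ γ))) e in x , proj₁ (U₁↔ γ x) h)
    , λ { (x , h) → Equivalence.from (ok0 (ex (U₁ γ))) (x , proj₂ (U₁↔ γ x) h) }

  and↔ : ∀ φ ψ {A C} → val0 φ ↔ᵇ A → val0 ψ ↔ᵇ C → val0 (and φ ψ) ↔ᵇ (A × C)
  and↔ φ ψ a c = ≡↔ (ok0 (and φ ψ)) (∧↔ a c)

  Th↔ : ∀ t → val0 (sentence t) ↔ᵇ Th⊨ t
  Th↔ (cl c)   = clause↔ c
  Th↔ (s ∧ᵗ t) = and↔ _ _ (Th↔ s) (Th↔ t)
  Th↔ (⋀ [] f) = (λ _ a ()) , λ _ →
    trans (ok0 (or (nul 0) (neg (nul 0)))) (trans (cong (val0 (nul 0) ∨_) (ok0 (neg (nul 0)))) (em (val0 (nul 0))))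
    where em : ∀ b → b ∨ not b ≡ true
          em true  = refl
          em false = refl
  Th↔ (⋀ (x ∷ xs) f) = map↔ (λ { (h , k) a (here refl) → h ; (h , k) a (there i) → k a i })
    (λ h → h x (here refl) , λ a i → h a (there i)) (and↔ _ _ (Th↔ (f x)) (Th↔ (⋀ xs f)))

-- A `Valuation` gives a Boolean to quantified formulas too. Where existence of a witness is
-- decidable, these Booleans can be defined by recursion on the formula.
module Valuate (M : Structure)
  (search : (f : Structure.Dom M → Bool) → Dec (Σ (Structure.Dom M) λ a → f a ≡ true)) where
  open Structure M

  some every : (Dom → Bool) → Bool
  some f  = does (search f)
  every f = not (some λ a → not (f a))

  some⇔ : ∀ f → (some f ≡ true) ⇔ Σ Dom λ a → f a ≡ true
  some⇔ f with search f
  ... | yes h = mk⇔ (λ _ → h) (λ _ → refl)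
  ... | no n  = mk⇔ (λ ()) (λ h → ⊥-elim (n h))

  every⇔ : ∀ f → (every f ≡ true) ⇔ (∀ a → f a ≡ true)
  every⇔ f with search (λ a → not (f a))
  ... | yes (a , e) = mk⇔ (λ ()) λ h → ⊥-elim (clash (f a) e (h a))
    where clash : ∀ b → not b ≡ true → b ≡ true → ⊥
          clash true () _
          clash false _ ()
  ... | no n = mk⇔ (λ _ a → holds a (f a) refl) (λ _ → refl)
    where holds : ∀ a b → f a ≡ b → f a ≡ true
          holds a true e  = e
          holds a false e = ⊥-elim (n (a , cong not e))

  v1 : FL1 → Dom → Bool
  v1 (nul p) a   = P0 p
  v1 (un p) a    = P1 p a
  v1 (neg φ) a   = not (v1 φ a)
  v1 (and φ ψ) a = v1 φ a ∧ v1 ψ a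
  v1 (or φ ψ) a  = v1 φ a ∨ v1 ψ a
  v1 (ex ψ) a    = some (eval2 M ψ a)
  v1 (all ψ) a   = every (eval2 M ψ a)

  v0 : FL0 → Bool
  v0 (nul p)   = P0 p
  v0 (neg φ)   = not (v0 φ)
  v0 (and φ ψ) = v0 φ ∧ v0 ψ
  v0 (or φ ψ)  = v0 φ ∨ v0 ψ
  v0 (ex ψ)    = some (v1 ψ)
  v0 (all ψ)   = every (v1 ψ)

  valuation : Valuation M
  valuation = record { val1 = v1 ; val0 = v0 ; ok1 = k1 ; ok0 = k0 }
    where
    k1 : ∀ φ a → Clause1 M v1 φ a
    k1 (nul p) a   = refl
    k1 (un p) a    = refl
    k1 (neg φ) a   = refl
    k1 (and φ ψ) a = refl
    k1 (or φ ψ) a  = refl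
    k1 (ex ψ) a    = some⇔ _
    k1 (all ψ) a   = every⇔ _
    k0 : ∀ φ → Clause0 M v1 v0 φ
    k0 (nul p)   = refl
    k0 (neg φ)   = refl
    k0 (and φ ψ) = refl
    k0 (or φ ψ)  = refl
    k0 (ex ψ)    = some⇔ _
    k0 (all ψ)   = every⇔ _

-- The theory of the grid and of a counter machine

bools : List Bool
bools = false ∷ true ∷ []

∈bools : ∀ e → e ∈ bools
∈bools false = here refl
∈bools true  = there (here refl)

cols : List Col
cols = c0 ∷ c1 ∷ c2 ∷ c3 ∷ []

∈cols : ∀ l → l ∈ cols
∈cols c0 = here refl
∈cols c1 = there (here refl)
∈cols c2 = there (there (here refl))
∈cols c3 = there (there (there (here refl)))

-- `flip` is the column of the facing cell: the reflection p + m = 4k+3 reverses the order of the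
-- columns in a block of four.
rot flip : Col → Col
rot c0 = c1
rot c1 = c2
rot c2 = c3
rot c3 = c0
flip c0 = c3
flip c1 = c2
flip c2 = c1
flip c3 = c0

-- The argument is the parity of the lower row of a strip, so that two strips sharing a row never
-- have the same wide colour.
wide : Bool → Fin 3
wide false = suc zero
wide true  = suc (suc zero)

-- The colour of the square whose upper side leads from the given column to the following one. A
-- wide brick covers the squares that start at `c3`, `c0` and `c1`; the square starting at `c2` has
-- colour `T 0`.
band : Bool → Col → Fin 3
band e c2 = zero
band e _  = wide e

vert vert⁻ vert⁺ next : B
vert  = rel 0
vert⁻ = rel 1
vert⁺ = rel 2
next  = rel 3

lab : Bool → Col → U
lab e l = atom (fl (par e)) ∧ᵘ atom (fl (col l))

flag : Flag → U
flag f = atom (fl f)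

-- A cell that is both `c3` and `ext` ends its row, and there the path turns instead of continuing.
inside : Col → U
inside c3 = ¬ᵘ flag ext
inside _  = flag live

-- `vert⁻` arises from a step along the lower row followed by a vertical edge, `vert⁺` from a
-- vertical edge followed by a step along the upper row. In the existential clause a row edge gets
-- two colours: the first as lower side of a square in the strip above, the second as upper side of
-- one in the strip below.
cellTh : Bool → Col → Th
cellTh e l =
     cl (forces (lab e l) (snd (lab (not e) (flip l)) ∧ᵇ tra (wide e)) vert)
  ∧ᵗ cl (forces (lab e l) (snd (lab (not e) (flip (rot l))) ∧ᵇ tra (band e (flip (rot l)))) vert⁻)
  ∧ᵗ cl (forces (lab e l) (snd (lab (not e) (rot (flip l))) ∧ᵇ tra (band e (flip l))) vert⁺)
  ∧ᵗ cl (needs (flag live ∧ᵘ lab e l ∧ᵘ inside l)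
               (snd (lab e (rot l)) ∧ᵇ next ∧ᵇ tra (band e (flip (rot l))) ∧ᵇ tra (band (not e) l)))

gridTh : Bool → Th
gridTh e =
     ⋀ cols (cellTh e)
  -- The hand-over: the vertical edge at column `c2` of the upper row enters the `T 0` square, and
  -- the one at column `c3` leaves it for the next wide brick.
  ∧ᵗ cl (forces (lab e c1) (snd (lab (not e) c2) ∧ᵇ tra (wide e)) (tra zero))
  ∧ᵗ cl (forces (lab e c0) (snd (lab (not e) c3) ∧ᵇ tra zero) (tra (wide e)))
  ∧ᵗ cl (needs (flag live ∧ᵘ lab e c3 ∧ᵘ flag ext)
               (snd (lab (not e) c0 ∧ᵘ flag first ∧ᵘ ¬ᵘ flag ext) ∧ᵇ tra (wide e)))

-- `under` marks the cell that faces the first cell of the row below; the four cells after it are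
-- `ext`. Only the starting cell of row 0 is `first` and `ext` at once, so `origin` arises at
-- position 1 of row 0 and climbs from there.
flagTh : Th
flagTh =
     cl (forces (flag first) vert (snd (flag under)))
  ∧ᵗ cl (forces (¬ᵘ flag first) vert (snd (¬ᵘ flag under)))
  ∧ᵗ cl (forces (flag under ∨ᵘ flag ext) next (snd (flag ext)))
  ∧ᵗ cl (forces (¬ᵘ (flag under ∨ᵘ flag ext)) next (snd (¬ᵘ flag ext)))
  -- The tautology is the guard of an unconditional clause.
  ∧ᵗ cl (forces (flag first ∨ᵘ ¬ᵘ flag first) next (snd (¬ᵘ flag first)))
  ∧ᵗ cl (forces (flag first ∧ᵘ flag ext) next (snd (flag origin)))
  ∧ᵗ cl (forces (flag origin) vert (snd (flag origin)))
  ∧ᵗ cl (unary (flag nop) (flag live))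
  ∧ᵗ cl (unary (atom (at bad)) (¬ᵘ atom (at bad)))

-- Facing rows run in opposite directions and both show their 1s at the beginning, so a copied bit
-- has to be complemented.
swaps : ℕ → U → B → Th
swaps r γ δ =
     cl (forces (γ ∧ᵘ atom (bit r)) δ (snd (¬ᵘ atom (bit r))))
  ∧ᵗ cl (forces (γ ∧ᵘ ¬ᵘ atom (bit r)) δ (snd (atom (bit r))))

-- A growing register moves its border to the right in even rows and to the left in odd ones. The
-- same instruction hence needs the diagonal p + m = 4k+2 in one parity and p + m = 4k+4 in the
-- other.
toward away : ℕ → U
toward r = flag (par false) ∧ᵘ atom (inc r) ∨ᵘ flag (par true) ∧ᵘ atom (dec r)
away r   = flag (par true) ∧ᵘ atom (inc r) ∨ᵘ flag (par false) ∧ᵘ atom (dec r)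

-- A register owes no frame condition to itself, so the diagonal case repeats the liveness of `inc`.
frameTh : ℕ → ℕ → Th
frameTh r r′ = if r ≡ᵇ r′ then cl (unary (atom (inc r)) (flag live))
  else cl (unary (atom (inc r)) (atom (keep r′))) ∧ᵗ cl (unary (atom (dec r)) (atom (keep r′)))

registerTh : List ℕ → ℕ → Th
registerTh rs r =
     -- These cells have no facing cell on at least one of the three kinds of edges from below, so
     -- their bits are prescribed: 1 at the beginning of a row and 0 at its end.
     cl (unary (flag first) (atom (bit r)))
  ∧ᵗ cl (unary (flag under ∨ᵘ flag ext ∧ᵘ ¬ᵘ flag first) (¬ᵘ atom (bit r)))
  ∧ᵗ swaps r (atom (keep r)) vert
  ∧ᵗ swaps r (toward r) vert⁻
  ∧ᵗ swaps r (away r) vert⁺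
  -- When the register is 0, the centre is the first cell after the 1s in even rows and the last of
  -- the 1s in odd rows. Its bit therefore decides the zero test.
  ∧ᵗ cl (unary (flag origin ∧ᵘ flag (par false) ∧ᵘ atom (bit r)) (¬ᵘ atom (zer r)))
  ∧ᵗ cl (unary (flag origin ∧ᵘ flag (par false) ∧ᵘ ¬ᵘ atom (bit r)) (atom (zer r)))
  ∧ᵗ cl (unary (flag origin ∧ᵘ flag (par true) ∧ᵘ atom (bit r)) (atom (zer r)))
  ∧ᵗ cl (unary (flag origin ∧ᵘ flag (par true) ∧ᵘ ¬ᵘ atom (bit r)) (¬ᵘ atom (zer r)))
  -- Both truth values are passed on, which makes `zer` constant on the whole row; this informs even
  -- the cells before the centre, to which no edge leads back.
  ∧ᵗ cl (forces (atom (zer r)) next (snd (atom (zer r))))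
  ∧ᵗ cl (forces (¬ᵘ atom (zer r)) next (snd (¬ᵘ atom (zer r))))
  ∧ᵗ cl (unary (atom (inc r)) (flag live))
  ∧ᵗ cl (unary (atom (dec r)) (flag live))
  ∧ᵗ cl (unary (flag nop) (atom (keep r)))
  ∧ᵗ ⋀ rs (frameTh r)

baseTh : List ℕ → Th
baseTh rs = ⋀ bools gridTh ∧ᵗ flagTh ∧ᵗ ⋀ rs (registerTh rs)

-- Counter machines and their runs

data Ins : Set where
  inc : ℕ → PC → Ins
  dec : ℕ → PC → PC → Ins

reg : Ins → ℕ
reg (inc r _)   = r
reg (dec r _ _) = r

insTh : PC → Ins → Th
insTh p (inc r j) =
     cl (unary (atom (at p)) (atom (inc r)))
  ∧ᵗ cl (forces (atom (at p)) vert (snd (atom (at j))))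
  ∧ᵗ cl (forces (atom (at p)) next (snd (atom (at p))))
insTh p (dec r j k) =
     cl (unary (atom (at p) ∧ᵘ atom (zer r)) (flag nop))
  ∧ᵗ cl (unary (atom (at p) ∧ᵘ ¬ᵘ atom (zer r)) (atom (dec r)))
  ∧ᵗ cl (forces (atom (at p) ∧ᵘ atom (zer r)) vert (snd (atom (at k))))
  ∧ᵗ cl (forces (atom (at p) ∧ᵘ ¬ᵘ atom (zer r)) vert (snd (atom (at j))))
  ∧ᵗ cl (forces (atom (at p)) next (snd (atom (at p))))

startClause : PC → Clause
startClause s = start (lab false c0 ∧ᵘ flag first ∧ᵘ flag ext ∧ᵘ atom (at s))

Regs : Set
Regs = ℕ → ℕ

exec-dec : ℕ → PC → PC → Regs → ℕ → PC × Regs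
exec-dec r j k R zero    = k , R
exec-dec r j k R (suc v) = j , update R r v

exec : Maybe Ins → PC × Regs → PC × Regs
exec nothing c                    = c
exec (just (inc r j)) (p , R)     = j , update R r (suc (R r))
exec (just (dec r j k)) (p , R)   = exec-dec r j k R (R r)

module Run (δ : PC → Maybe Ins) where

  iter : ℕ → PC × Regs → PC × Regs
  iter zero c    = c
  iter (suc k) c = let d = iter k c in exec (δ (proj₁ d)) d

  -- One step adds at most 1. The bound keeps the border of every register within row k.
  iter-bound : ∀ k p r → proj₂ (iter k (p , λ _ → 0)) r ≤ k
  iter-bound zero p r = z≤n
  iter-bound (suc k) p r = go (δ (proj₁ c)) (iter-bound k p)
    where
    c = iter k (p , λ _ → 0)
    go : ∀ i → (∀ r → proj₂ c r ≤ k) → proj₂ (exec i c) r ≤ suc k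
    go nothing h = m≤n⇒m≤1+n (h r)
    go (just (inc r′ j)) h with r ≡ᵇ r′
    ... | false = m≤n⇒m≤1+n (h r)
    ... | true  = s≤s (h r′)
    go (just (dec r′ j j′)) h with proj₂ c r′ in e
    ... | zero  = m≤n⇒m≤1+n (h r)
    ... | suc v with r ≡ᵇ r′
    ...   | false = m≤n⇒m≤1+n (h r)
    ...   | true  = m≤n⇒m≤1+n (≤-trans (n≤1+n v) (≤-trans (≤-reflexive (sym e)) (h r′)))

-- Arithmetic of rows and columns

par-of : ℕ → Bool
par-of zero    = false
par-of (suc k) = not (par-of k)

-- The value R of a register is displayed in row k by the cells p satisfying
-- p < 2k+1+R (even rows) or p+R < 2k+1 (odd rows).
shows : Bool → ℕ → ℕ → ℕ → Bool
shows false k p R = p <ᵇ suc (k + k) + R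
shows true k p R  = p + R <ᵇ suc (k + k)

-- The position of `origin`. The centres of rows k and k+1 add up to 4k+3, so they face each other.
centre : Bool → ℕ → ℕ
centre false k = suc (k + k)
centre true k  = k + k

<ᵇ-shift : ∀ c x y → (x <ᵇ y) ≡ (c + x <ᵇ c + y)
<ᵇ-shift zero x y    = refl
<ᵇ-shift (suc c) x y = <ᵇ-shift c x y

<ᵇ-balance : ∀ c c′ {x y x′ y′} → c + x ≡ c′ + x′ → c + y ≡ c′ + y′ → (x <ᵇ y) ≡ (x′ <ᵇ y′)
<ᵇ-balance c c′ {x} {y} {x′} {y′} p q =
  trans (<ᵇ-shift c x y) (trans (cong₂ _<ᵇ_ p q) (sym (<ᵇ-shift c′ x′ y′)))

not-<ᵇ : ∀ x y → not (x <ᵇ y) ≡ (y <ᵇ suc x)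
not-<ᵇ x zero          = refl
not-<ᵇ zero (suc y)    = refl
not-<ᵇ (suc x) (suc y) = not-<ᵇ x y

-- The complement of p < 2k+1+R is 2k+1+R < p+1; adding m + R′ to both sides and cancelling 2k+1+R
-- leaves m + R′ < 2k+3. An unchanged register gives the vertical edges, a change by 1 the two
-- diagonals.
shows-even : ∀ k p m R R′ → p + m + R′ ≡ 3 + k * 4 + R →
             shows true (suc k) m R′ ≡ not (shows false k p R)
shows-even k p m R R′ h = sym (trans (not-<ᵇ p (suc (k + k) + R)) (<ᵇ-balance (m + R′) (suc (k + k) + R) {x = suc (k + k) + R} {x′ = m + R′}
  (+-comm (m + R′) _)
  (trans (lhs p m R′) (trans (cong suc h) (rhs k R)))))
  where
  lhs : ∀ p m R′ → m + R′ + suc p ≡ suc (p + m + R′)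
  lhs = solve-∀
  rhs : ∀ k R → suc (3 + k * 4 + R) ≡ suc (k + k) + R + suc (suc k + suc k)
  rhs = solve-∀

shows-odd : ∀ k p m R R′ → p + m + R ≡ 3 + k * 4 + R′ →
            shows false (suc k) m R′ ≡ not (shows true k p R)
shows-odd k p m R R′ h = sym (trans (not-<ᵇ (p + R) (suc (k + k))) (<ᵇ-balance m (suc (k + k)) {x = suc (k + k)} {x′ = m}
  (+-comm m _)
  (trans (lhs p m R) (trans (cong suc h) (rhs k R′)))))
  where
  lhs : ∀ p m R → m + suc (p + R) ≡ suc (p + m + R)
  lhs = solve-∀
  rhs : ∀ k R′ → suc (3 + k * 4 + R′) ≡ suc (k + k) + (suc (suc k + suc k) + R′)
  rhs = solve-∀

<ᵇ-true : ∀ {x y} → x < y → (x <ᵇ y) ≡ true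
<ᵇ-true (s≤s z≤n)       = refl
<ᵇ-true (s≤s (s≤s p)) = <ᵇ-true (s≤s p)

<ᵇ-false : ∀ {x y} → y ≤ x → (x <ᵇ y) ≡ false
<ᵇ-false z≤n     = refl
<ᵇ-false (s≤s p) = <ᵇ-false p

len : ℕ → ℕ
len k = suc k * 4

shows-first : ∀ e k R → R ≤ k → shows e k 0 R ≡ true
shows-first false k R _ = refl
shows-first true k R h  = <ᵇ-true (s≤s (≤-trans h (m≤m+n k k)))

double≤ : ∀ k → k + k ≤ k * 4
double≤ k = subst (k + k ≤_) (e k) (m≤m+n (k + k) (k + k))
  where e : ∀ k → k + k + (k + k) ≡ k * 4
        e = solve-∀

shows-under : ∀ k m R → R ≤ suc k → 3 + k * 4 ≤ m → shows (par-of (suc k)) (suc k) m R ≡ false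
shows-under k m R h q with par-of k in eq
... | false = <ᵇ-false (≤-trans (≤-trans (≤-reflexive (e k)) (+-monoʳ-≤ 3 (double≤ k))) (≤-trans q (m≤m+n m R)))
  where e : ∀ k → suc (suc k + suc k) ≡ 3 + (k + k)
        e = solve-∀
-- The odd row index is written as k+1, so the row in question is k+2 and its border is at most
-- 2(k+2)+1+(k+2) = 3k+7, below the position 4k+7 of the last facing cell or equal to it.
shows-under (suc k) m R h q | true = <ᵇ-false (≤-trans (+-monoʳ-≤ (suc (suc (suc k) + suc (suc k))) h)
  (≤-trans (≤-reflexive (e k)) (≤-trans (+-monoʳ-≤ 7 (triple k)) q)))
  where e : ∀ k → suc (suc (suc k) + suc (suc k)) + suc (suc k) ≡ 7 + (k + k + k)
        e = solve-∀
        triple : ∀ k → k + k + k ≤ k * 4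
        triple k = subst (k + k + k ≤_) (f k) (m≤m+n (k + k + k) k)
          where f : ∀ k → k + k + k + k ≡ k * 4
                f = solve-∀

-- Position 0 is excluded because in row 0 it belongs to the extension and yet shows 1.
shows-ext : ∀ k m R → R ≤ k → 0 < m → k * 4 ≤ m → shows (par-of k) k m R ≡ false
shows-ext zero (suc m) zero z≤n _ _ = refl
shows-ext (suc k) m R h _ q = shows-under k m R h (≤-trans (n≤1+n _) q)

shows-centre-even : ∀ k R → shows false k (centre false k) R ≡ not (R ≡ᵇ 0)
shows-centre-even k R = trans (<ᵇ-balance 0 (suc (k + k)) (sym (+-identityʳ _)) refl) (e R)
  where e : ∀ R → (0 <ᵇ R) ≡ not (R ≡ᵇ 0)
        e zero    = refl
        e (suc R) = refl

shows-centre-odd : ∀ k R → shows true k (centre true k) R ≡ (R ≡ᵇ 0)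
shows-centre-odd k R = trans (<ᵇ-balance 0 (k + k) {y′ = 1} refl (+-comm 1 (k + k))) (e R)
  where e : ∀ R → (R <ᵇ 1) ≡ (R ≡ᵇ 0)
        e zero    = refl
        e (suc R) = refl

column : ℕ → Col
column zero    = c0
column (suc p) = rot (column p)

flip-flip : ∀ l → flip (flip l) ≡ l
flip-flip c0 = refl
flip-flip c1 = refl
flip-flip c2 = refl
flip-flip c3 = refl

column-4k : ∀ k i → column (k * 4 + i) ≡ column i
column-4k zero i    = refl
column-4k (suc k) i = trans (r4 (column (k * 4 + i))) (column-4k k i)
  where r4 : ∀ l → rot (rot (rot (rot l))) ≡ l
        r4 c0 = refl
        r4 c1 = refl
        r4 c2 = refl
        r4 c3 = refl

column-mirror : ∀ k p m → p + m ≡ 3 + k * 4 → column p ≡ flip (column m)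
column-mirror k p zero h = trans (cong column (trans (sym (+-identityʳ p)) (trans h (+-comm 3 _)))) (column-4k k 3)
column-mirror k p (suc m) h = unrot (column p) (column m)
  (column-mirror k (suc p) m (trans (sym (+-suc p m)) h))
  where unrot : ∀ a b → rot a ≡ flip b → a ≡ flip (rot b)
        unrot c0 c2 _ = refl
        unrot c1 c1 _ = refl
        unrot c2 c0 _ = refl
        unrot c3 c3 _ = refl
        unrot c0 c0 ()
        unrot c0 c1 ()
        unrot c0 c3 ()
        unrot c1 c0 ()
        unrot c1 c2 ()
        unrot c1 c3 ()
        unrot c2 c1 ()
        unrot c2 c2 ()
        unrot c2 c3 ()
        unrot c3 c0 ()
        unrot c3 c1 ()
        unrot c3 c2 ()

shows-suc : ∀ k p m R R′ → (par-of k ≡ false → p + m + R′ ≡ 3 + k * 4 + R) →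
            (par-of k ≡ true → p + m + R ≡ 3 + k * 4 + R′) →
            shows (par-of (suc k)) (suc k) m R′ ≡ not (shows (par-of k) k p R)
shows-suc k p m R R′ f g with par-of k
... | false = shows-even k p m R R′ (f refl)
... | true  = shows-odd k p m R R′ (g refl)

≡ᵇ-false-sym : ∀ x y → (x ≡ᵇ y) ≡ false → (y ≡ᵇ x) ≡ false
≡ᵇ-false-sym zero (suc y) _        = refl
≡ᵇ-false-sym (suc x) zero _        = refl
≡ᵇ-false-sym (suc x) (suc y) h     = ≡ᵇ-false-sym x y h

≡ᵇ-true : ∀ x y → (x ≡ᵇ y) ≡ true → x ≡ y
≡ᵇ-true zero zero _       = refl
≡ᵇ-true (suc x) (suc y) h = cong suc (≡ᵇ-true x y h)

≡ᵇ-refl : ∀ x → (x ≡ᵇ x) ≡ true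
≡ᵇ-refl zero    = refl
≡ᵇ-refl (suc x) = ≡ᵇ-refl x

clash : ∀ {b : Bool} {A : Set} → b ≡ false → b ≡ true → A
clash refl ()

≢true⇒false : ∀ {b} → ¬ (b ≡ true) → b ≡ false
≢true⇒false {true} n  = ⊥-elim (n refl)
≢true⇒false {false} _ = refl

false⇒≢true : ∀ {b} → b ≡ false → ¬ (b ≡ true)
false⇒≢true refl ()

iff⇒≡ : ∀ {a b} → (a ≡ true → b ≡ true) → (¬ (a ≡ true) → ¬ (b ≡ true)) → b ≡ a
iff⇒≡ {true} f _  = f refl
iff⇒≡ {false} _ g = ≢true⇒false (g λ ())

-- From position 4k on there is a single block of four, and its only cell of column `c3` ends the
-- row. Elsewhere in a row the path can go straight on.
no-turn : ∀ k p → column p ≡ c3 → k * 4 ≤ p → suc p < len k → ⊥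
no-turn k p h q s with m≤n⇒∃[o]m+o≡n q
... | i , refl = go i (trans (sym (column-4k k i)) h)
    (+-cancelˡ-< (k * 4) i 3 (subst (k * 4 + i <_) (+-comm 3 (k * 4)) (s≤s⁻¹ s)))
  where go : ∀ i → column i ≡ c3 → i < 3 → ⊥
        go 0 () _
        go 1 () _
        go 2 () _
        go (suc (suc (suc i))) _ (s≤s (s≤s (s≤s ())))

centre-mirror : ∀ k → centre (par-of k) k + centre (par-of (suc k)) (suc k) ≡ 3 + k * 4
centre-mirror k with par-of k
... | false = e k
  where e : ∀ k → suc (k + k) + (suc k + suc k) ≡ 3 + k * 4
        e = solve-∀
... | true = e k
  where e : ∀ k → k + k + suc (suc k + suc k) ≡ 3 + k * 4
        e = solve-∀

centre< : ∀ k → centre (par-of k) k < len k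
centre< k with par-of k
... | false = s≤s (s≤s (≤-trans (double≤ k) (m≤n+m (k * 4) 2)))
... | true  = s≤s (≤-trans (double≤ k) (m≤n+m (k * 4) 3))

-- Every structure satisfying the theory contains the run of the machine

-- Every element z k p is reached along one path, so no confluence of witnesses is needed.
module Refute {D : Set} (I : Pr → D → Bool) (J : ℕ → D → D → Bool) (T : Fin 3 → D → D → Bool)
  (T-trans : ∀ i x y w → T i x y ≡ true → T i y w ≡ true → T i x w ≡ true)
  (rs : List ℕ) (base : Semantics.Th⊨ I J T (baseTh rs))
  (δ : PC → Maybe Ins)
  (ins⊨ : ∀ p i → δ p ≡ just i → Semantics.Th⊨ I J T (insTh p i))
  (reg∈ : ∀ p i → δ p ≡ just i → reg i ∈ rs)
  (s : PC) (start⊨ : Semantics.Clause⊨ I J T (startClause s)) where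

  open Semantics I J T
  open Run δ

  ahead-guard turn-guard : Bool → Col → U
  ahead-guard e l = flag live ∧ᵘ lab e l ∧ᵘ inside l
  turn-guard e l = flag live ∧ᵘ lab e l ∧ᵘ flag ext

  abstract
    -- The value `x` off the guard makes the function total, so all cells can be defined before they
    -- are known to satisfy the guard.
    ahead : Bool → Col → D → D
    ahead e l x with ⟦ ahead-guard e l ⟧? x
    ... | yes g = proj₁ (proj₂ (proj₂ (proj₂ (proj₁ (proj₁ base e (∈bools e)) l (∈cols l)))) x g)
    ... | no _  = x

    ahead-ok : ∀ e l x → ⟦ ahead-guard e l ⟧ x → let y = ahead e l x in
      ⟦ lab e (rot l) ⟧ y × ⟦ next ⟧₂ x y × T (band e (flip (rot l))) x y ≡ true × T (band (not e) l) x y ≡ true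
    ahead-ok e l x g with ⟦ ahead-guard e l ⟧? x
    ... | yes g = proj₂ (proj₂ (proj₂ (proj₂ (proj₁ (proj₁ base e (∈bools e)) l (∈cols l)))) x g)
    ... | no n  = ⊥-elim (n g)

    turn : Bool → D → D
    turn e x with ⟦ turn-guard e c3 ⟧? x
    ... | yes g = proj₁ (proj₂ (proj₂ (proj₂ (proj₁ base e (∈bools e)))) x g)
    ... | no _  = x

    turn-ok : ∀ e x → ⟦ turn-guard e c3 ⟧ x → let y = turn e x in
      (⟦ lab (not e) c0 ⟧ y × ⟦ flag first ⟧ y × ⟦ ¬ᵘ flag ext ⟧ y) × T (wide e) x y ≡ true
    turn-ok e x g with ⟦ turn-guard e c3 ⟧? x
    ... | yes g = proj₂ (proj₂ (proj₂ (proj₂ (proj₁ base e (∈bools e)))) x g)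
    ... | no n  = ⊥-elim (n g)

  walk : Bool → ℕ → D → D
  walk e zero x    = x
  walk e (suc p) x = ahead e (column p) (walk e p x)

  row : ℕ → D
  row zero    = proj₁ start⊨
  row (suc k) = turn (par-of k) (walk (par-of k) (3 + k * 4) (row k))

  z : ℕ → ℕ → D
  z k p = walk (par-of k) p (row k)

  pc : ℕ → PC
  pc k = proj₁ (iter k (s , λ _ → 0))

  R : ℕ → Regs
  R k = proj₂ (iter k (s , λ _ → 0))

  module Reg {r} (r∈ : r ∈ rs) where
    t0  = proj₂ (proj₂ base) r r∈
    t2  = proj₂ (proj₂ t0)
    t5  = proj₂ (proj₂ (proj₂ t2))
    t9  = proj₂ (proj₂ (proj₂ (proj₂ t5)))
    t11 = proj₂ (proj₂ t9)
    t14 = proj₂ (proj₂ (proj₂ t11))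

    first-bit  = proj₁ t0
    border-bit = proj₁ (proj₂ t0)
    inc-live   = proj₁ t11
    dec-live   = proj₁ (proj₂ t11)
    nop-keep   = proj₁ (proj₂ (proj₂ t11))

    swapped : ∀ {γ δ} → Th⊨ (swaps r γ δ) → ∀ x y → ⟦ γ ⟧ x → ⟦ δ ⟧₂ x y →
              I (bit r) y ≡ not (I (bit r) x)
    swapped (f , g) x y h d with I (bit r) x in e
    ... | true  = ≢true⇒false (f x y (h , e) d)
    ... | false = g x y (h , false⇒≢true e) d

    swap  = swapped {δ = vert} (proj₁ t2)
    swap⁻ = swapped {δ = vert⁻} (proj₁ (proj₂ t2))
    swap⁺ = swapped {δ = vert⁺} (proj₁ (proj₂ (proj₂ t2)))

    zero-next : ∀ x y → ⟦ next ⟧₂ x y → I (zer r) y ≡ I (zer r) x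
    zero-next x y n = iff⇒≡ (λ h → proj₁ t9 x y h n) (λ h → proj₁ (proj₂ t9) x y h n)

    zero-centre : ∀ e x → ⟦ flag origin ⟧ x → ⟦ flag (par e) ⟧ x →
                  I (zer r) x ≡ (if e then I (bit r) x else not (I (bit r) x))
    zero-centre false x o p with I (bit r) x in b
    ... | true  = ≢true⇒false (proj₁ t5 x (o , p , b))
    ... | false = proj₁ (proj₂ t5) x (o , p , false⇒≢true b)
    zero-centre true x o p with I (bit r) x in b
    ... | true  = proj₁ (proj₂ (proj₂ t5)) x (o , p , b)
    ... | false = ≢true⇒false (proj₁ (proj₂ (proj₂ (proj₂ t5))) x (o , p , false⇒≢true b))

    frame : ∀ r′ → r′ ∈ rs → (r ≡ᵇ r′) ≡ false → ∀ x →
            (I (inc r) x ≡ true → I (keep r′) x ≡ true) × (I (dec r) x ≡ true → I (keep r′) x ≡ true)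
    frame r′ r′∈ ne x with r ≡ᵇ r′ | t14 r′ r′∈
    frame r′ r′∈ refl x | false | f , g = f x , g x

  flags : Th⊨ flagTh
  flags = proj₁ (proj₂ base)

  under-vert : ∀ x y → ⟦ vert ⟧₂ x y → I (fl under) y ≡ I (fl first) x
  under-vert x y v = iff⇒≡ (λ h → proj₁ flags x y h v) (λ h → proj₁ (proj₂ flags) x y h v)

  ext-next⁺ : ∀ x y → ⟦ next ⟧₂ x y → ⟦ flag under ∨ᵘ flag ext ⟧ x → ⟦ flag ext ⟧ y
  ext-next⁺ x y n h = proj₁ (proj₂ (proj₂ flags)) x y h n

  ext-next⁻ : ∀ x y → ⟦ next ⟧₂ x y → ¬ ⟦ flag under ∨ᵘ flag ext ⟧ x → ¬ ⟦ flag ext ⟧ y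
  ext-next⁻ x y n h = proj₁ (proj₂ (proj₂ (proj₂ flags))) x y h n

  first-next : ∀ x y → ⟦ next ⟧₂ x y → ¬ ⟦ flag first ⟧ y
  first-next x y n = proj₁ (proj₂ (proj₂ (proj₂ (proj₂ flags)))) x y em n
    where em : ⟦ flag first ∨ᵘ ¬ᵘ flag first ⟧ x
          em with ⟦ flag first ⟧? x
          ... | yes h = inj₁ h
          ... | no h  = inj₂ h

  origin-next : ∀ x y → ⟦ next ⟧₂ x y → ⟦ flag first ∧ᵘ flag ext ⟧ x → ⟦ flag origin ⟧ y
  origin-next x y n h = proj₁ (proj₂ (proj₂ (proj₂ (proj₂ (proj₂ flags))))) x y h n

  origin-vert : ∀ x y → ⟦ vert ⟧₂ x y → ⟦ flag origin ⟧ x → ⟦ flag origin ⟧ y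
  origin-vert x y n h = proj₁ (proj₂ (proj₂ (proj₂ (proj₂ (proj₂ (proj₂ flags)))))) x y h n

  nop-live : ∀ x → ⟦ flag nop ⟧ x → ⟦ flag live ⟧ x
  nop-live = proj₁ (proj₂ (proj₂ (proj₂ (proj₂ (proj₂ (proj₂ (proj₂ flags)))))))

  never-bad : ∀ x → ¬ I (at bad) x ≡ true
  never-bad x h = proj₂ (proj₂ (proj₂ (proj₂ (proj₂ (proj₂ (proj₂ (proj₂ flags))))))) x h h

  alive : ∀ p i → δ p ≡ just i → ∀ x → I (at p) x ≡ true → ⟦ flag live ⟧ x
  alive p i@(inc r j) e x h = Reg.inc-live (reg∈ p i e) x (proj₁ (ins⊨ p i e) x h)
  alive p i@(dec r j k) e x h with ⟦ atom (zer r) ⟧? x | ins⊨ p i e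
  ... | yes o | f , _     = nop-live x (f x (h , o))
  ... | no o  | _ , g , _ = Reg.dec-live (reg∈ p i e) x (g x (h , o))

  at-next : ∀ p i → δ p ≡ just i → ∀ x y → ⟦ next ⟧₂ x y → I (at p) x ≡ true → I (at p) y ≡ true
  at-next p i@(inc r j) e x y n h   = proj₂ (proj₂ (ins⊨ p i e)) x y h n
  at-next p i@(dec r j k) e x y n h = proj₂ (proj₂ (proj₂ (proj₂ (ins⊨ p i e)))) x y h n

  Edge : ℕ → ℕ → Set
  Edge k p = let e = par-of k ; l = column p ; x = z k p ; y = z k (suc p) in
    ⟦ next ⟧₂ x y × T (band e (flip (rot l))) x y ≡ true × T (band (not e) l) x y ≡ true

  record Cell (k p : ℕ) : Set where
    field
      lab-ok : ⟦ lab (par-of k) (column p) ⟧ (z k p)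
      at-ok  : I (at (pc k)) (z k p) ≡ true
      ext⁺   : k * 4 ≤ p → ⟦ flag ext ⟧ (z k p)
      ext⁻   : p < k * 4 → ¬ ⟦ flag ext ⟧ (z k p)
  open Cell

  inside-ok : ∀ l x → ⟦ flag live ⟧ x → (l ≡ c3 → ¬ ⟦ flag ext ⟧ x) → ⟦ inside l ⟧ x
  inside-ok c0 x h _ = h
  inside-ok c1 x h _ = h
  inside-ok c2 x h _ = h
  inside-ok c3 x _ n = n refl

  module _ (k : ℕ) (i : Ins) (δk : δ (pc k) ≡ just i) where

    edge : ∀ p → Cell k p → suc p < len k →
           ⟦ lab (par-of k) (column (suc p)) ⟧ (z k (suc p)) × Edge k p
    edge p c b = ahead-ok (par-of k) (column p) (z k p)
      ( l , lab-ok c , inside-ok (column p) _ l λ e h → not-ext e h )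
      where
      l : ⟦ flag live ⟧ (z k p)
      l = alive (pc k) i δk _ (at-ok c)
      not-ext : column p ≡ c3 → ¬ ⟦ flag ext ⟧ (z k p)
      not-ext e with p <? k * 4
      ... | yes q = ext⁻ c q
      ... | no q  = λ _ → no-turn k p e (≮⇒≥ q) b

    advance : ∀ p → (c : Cell k p) → (b : suc p < len k) →
              (k * 4 ≤ suc p → ⟦ flag under ∨ᵘ flag ext ⟧ (z k p)) →
              (suc p < k * 4 → ¬ ⟦ flag under ∨ᵘ flag ext ⟧ (z k p)) → Cell k (suc p)
    advance p c b f g = record
      { lab-ok = proj₁ (edge p c b)
      ; at-ok  = at-next (pc k) i δk _ _ n (at-ok c)
      ; ext⁺   = λ q → ext-next⁺ _ _ n (f q)
      ; ext⁻   = λ q → ext-next⁻ _ _ n (g q) }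
      where n = proj₁ (proj₂ (edge p c b))

  -- What holds of a complete row. Completeness is guaranteed only for rows whose state has an
  -- instruction; in the row where the machine halts only the first cell is at hand.
  record Frame (k : ℕ) : Set where
    field
      cell    : ∀ p → p < len k → Cell k p
      edges   : ∀ p → suc p < len k → Edge k p
      first⁺  : ⟦ flag first ⟧ (z k 0)
      first⁻  : ∀ p → suc p < len k → ¬ ⟦ flag first ⟧ (z k (suc p))
      centred : ⟦ flag origin ⟧ (z k (centre (par-of k) k))
      bits    : ∀ {r} → r ∈ rs → ∀ p → p < len k → I (bit r) (z k p) ≡ shows (par-of k) k p (R k r)
  open Frame

  R-bound : ∀ k r → R k r ≤ k
  R-bound k = iter-bound k s

  frame0 : ∀ i → δ (pc 0) ≡ just i → Frame 0
  frame0 i δ0 = record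
    { cell    = cells
    ; edges   = λ p b → proj₂ (edge 0 i δ0 p (cells p (<-trans (n<1+n p) b)) b)
    ; first⁺  = proj₁ (proj₂ st)
    ; first⁻  = λ p b → first-next _ _ (nx p b)
    ; centred = origin-next _ _ (nx 0 (s≤s (s≤s z≤n))) (proj₁ (proj₂ st) , proj₁ (proj₂ (proj₂ st)))
    ; bits    = bits0 }
    where
    st = proj₂ start⊨
    cells : ∀ p → p < 4 → Cell 0 p
    cells zero _ = record { lab-ok = proj₁ st ; at-ok = proj₂ (proj₂ (proj₂ st))
                          ; ext⁺ = λ _ → proj₁ (proj₂ (proj₂ st)) ; ext⁻ = λ () }
    cells (suc p) b = advance 0 i δ0 p c b (λ _ → inj₂ (ext⁺ c z≤n)) (λ ())
      where c = cells p (<-trans (n<1+n p) b)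
    nx : ∀ p → suc p < 4 → ⟦ next ⟧₂ (z 0 p) (z 0 (suc p))
    nx p b = proj₁ (proj₂ (edge 0 i δ0 p (cells p (<-trans (n<1+n p) b)) b))
    bits0 : ∀ {r} → r ∈ rs → ∀ p → p < 4 → I (bit r) (z 0 p) ≡ shows false 0 p 0
    bits0 r∈ zero b    = Reg.first-bit r∈ _ (proj₁ (proj₂ st))
    bits0 r∈ (suc p) b = ≢true⇒false (Reg.border-bit r∈ _
      (inj₂ (ext⁺ (cells (suc p) b) z≤n , first-next _ _ (nx p b))))

  cells-rule : ∀ e l → Th⊨ (cellTh e l)
  cells-rule e l = proj₁ (proj₁ base e (∈bools e)) l (∈cols l)

  widen : ∀ e x y → ⟦ lab e c0 ⟧ x → ⟦ lab (not e) c3 ⟧ y → T zero x y ≡ true → T (wide e) x y ≡ true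
  widen e x y a b t = proj₁ (proj₂ (proj₂ (proj₁ base e (∈bools e)))) x y a (b , t)

  narrow : ∀ e x y → ⟦ lab e c1 ⟧ x → ⟦ lab (not e) c2 ⟧ y → T (wide e) x y ≡ true → T zero x y ≡ true
  narrow e x y a b t = proj₁ (proj₂ (proj₁ base e (∈bools e))) x y a (b , t)

  mirror< : ∀ k p m → p + m ≡ 3 + k * 4 → p < len k
  mirror< k p m h = s≤s (≤-trans (m≤m+n p m) (≤-reflexive h))

  -- The wide colour is kept at every column so that one rule of `cellTh` yields `vert`. Columns
  -- `c2` and `c3` carry `T 0` in addition, as the two vertical sides of its square.
  record Vert (k m : ℕ) : Set where
    field
      wide-ok : ∀ p → p + m ≡ 3 + k * 4 → T (wide (par-of k)) (z k p) (z (suc k) m) ≡ true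
      two-ok  : ∀ p → p + m ≡ 3 + k * 4 → column m ≡ c2 → T zero (z k p) (z (suc k) m) ≡ true
      three-ok : ∀ p → p + m ≡ 3 + k * 4 → column m ≡ c3 → T zero (z k p) (z (suc k) m) ≡ true
  open Vert

  band-ok : ∀ k m p → Vert k m → p + m ≡ 3 + k * 4 →
            T (band (par-of k) (column m)) (z k p) (z (suc k) m) ≡ true
  band-ok k m p v h = go (column m) refl
    where
    go : ∀ c → column m ≡ c → T (band (par-of k) c) (z k p) (z (suc k) m) ≡ true
    go c0 _ = wide-ok v p h
    go c1 _ = wide-ok v p h
    go c2 q = two-ok v p h q
    go c3 _ = wide-ok v p h

  module NextRow (k : ℕ) (i : Ins) (δk : δ (pc k) ≡ just i) (Fr : Frame k) where

    e = par-of k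

    iter-suc : iter (suc k) (s , λ _ → 0) ≡ exec (just i) (pc k , R k)
    iter-suc = cong (λ d → exec d (pc k , R k)) δk

    zero-ok : ∀ {r} → r ∈ rs → ∀ p → p < len k → I (zer r) (z k p) ≡ (R k r ≡ᵇ 0)
    zero-ok {r} r∈ p b = trans (const p b) (trans (sym (const (centre e k) (centre< k)))
      (trans (Reg.zero-centre r∈ e _ (centred Fr) (proj₁ (lab-ok (cell Fr _ (centre< k)))))
        (at-centre e (bits Fr r∈ _ (centre< k)))))
      where
      const : ∀ p → p < len k → I (zer r) (z k p) ≡ I (zer r) (z k 0)
      const zero _    = refl
      const (suc p) b = trans (Reg.zero-next r∈ _ _ (proj₁ (edges Fr p b))) (const p (<-trans (n<1+n p) b))
      at-centre : ∀ e {b} → b ≡ shows e k (centre e k) (R k r) →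
                  (if e then b else not b) ≡ (R k r ≡ᵇ 0)
      at-centre false refl = trans (cong not (shows-centre-even k (R k r))) (not-involutive _)
      at-centre true refl = shows-centre-odd k (R k r)

    data Change (r : ℕ) : Set where
      kept : (∀ p → p < len k → I (keep r) (z k p) ≡ true) → R (suc k) r ≡ R k r → Change r
      up   : (∀ p → p < len k → I (inc r) (z k p) ≡ true) → R (suc k) r ≡ suc (R k r) → Change r
      down : (∀ p → p < len k → I (dec r) (z k p) ≡ true) → R k r ≡ suc (R (suc k) r) → Change r

    at-row : ∀ p → p < len k → I (at (pc k)) (z k p) ≡ true
    at-row p b = at-ok (cell Fr p b)

    -- A register other than that of the instruction is kept by `frameTh`; a decrement at 0 is a
    -- `nop`, which keeps all registers.
    change : ∀ {r} → r ∈ rs → Change r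
    change {r} r∈ = go i (ins⊨ (pc k) i δk) (reg∈ (pc k) i δk) iter-suc
      where
      go : ∀ i → Th⊨ (insTh (pc k) i) → reg i ∈ rs →
           iter (suc k) (s , λ _ → 0) ≡ exec (just i) (pc k , R k) → Change r
      go (inc r₀ j) (f , _) r₀∈ eq with r ≡ᵇ r₀ in q
      ... | false = kept (λ p b → proj₁ (Reg.frame r₀∈ r r∈ (≡ᵇ-false-sym r r₀ q) _) (f _ (at-row p b)))
                         (trans (cong (λ c → proj₂ c r) eq) (cong (λ b → if b then suc (R k r₀) else R k r) q))
      ... | true with ≡ᵇ-true r r₀ q
      ...   | refl = up (λ p b → f _ (at-row p b))
                        (trans (cong (λ c → proj₂ c r) eq) (cong (λ b → if b then suc (R k r) else R k r) q))
      go (dec r₀ j j′) (f , g , _) r₀∈ eq with R k r₀ in v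
      ... | zero = kept (λ p b → Reg.nop-keep r∈ _ (f _ (at-row p b , trans (zero-ok r₀∈ p b) (cong (_≡ᵇ 0) v))))
                        (cong (λ c → proj₂ c r) eq)
      ... | suc w with r ≡ᵇ r₀ in q
      ...   | false = kept (λ p b → proj₂ (Reg.frame r₀∈ r r∈ (≡ᵇ-false-sym r r₀ q) _)
                              (g _ (at-row p b , false⇒≢true (trans (zero-ok r₀∈ p b) (cong (_≡ᵇ 0) v)))))
                           (trans (cong (λ c → proj₂ c r) eq) (cong (λ b → if b then w else R k r) q))
      ...   | true with ≡ᵇ-true r r₀ q
      ...     | refl = down (λ p b → g _ (at-row p b , false⇒≢true (trans (zero-ok r₀∈ p b) (cong (_≡ᵇ 0) v))))
                            (trans v (cong suc (sym (trans (cong (λ c → proj₂ c r) eq)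
                              (cong (λ b → if b then w else R k r) q)))))

    at-vert : ∀ p y → p < len k → ⟦ vert ⟧₂ (z k p) y → I (at (pc (suc k))) y ≡ true
    at-vert p y b v = go i (ins⊨ (pc k) i δk) (reg∈ (pc k) i δk) iter-suc
      where
      go : ∀ i → Th⊨ (insTh (pc k) i) → reg i ∈ rs →
           iter (suc k) (s , λ _ → 0) ≡ exec (just i) (pc k , R k) → I (at (pc (suc k))) y ≡ true
      go (inc r₀ j) (_ , f , _) _ eq rewrite cong proj₁ eq = f _ _ (at-row p b) v
      go (dec r₀ j j′) (_ , _ , f , g , _) r₀∈ eq with R k r₀ in w
      ... | zero rewrite cong proj₁ eq =
            f _ _ (at-row p b , trans (zero-ok r₀∈ p b) (cong (_≡ᵇ 0) w)) v
      ... | suc _ rewrite cong proj₁ eq =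
            g _ _ (at-row p b , false⇒≢true (trans (zero-ok r₀∈ p b) (cong (_≡ᵇ 0) w))) v

    link : ∀ p m → p + m ≡ 3 + k * 4 → ⟦ lab (not e) (column m) ⟧ (z (suc k) m) → Vert k m →
           ⟦ vert ⟧₂ (z k p) (z (suc k) m)
    link p m h l v = proj₁ (cells-rule e (column p)) _ _ (lab-ok (cell Fr p (mirror< k p m h)))
      (subst (λ c → ⟦ lab (not e) c ⟧ (z (suc k) m)) (sym (trans (cong flip (column-mirror k p m h)) (flip-flip _))) l
      , wide-ok v p h)

    turned : (⟦ lab (not e) c0 ⟧ (z (suc k) 0) × ⟦ flag first ⟧ (z (suc k) 0) × ⟦ ¬ᵘ flag ext ⟧ (z (suc k) 0))
             × T (wide e) (z k (3 + k * 4)) (z (suc k) 0) ≡ true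
    turned = turn-ok e _
      ( alive (pc k) i δk _ (at-row _ ≤-refl)
      , subst (λ c → ⟦ lab e c ⟧ (z k (3 + k * 4))) (trans (cong column (+-comm 3 (k * 4))) (column-4k k 3)) (lab-ok last)
      , ext⁺ last (m≤n+m (k * 4) 3) )
      where last = cell Fr (3 + k * 4) ≤-refl

    vert0 : Vert k 0
    -- The row starts in column `c0`, in the interior of a wide brick, where no `T 0` edge is owed.
    vert0 = record { wide-ok = w ; two-ok = λ _ _ () ; three-ok = λ _ _ () }
      where w : ∀ p → p + 0 ≡ 3 + k * 4 → T (wide e) (z k p) (z (suc k) 0) ≡ true
            w p h rewrite trans (sym (+-identityʳ p)) h = proj₂ turned

    cell0 : Cell (suc k) 0
    cell0 = record
      { lab-ok = proj₁ (proj₁ turned)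
      ; at-ok  = at-vert (3 + k * 4) _ ≤-refl (link (3 + k * 4) 0 (+-identityʳ _) (proj₁ (proj₁ turned)) vert0)
      ; ext⁺   = λ ()
      ; ext⁻   = λ _ → proj₂ (proj₂ (proj₁ turned)) }

    -- Past its first cell the new row exists only if its own state has an instruction, for this is
    -- what makes its cells `live`.
    module _ (i′ : Ins) (δk′ : δ (pc (suc k)) ≡ just i′) where

      T-path : ∀ c {w x y u} → T c w x ≡ true → T c x y ≡ true → T c y u ≡ true → T c w u ≡ true
      T-path c a b d = T-trans c _ _ _ a (T-trans c _ _ _ b d)

      top-edge : ∀ m → Cell (suc k) m → suc m < len (suc k) → T (band e (column m)) (z (suc k) m) (z (suc k) (suc m)) ≡ true
      top-edge m c b = subst (λ f → T (band f (column m)) (z (suc k) m) (z (suc k) (suc m)) ≡ true) (not-involutive e)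
                             (proj₂ (proj₂ (proj₂ (edge (suc k) i′ δk′ m c b))))

      base-edge : ∀ p m → suc p + m ≡ 3 + k * 4 → T (band e (column m)) (z k p) (z k (suc p)) ≡ true
      base-edge p m h = subst (λ c → T (band e c) (z k p) (z k (suc p)) ≡ true) (trans (cong flip (column-mirror k (suc p) m h)) (flip-flip _))
        (proj₁ (proj₂ (edges Fr p (mirror< k (suc p) m h))))

      -- The three known sides of the square share the colour `band e (column m)`. This is `T 0`
      -- only when `column m` is `c2`, and then `widen` restores the wide colour of the new edge;
      -- when the new column is `c2`, `narrow` adds `T 0`.
      vert-suc : ∀ m → Cell (suc k) m → (b : suc m < len (suc k)) → Vert k m → Vert k (suc m)
      vert-suc m c b v = record { wide-ok = wide-suc ; two-ok = two-suc ; three-ok = three-suc }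
        where
        x⊢ : ∀ p → p + suc m ≡ 3 + k * 4 → ⟦ lab e (flip (column (suc m))) ⟧ (z k p)
        x⊢ p h = subst (λ c → ⟦ lab e c ⟧ (z k p)) (column-mirror k p (suc m) h) (lab-ok (cell Fr p (mirror< k p (suc m) h)))
        y⊢ : ⟦ lab (not e) (column (suc m)) ⟧ (z (suc k) (suc m))
        y⊢ = proj₁ (edge (suc k) i′ δk′ m c b)
        path : ∀ p → p + suc m ≡ 3 + k * 4 → T (band e (column m)) (z k p) (z (suc k) (suc m)) ≡ true
        path p h = T-path (band e (column m)) (base-edge p m h′) (band-ok k m (suc p) v h′) (top-edge m c b)
          where h′ = trans (sym (+-suc p m)) h
        wide-suc : ∀ p → p + suc m ≡ 3 + k * 4 → T (wide e) (z k p) (z (suc k) (suc m)) ≡ true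
        wide-suc p h with column m | path p h | x⊢ p h | y⊢
        ... | c0 | t | _ | _ = t
        ... | c1 | t | _ | _ = t
        ... | c2 | t | a | b = widen e _ _ a b t
        ... | c3 | t | _ | _ = t
        two-suc : ∀ p → p + suc m ≡ 3 + k * 4 → column (suc m) ≡ c2 → T zero (z k p) (z (suc k) (suc m)) ≡ true
        two-suc p h q = narrow e _ _ (subst (λ c → ⟦ lab e (flip c) ⟧ (z k p)) q (x⊢ p h))
          (subst (λ c → ⟦ lab (not e) c ⟧ (z (suc k) (suc m))) q y⊢) (wide-suc p h)
        three-suc : ∀ p → p + suc m ≡ 3 + k * 4 → column (suc m) ≡ c3 → T zero (z k p) (z (suc k) (suc m)) ≡ true
        three-suc p h q with column m | path p h | q
        ... | c2 | t | _ = t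
        ... | c0 | _ | ()
        ... | c1 | _ | ()
        ... | c3 | _ | ()

      -- The two inductions are intertwined: `ext` at cell m+1 depends on `under` at cell m, which
      -- comes up the vertical edge into m, while the edge into m+1 uses the row edge out of m,
      -- available only because cell m is correct.
      cellv : ∀ m → m < len (suc k) → Cell (suc k) m × Vert k m
      cellv zero _ = cell0 , vert0
      cellv (suc m) b = advance (suc k) i′ δk′ m c b ext-in ext-out , vert-suc m c b v
        where
        cv = cellv m (<-trans (n<1+n m) b)
        c = proj₁ cv
        v = proj₂ cv
        under-is : ∀ p → p + m ≡ 3 + k * 4 → I (fl under) (z (suc k) m) ≡ I (fl first) (z k p)
        under-is p h = under-vert _ _ (link p m h (lab-ok c) v)
        ext-in : suc k * 4 ≤ suc m → ⟦ flag under ∨ᵘ flag ext ⟧ (z (suc k) m)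
        ext-in q with suc k * 4 ≤? m
        ... | yes q′ = inj₂ (ext⁺ c q′)
        ... | no q′  = inj₁ (trans (under-is 0 (≤-antisym (s≤s⁻¹ (≰⇒> q′)) (s≤s⁻¹ q))) (first⁺ Fr))
        ext-out : suc m < suc k * 4 → ¬ ⟦ flag under ∨ᵘ flag ext ⟧ (z (suc k) m)
        ext-out q (inj₂ h) = ext⁻ c (<-trans (n<1+n m) q) h
        ext-out q (inj₁ h) with m≤n⇒∃[o]m+o≡n (s≤s⁻¹ q)
        ... | o , eq = first⁻ Fr o (mirror< k (suc o) m h′) (trans (sym (under-is (suc o) h′)) h)
          where h′ : suc o + m ≡ 3 + k * 4
                h′ = trans (cong suc (+-comm o m)) eq

      cells : ∀ m → m < len (suc k) → Cell (suc k) m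
      cells m b = proj₁ (cellv m b)

      edges′ : ∀ p → suc p < len (suc k) → Edge (suc k) p
      edges′ p b = proj₂ (edge (suc k) i′ δk′ p (cells p (<-trans (n<1+n p) b)) b)

      top< : ∀ {m} → m ≤ 3 + k * 4 → m < len (suc k)
      top< h = s≤s (≤-trans h (m≤n+m (3 + k * 4) 4))

      linked : ∀ p m → p + m ≡ 3 + k * 4 → ⟦ vert ⟧₂ (z k p) (z (suc k) m)
      linked p m h = link p m h (lab-ok (cells m b)) (proj₂ (cellv m b))
        where b : m < len (suc k)
              b = top< (≤-trans (m≤n+m m p) (≤-reflexive h))

      linked⁻ : ∀ p m → p + m ≡ 2 + k * 4 → ⟦ vert⁻ ⟧₂ (z k p) (z (suc k) m)
      linked⁻ p m h = proj₁ (proj₂ (cells-rule e (column p))) _ _ (lab-ok (cell Fr p p<))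
        ( subst (λ c → ⟦ lab (not e) c ⟧ (z (suc k) m)) (sym mc) (lab-ok (cells m b))
        , subst (λ c → T (band e c) (z k p) (z (suc k) m) ≡ true) (sym mc)
            (T-trans (band e (column m)) _ _ _ (base-edge p m (cong suc h))
              (band-ok k m (suc p) (proj₂ (cellv m b)) (cong suc h))) )
        where
        p< : p < len k
        p< = mirror< k p (suc m) (trans (+-suc p m) (cong suc h))
        b : m < len (suc k)
        b = top< (≤-trans (m≤n+m m p) (≤-trans (≤-reflexive h) (n≤1+n _)))
        mc : flip (rot (column p)) ≡ column m
        mc = trans (cong flip (column-mirror k (suc p) m (cong suc h))) (flip-flip _)

      linked⁺ : ∀ p m → p + suc m ≡ 4 + k * 4 → p < len k → suc m < len (suc k) →
                ⟦ vert⁺ ⟧₂ (z k p) (z (suc k) (suc m))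
      linked⁺ p m h p< b = proj₁ (proj₂ (proj₂ (cells-rule e (column p)))) _ _ (lab-ok (cell Fr p p<))
        ( subst (λ c → ⟦ lab (not e) c ⟧ (z (suc k) (suc m))) (sym (cong rot mc)) (lab-ok (cells (suc m) b))
        , subst (λ c → T (band e c) (z k p) (z (suc k) (suc m)) ≡ true) (sym mc)
            (T-trans (band e (column m)) _ _ _ (band-ok k m p (proj₂ (cellv m b′)) h′)
              (top-edge m (cells m b′) b)) )
        where
        b′ : m < len (suc k)
        b′ = <-trans (n<1+n m) b
        h′ : p + m ≡ 3 + k * 4
        h′ = suc-injective (trans (sym (+-suc p m)) h)
        mc : flip (column p) ≡ column m
        mc = trans (cong flip (column-mirror k p m h′)) (flip-flip _)

      first⁻′ : ∀ p → suc p < len (suc k) → ¬ ⟦ flag first ⟧ (z (suc k) (suc p))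
      first⁻′ p b = first-next _ _ (proj₁ (edges′ p b))

      under-last : ⟦ flag under ⟧ (z (suc k) (3 + k * 4))
      under-last = trans (under-vert _ _ (linked 0 (3 + k * 4) refl)) (first⁺ Fr)

      bits′ : ∀ {r} → r ∈ rs → ∀ m → m < len (suc k) →
              I (bit r) (z (suc k) m) ≡ shows (par-of (suc k)) (suc k) m (R (suc k) r)
      bits′ {r} r∈ zero b = trans (Reg.first-bit r∈ _ (proj₁ (proj₂ (proj₁ turned))))
                              (sym (shows-first (par-of (suc k)) (suc k) _ (R-bound (suc k) r)))
      bits′ {r} r∈ (suc m) b with <-cmp (suc m) (3 + k * 4)
      ... | tri≈ _ refl _ = trans (≢true⇒false (Reg.border-bit r∈ _ (inj₁ under-last)))
                              (sym (shows-under k _ (R (suc k) r) (R-bound (suc k) r) ≤-refl))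
      ... | tri> _ _ q = trans (≢true⇒false (Reg.border-bit r∈ _ (inj₂ (ext⁺ (cells (suc m) b) q , first⁻′ m b))))
                           (sym (shows-under k _ (R (suc k) r) (R-bound (suc k) r) (≤-trans (n≤1+n _) q)))
      -- Strictly before the `under` cell all three possible sources `o`, `suc o` and `suc (suc o)`
      -- lie in row k; the change of the register selects one of them.
      ... | tri< q _ _ with m≤n⇒∃[o]m+o≡n q
      ...   | o , eq = by (change r∈)
        where
        keep-eq : suc o + suc m ≡ 3 + k * 4
        keep-eq = trans (cong suc (+-comm o (suc m))) eq
        minus-eq : o + suc m ≡ 2 + k * 4
        minus-eq = suc-injective keep-eq
        plus-eq : suc (suc o) + suc m ≡ 4 + k * 4
        plus-eq = cong suc keep-eq
        keep< : suc o < len k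
        keep< = mirror< k (suc o) (suc m) keep-eq
        plus< : suc (suc o) < len k
        plus< = mirror< k (suc (suc o)) m (trans (sym (+-suc (suc o) m)) keep-eq)
        minus< : o < len k
        minus< = <-trans (n<1+n o) keep<
        target = shows (par-of (suc k)) (suc k) (suc m) (R (suc k) r)

        finish : ∀ p → p < len k → I (bit r) (z (suc k) (suc m)) ≡ not (I (bit r) (z k p)) →
                 target ≡ not (shows (par-of k) k p (R k r)) → I (bit r) (z (suc k) (suc m)) ≡ target
        finish p b f g = trans f (trans (cong not (bits Fr r∈ p b)) (sym g))

        par-ok : ∀ p → p < len k → ∀ {e′} → e ≡ e′ → I (fl (par e′)) (z k p) ≡ true
        par-ok p b refl = proj₁ (lab-ok (cell Fr p b))

        at-minus : ⟦ toward r ⟧ (z k o) →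
                   I (bit r) (z (suc k) (suc m)) ≡ not (I (bit r) (z k o))
        at-minus g = Reg.swap⁻ r∈ _ _ g (linked⁻ o (suc m) minus-eq)

        at-plus : ⟦ away r ⟧ (z k (suc (suc o))) →
                  I (bit r) (z (suc k) (suc m)) ≡ not (I (bit r) (z k (suc (suc o))))
        at-plus g = Reg.swap⁺ r∈ _ _ g (linked⁺ (suc (suc o)) m plus-eq plus< b)

        eqs-minus : ∀ {x y} → y ≡ suc x → o + suc m + y ≡ 3 + k * 4 + x
        eqs-minus {x} refl = trans (cong (_+ suc x) minus-eq) (+-suc (2 + k * 4) x)

        eqs-plus : ∀ {x y} → x ≡ suc y → suc (suc o) + suc m + y ≡ 3 + k * 4 + x
        eqs-plus {_} {y} refl = trans (cong (_+ y) plus-eq) (sym (+-suc (3 + k * 4) y))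

        by : Change r → I (bit r) (z (suc k) (suc m)) ≡ target
        by (kept f q) = finish (suc o) keep<
          (Reg.swap r∈ _ _ (f (suc o) keep<) (linked (suc o) (suc m) keep-eq))
          (shows-suc k (suc o) (suc m) (R k r) (R (suc k) r) (λ _ → cong₂ _+_ keep-eq q) (λ _ → cong₂ _+_ keep-eq (sym q)))
        by (up f q) = go e refl
          where
          go : ∀ e′ → e ≡ e′ → I (bit r) (z (suc k) (suc m)) ≡ target
          go false ek = finish o minus<
            (at-minus (inj₁ (par-ok o minus< ek , f o minus<)))
            (shows-suc k o (suc m) (R k r) (R (suc k) r) (λ _ → eqs-minus q) (λ h → clash ek h))
          go true ek = finish (suc (suc o)) plus<
            (at-plus (inj₁ (par-ok _ plus< ek , f _ plus<)))
            (shows-suc k (suc (suc o)) (suc m) (R k r) (R (suc k) r) (λ h → clash h ek) (λ _ → eqs-plus q))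
        by (down f q) = go e refl
          where
          go : ∀ e′ → e ≡ e′ → I (bit r) (z (suc k) (suc m)) ≡ target
          go false ek = finish (suc (suc o)) plus<
            (at-plus (inj₂ (par-ok _ plus< ek , f _ plus<)))
            (shows-suc k (suc (suc o)) (suc m) (R k r) (R (suc k) r) (λ _ → eqs-plus q) (λ h → clash ek h))
          go true ek = finish o minus<
            (at-minus (inj₂ (par-ok o minus< ek , f o minus<)))
            (shows-suc k o (suc m) (R k r) (R (suc k) r) (λ h → clash h ek) (λ _ → eqs-minus q))

      frame-suc : Frame (suc k)
      frame-suc = record
        { cell    = cells
        ; edges   = edges′
        ; first⁺  = proj₁ (proj₂ (proj₁ turned))
        ; first⁻  = first⁻′
        ; centred = origin-vert _ _ (linked (centre e k) _ (centre-mirror k)) (centred Fr)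
        ; bits    = bits′ }

  halted : ∀ k → δ (pc k) ≡ nothing → pc (suc k) ≡ pc k
  halted k h = cong (λ d → proj₁ (exec d (pc k , R k))) h

  frame-at : ∀ k i → δ (pc k) ≡ just i → Frame k
  frame-at zero i δ0 = frame0 i δ0
  frame-at (suc k) i′ δk′ = go (δ (pc k)) refl
    where
    go : ∀ d → δ (pc k) ≡ d → Frame (suc k)
    go (just i) δk = NextRow.frame-suc k i δk (frame-at k i δk) i′ δk′
    go nothing δk with trans (sym δk′) (trans (cong δ (halted k δk)) δk)
    ... | ()

  -- An executed instruction brings the first cell of the next row; after halting the state no
  -- longer changes and the old witness serves again.
  visited : ∀ k → ∃ λ x → I (at (pc k)) x ≡ true
  visited zero = _ , proj₂ (proj₂ (proj₂ (proj₂ start⊨)))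
  visited (suc k) = go (δ (pc k)) refl
    where
    go : ∀ d → δ (pc k) ≡ d → ∃ λ x → I (at (pc (suc k))) x ≡ true
    go (just i) δk = _ , at-ok (NextRow.cell0 k i δk (frame-at k i δk))
    go nothing δk with visited k
    ... | x , h = x , trans (cong (λ p → I (at p) x) (halted k δk)) h

  unreachable : ∀ k → ¬ pc k ≡ bad
  unreachable k h with visited k
  ... | x , v = never-bad x (trans (cong (λ p → I (at p) x) (sym h)) v)

-- Bricks

-- `block` counts the blocks of four before the cell in its row and `coblock` those after it. The
-- cell facing ⟨ q , d , l ⟩ in the next row is ⟨ d , suc q , flip l ⟩: in these coordinates the
-- reflection needs no subtraction.
record Cell : Set where
  constructor ⟨_,_,_⟩
  field
    block coblock : ℕ
    colour        : Col
open Cell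

digit : Col → ℕ
digit c0 = 0
digit c1 = 1
digit c2 = 2
digit c3 = 3

rowOf posOf : Cell → ℕ
rowOf x = block x + coblock x
posOf x = block x * 4 + digit (colour x)

nextCell : Cell → Cell
nextCell ⟨ q , d , c3 ⟩ with d
... | zero   = ⟨ 0 , suc q , c0 ⟩
... | suc d′ = ⟨ suc q , d′ , c0 ⟩
nextCell ⟨ q , d , l ⟩ = ⟨ q , d , rot l ⟩

firstCell : Cell
firstCell = ⟨ 0 , 0 , c0 ⟩

path : ℕ → Cell
path zero    = firstCell
path (suc n) = nextCell (path n)

path-row : ∀ k → ∃ λ n → path n ≡ ⟨ 0 , k , c0 ⟩
path-row zero = 0 , refl
path-row (suc k) with path-row k
... | n , h = go n 0 k h
  where
  go : ∀ n q d → path n ≡ ⟨ q , d , c0 ⟩ → ∃ λ m → path m ≡ ⟨ 0 , suc (q + d) , c0 ⟩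
  go n q zero h = 4 + n , trans (cong (λ c → nextCell (nextCell (nextCell (nextCell c)))) h)
                                (cong (λ k → ⟨ 0 , suc k , c0 ⟩) (sym (+-identityʳ q)))
  go n q (suc d) h with go (4 + n) (suc q) d (cong (λ c → nextCell (nextCell (nextCell (nextCell c)))) h)
  ... | m , e = m , trans e (cong (λ k → ⟨ 0 , suc k , c0 ⟩) (sym (+-suc q d)))

_≟ᵇ_ : Bool → Bool → Bool
true ≟ᵇ b  = b
false ≟ᵇ b = not b

≟ᵇ-true : ∀ a b → (a ≟ᵇ b) ≡ true → a ≡ b
≟ᵇ-true true b h = sym h
≟ᵇ-true false false _ = refl

≟ᵇ-refl : ∀ a → (a ≟ᵇ a) ≡ true
≟ᵇ-refl true  = refl
≟ᵇ-refl false = refl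

_≟ᶜ_ : Col → Col → Bool
l ≟ᶜ m = digit l ≡ᵇ digit m

≟ᶜ-true : ∀ l m → (l ≟ᶜ m) ≡ true → l ≡ m
≟ᶜ-true c0 c0 _ = refl
≟ᶜ-true c1 c1 _ = refl
≟ᶜ-true c2 c2 _ = refl
≟ᶜ-true c3 c3 _ = refl

≟ᶜ-refl : ∀ l → (l ≟ᶜ l) ≡ true
≟ᶜ-refl l = ≡ᵇ-refl (digit l)

∧-true : ∀ {a b} → a ∧ b ≡ true → a ≡ true × b ≡ true
∧-true {true} h = refl , h

true-∧ : ∀ {a b} → a ≡ true → b ≡ true → a ∧ b ≡ true
true-∧ refl h = h

-- A wide brick is a block shifted by one cell. So in each block one column counts towards the
-- neighbouring brick: `c3` in the upper row of a strip, facing `c0` in the lower one.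
at0 at3 : Col → ℕ
at0 c0 = 1
at0 _  = 0
at3 c3 = 1
at3 _  = 0

-- The transitive relations are interpreted by "lying in the same brick".  A cell lies in one
-- brick of the strip above its row (lower) and in one of the strip below it (upper), and in one
-- two-column brick.
lower upper square : Cell → ℕ × ℕ
lower x = suc (rowOf x) , coblock x + at0 (colour x)
upper x = rowOf x , block x + at3 (colour x)
square x with colour x
... | c0 = suc (rowOf x) , coblock x
... | c1 = suc (rowOf x) , coblock x
... | c2 = rowOf x , block x
... | c3 = rowOf x , block x

brick : Fin 3 → Cell → ℕ × ℕ
brick zero x             = square x
brick (suc zero) x       = if par-of (rowOf x) then upper x else lower x
brick (suc (suc zero)) x = if par-of (rowOf x) then lower x else upper x

brick-lower : ∀ e x → par-of (rowOf x) ≡ e → brick (wide e) x ≡ lower x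
brick-lower false x h rewrite h = refl
brick-lower true x h rewrite h  = refl

brick-upper : ∀ e x → par-of (rowOf x) ≡ not e → brick (wide e) x ≡ upper x
brick-upper false x h rewrite h = refl
brick-upper true x h rewrite h  = refl

same : Fin 3 → Cell → Cell → Bool
same i x y = (proj₁ (brick i x) ≡ᵇ proj₁ (brick i y)) ∧ (proj₂ (brick i x) ≡ᵇ proj₂ (brick i y))

same-true : ∀ i x y → same i x y ≡ true → brick i x ≡ brick i y
same-true i x y h = cong₂ _,_ (≡ᵇ-true _ _ (proj₁ (∧-true h))) (≡ᵇ-true _ _ (proj₂ (∧-true {proj₁ (brick i x) ≡ᵇ proj₁ (brick i y)} h)))

true-same : ∀ i x y → brick i x ≡ brick i y → same i x y ≡ true
true-same i x y h = true-∧ (trans (cong (λ b → proj₁ b ≡ᵇ proj₁ (brick i y)) h) (≡ᵇ-refl (proj₁ (brick i y))))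
                           (trans (cong (λ b → proj₂ b ≡ᵇ proj₂ (brick i y)) h) (≡ᵇ-refl (proj₂ (brick i y))))

same-trans : ∀ i x y w → same i x y ≡ true → same i y w ≡ true → same i x w ≡ true
same-trans i x y w a b = true-same i x w (trans (same-true i x y a) (same-true i y w b))

above : ℕ → Cell → Cell → Bool
above n x y = (rowOf y ≡ᵇ suc (rowOf x)) ∧ (posOf x + posOf y ≡ᵇ n + rowOf x * 4)

succeeds : Cell → Cell → Bool
succeeds x y = (rowOf y ≡ᵇ rowOf x) ∧ (posOf y ≡ᵇ suc (posOf x))

link : ℕ → Cell → Cell → Bool
link 0 = above 3
link 1 = above 2
link 2 = above 4
link _ = succeeds

above-true : ∀ n x y → rowOf y ≡ suc (rowOf x) → posOf x + posOf y ≡ n + rowOf x * 4 → above n x y ≡ true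
above-true n x y h g rewrite h | g = true-∧ (≡ᵇ-refl (rowOf x)) (≡ᵇ-refl (n + rowOf x * 4))

true-above : ∀ n x y → above n x y ≡ true → rowOf y ≡ suc (rowOf x) × posOf x + posOf y ≡ n + rowOf x * 4
true-above n x y h = ≡ᵇ-true _ _ (proj₁ (∧-true h)) , ≡ᵇ-true _ _ (proj₂ (∧-true {rowOf y ≡ᵇ suc (rowOf x)} h))

true-succeeds : ∀ x y → succeeds x y ≡ true → rowOf y ≡ rowOf x × posOf y ≡ suc (posOf x)
true-succeeds x y h = ≡ᵇ-true _ _ (proj₁ (∧-true h)) , ≡ᵇ-true _ _ (proj₂ (∧-true {rowOf y ≡ᵇ rowOf x} h))

record Lab (e : Bool) (l : Col) (x : Cell) : Set where
  constructor mkLab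
  field
    par-eq : par-of (rowOf x) ≡ e
    col-eq : colour x ≡ l

across-wide : ∀ e x y → par-of (rowOf x) ≡ e → par-of (rowOf y) ≡ not e → same (wide e) x y ≡ true →
              rowOf y ≡ suc (rowOf x) × coblock x + at0 (colour x) ≡ block y + at3 (colour y)
across-wide e x y p q h = sym (cong proj₁ eq) , cong proj₂ eq
  where eq : lower x ≡ upper y
        eq = trans (sym (brick-lower e x p)) (trans (same-true (wide e) x y h) (brick-upper e y q))

-- The relation also connects pairs in a brick that do not face each other. But a brick meets each
-- column at most once in either row, so parity and column labels leave only the intended cell.
vert-model : ∀ e l x y → Lab e l x → Lab (not e) (flip l) y → same (wide e) x y ≡ true → above 3 x y ≡ true
vert-model e l x@(⟨ q , d , _ ⟩) y@(⟨ q′ , d′ , _ ⟩) (mkLab p refl) (mkLab p′ refl) h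
  with across-wide e x y p p′ h
... | r , b = above-true 3 x y r (go l b)
  where
  go : ∀ l → d + at0 l ≡ q′ + at3 (flip l) → q * 4 + digit l + (q′ * 4 + digit (flip l)) ≡ 3 + (q + d) * 4
  go c0 b with +-cancelʳ-≡ 1 d q′ b
  ... | refl = e1 q d
    where e1 : ∀ q d → q * 4 + 0 + (d * 4 + 3) ≡ 3 + (q + d) * 4
          e1 = solve-∀
  go c1 b with +-cancelʳ-≡ 0 d q′ b
  ... | refl = e1 q d
    where e1 : ∀ q d → q * 4 + 1 + (d * 4 + 2) ≡ 3 + (q + d) * 4
          e1 = solve-∀
  go c2 b with +-cancelʳ-≡ 0 d q′ b
  ... | refl = e1 q d
    where e1 : ∀ q d → q * 4 + 2 + (d * 4 + 1) ≡ 3 + (q + d) * 4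
          e1 = solve-∀
  go c3 b with +-cancelʳ-≡ 0 d q′ b
  ... | refl = e1 q d
    where e1 : ∀ q d → q * 4 + 3 + (d * 4 + 0) ≡ 3 + (q + d) * 4
          e1 = solve-∀

vert⁻-model : ∀ e l x y → Lab e l x → Lab (not e) (flip (rot l)) y →
              same (band e (flip (rot l))) x y ≡ true → above 2 x y ≡ true
vert⁻-model e c0 x@(⟨ q , d , _ ⟩) y (mkLab p refl) (mkLab p′ refl) h with same-true zero x y h
... | b with cong proj₂ b
... | refl = above-true 2 x y (sym (cong proj₁ b)) (e1 q d)
    where e1 : ∀ q d → q * 4 + 0 + (d * 4 + 2) ≡ 2 + (q + d) * 4
          e1 = solve-∀
vert⁻-model e c1 x@(⟨ q , d , _ ⟩) y@(⟨ q′ , d′ , _ ⟩) (mkLab p refl) (mkLab p′ refl) h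
  with across-wide e x y p p′ h
... | r , b with +-cancelʳ-≡ 0 d q′ b
... | refl = above-true 2 x y r (e1 q d)
    where e1 : ∀ q d → q * 4 + 1 + (d * 4 + 1) ≡ 2 + (q + d) * 4
          e1 = solve-∀
vert⁻-model e c2 x@(⟨ q , d , _ ⟩) y@(⟨ q′ , d′ , _ ⟩) (mkLab p refl) (mkLab p′ refl) h
  with across-wide e x y p p′ h
... | r , b with +-cancelʳ-≡ 0 d q′ b
... | refl = above-true 2 x y r (e1 q d)
    where e1 : ∀ q d → q * 4 + 2 + (d * 4 + 0) ≡ 2 + (q + d) * 4
          e1 = solve-∀
vert⁻-model e c3 x@(⟨ q , d , _ ⟩) y@(⟨ q′ , d′ , _ ⟩) (mkLab p refl) (mkLab p′ refl) h
  with across-wide e x y p p′ h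
... | r , b with trans (sym (+-identityʳ d)) b
... | refl = above-true 2 x y r (e1 q q′)
    where e1 : ∀ q q′ → q * 4 + 3 + (q′ * 4 + 3) ≡ 2 + (q + (q′ + 1)) * 4
          e1 = solve-∀

vert⁺-model : ∀ e l x y → Lab e l x → Lab (not e) (rot (flip l)) y →
              same (band e (flip l)) x y ≡ true → above 4 x y ≡ true
vert⁺-model e c0 x@(⟨ q , d , _ ⟩) y@(⟨ q′ , d′ , _ ⟩) (mkLab p refl) (mkLab p′ refl) h
  with across-wide e x y p p′ h
... | r , b with trans b (+-identityʳ q′)
... | refl = above-true 4 x y r (e1 q d)
    where e1 : ∀ q d → q * 4 + 0 + ((d + 1) * 4 + 0) ≡ 4 + (q + d) * 4
          e1 = solve-∀
vert⁺-model e c1 x@(⟨ q , d , _ ⟩) y (mkLab p refl) (mkLab p′ refl) h with same-true zero x y h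
... | b with cong proj₂ b
... | refl = above-true 4 x y (sym (cong proj₁ b)) (e1 q d)
    where e1 : ∀ q d → q * 4 + 1 + (d * 4 + 3) ≡ 4 + (q + d) * 4
          e1 = solve-∀
vert⁺-model e c2 x@(⟨ q , d , _ ⟩) y@(⟨ q′ , d′ , _ ⟩) (mkLab p refl) (mkLab p′ refl) h
  with across-wide e x y p p′ h
... | r , b with +-cancelʳ-≡ 0 d q′ b
... | refl = above-true 4 x y r (e1 q d)
    where e1 : ∀ q d → q * 4 + 2 + (d * 4 + 2) ≡ 4 + (q + d) * 4
          e1 = solve-∀
vert⁺-model e c3 x@(⟨ q , d , _ ⟩) y@(⟨ q′ , d′ , _ ⟩) (mkLab p refl) (mkLab p′ refl) h
  with across-wide e x y p p′ h
... | r , b with +-cancelʳ-≡ 0 d q′ b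
... | refl = above-true 4 x y r (e1 q d)
    where e1 : ∀ q d → q * 4 + 3 + (d * 4 + 1) ≡ 4 + (q + d) * 4
          e1 = solve-∀

narrow-model : ∀ e x y → Lab e c1 x → Lab (not e) c2 y → same (wide e) x y ≡ true → same zero x y ≡ true
narrow-model e x@(⟨ q , d , _ ⟩) y@(⟨ q′ , d′ , _ ⟩) (mkLab p refl) (mkLab p′ refl) h
  with across-wide e x y p p′ h
... | r , b = true-same zero x y (cong₂ _,_ (sym r) (+-cancelʳ-≡ 0 d q′ b))

widen-model : ∀ e x y → Lab e c0 x → Lab (not e) c3 y → same zero x y ≡ true → same (wide e) x y ≡ true
widen-model e x@(⟨ q , d , _ ⟩) y@(⟨ q′ , d′ , _ ⟩) (mkLab p refl) (mkLab p′ refl) h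
  with same-true zero x y h
... | b = true-same (wide e) x y (trans (brick-lower e x p) (trans
            (cong₂ _,_ (cong proj₁ b) (cong (_+ 1) (cong proj₂ b))) (sym (brick-upper e y p′))))

both-wide : ∀ e x y → par-of (rowOf x) ≡ e → par-of (rowOf y) ≡ e →
            (lower x ≡ lower y → same (wide e) x y ≡ true) × (upper x ≡ upper y → same (wide (not e)) x y ≡ true)
both-wide e x y p q =
    (λ h → true-same (wide e) x y (trans (brick-lower e x p) (trans h (sym (brick-lower e y q)))))
  , (λ h → true-same (wide (not e)) x y (trans (brick-upper (not e) x (trans p (sym (not-involutive e))))
             (trans h (sym (brick-upper (not e) y (trans q (sym (not-involutive e))))))))

next-model : ∀ e l x → Lab e l x → ¬ (l ≡ c3 × (rowOf x * 4 ≤ᵇ posOf x) ≡ true) → let y = nextCell x in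
  Lab e (rot l) y × succeeds x y ≡ true × same (band e (flip (rot l))) x y ≡ true × same (band (not e) l) x y ≡ true
next-model e c0 x@(⟨ q , d , _ ⟩) (mkLab p refl) _ = mkLab p refl
  , true-∧ (≡ᵇ-refl (q + d)) (trans (cong (_≡ᵇ suc (q * 4 + 0)) (+-suc (q * 4) 0)) (≡ᵇ-refl (q * 4 + 0)))
  , true-same zero x (nextCell x) refl , proj₂ (both-wide e x (nextCell x) p p) refl
next-model e c1 x@(⟨ q , d , _ ⟩) (mkLab p refl) _ = mkLab p refl
  , true-∧ (≡ᵇ-refl (q + d)) (trans (cong (_≡ᵇ suc (q * 4 + 1)) (+-suc (q * 4) 1)) (≡ᵇ-refl (q * 4 + 1)))
  , proj₁ (both-wide e x (nextCell x) p p) refl , proj₂ (both-wide e x (nextCell x) p p) refl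
next-model e c2 x@(⟨ q , d , _ ⟩) (mkLab p refl) _ = mkLab p refl
  , true-∧ (≡ᵇ-refl (q + d)) (trans (cong (_≡ᵇ suc (q * 4 + 2)) (+-suc (q * 4) 2)) (≡ᵇ-refl (q * 4 + 2)))
  , proj₁ (both-wide e x (nextCell x) p p) refl , true-same zero x (nextCell x) refl
next-model e c3 x@(⟨ q , zero , _ ⟩) (mkLab p refl) n = ⊥-elim (n (refl , ≤ᵇ-true (q + 0) (q * 4 + 3)
  (≤-trans (≤-reflexive (cong (_* 4) (+-identityʳ q))) (m≤m+n (q * 4) 3))))
  where ≤ᵇ-true : ∀ a b → a * 4 ≤ b → (a * 4 ≤ᵇ b) ≡ true
        ≤ᵇ-true zero b _    = refl
        ≤ᵇ-true (suc a) b h = <ᵇ-true h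
next-model e c3 x@(⟨ q , suc d , _ ⟩) (mkLab p refl) _ = mkLab p′ refl
  , true-∧ (trans (cong (suc (q + d) ≡ᵇ_) (+-suc q d)) (≡ᵇ-refl (q + d)))
           (trans (cong (suc q * 4 + 0 ≡ᵇ_) (e1 q)) (≡ᵇ-refl (suc q * 4 + 0)))
  , proj₁ (both-wide e x y p p′) (cong₂ _,_ (cong suc (+-suc q d)) (trans (+-identityʳ (suc d)) (+-comm 1 d)))
  , proj₂ (both-wide e x y p p′) (cong₂ _,_ (+-suc q d) (trans (+-comm q 1) (sym (+-identityʳ (suc q)))))
  where
  y = nextCell x
  p′ : par-of (rowOf y) ≡ e
  p′ = trans (cong par-of (sym (+-suc q d))) p
  e1 : ∀ q → suc (q * 4 + 3) ≡ suc q * 4 + 0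
  e1 = solve-∀

turn-model : ∀ e x → Lab e c3 x → (rowOf x * 4 ≤ᵇ posOf x) ≡ true → let y = nextCell x in
  Lab (not e) c0 y × posOf y ≡ 0 × rowOf y ≡ suc (rowOf x) × same (wide e) x y ≡ true
turn-model e x@(⟨ q , zero , _ ⟩) (mkLab p refl) _ = mkLab p′ refl , refl , cong suc (sym (+-identityʳ q))
  , true-same (wide e) x (nextCell x) (trans (brick-lower e x p)
      (trans (cong (_, 0) (cong suc (+-identityʳ q))) (sym (brick-upper e (nextCell x) p′))))
  where p′ : not (par-of q) ≡ not e
        p′ = cong not (trans (cong par-of (sym (+-identityʳ q))) p)
turn-model e x@(⟨ q , suc d , _ ⟩) (mkLab p refl) h = ⊥-elim (false≢true (trans (sym (go (q + suc d) _ (+-suc q d) bound)) h))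
  where
  bound : q * 4 + 3 < suc (q + d) * 4
  bound = s≤s (≤-trans (≤-reflexive (+-comm (q * 4) 3)) (+-monoʳ-≤ 3 (*-monoˡ-≤ 4 (m≤m+n q d))))
  go : ∀ a b → a ≡ suc (q + d) → b < suc (q + d) * 4 → (a * 4 ≤ᵇ b) ≡ false
  go _ b refl h = <ᵇ-false (s≤s⁻¹ h)

-- A finite model of a run that ends in `good`

-- The model is the initial segment of the path up to the row of the halting configuration.
module Model (δ : PC → Maybe Ins) (δ-good : δ good ≡ nothing) (δ-bad : δ bad ≡ nothing)
  (s : PC) (K : ℕ) (ends : proj₁ (Run.iter δ K (s , λ _ → 0)) ≡ good) (rs : List ℕ) where
  open Run δ

  conf : ℕ → PC × Regs
  conf k = iter k (s , λ _ → 0)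

  pc : ℕ → PC
  pc k = proj₁ (conf k)

  R : ℕ → Regs
  R k = proj₂ (conf k)

  stuck : ∀ k j → δ (pc k) ≡ nothing → pc (j + k) ≡ pc k
  stuck k zero h = refl
  stuck k (suc j) h with stuck k j h
  ... | q = trans (cong (λ d → proj₁ (exec d (conf (j + k)))) (trans (cong δ q) h)) q

  -- From step K on the state is `good`, which has no instruction.
  alive : ∀ k {i} → δ (pc k) ≡ just i → k < K
  alive k h with k <? K
  ... | yes q = q
  ... | no q with m≤n⇒∃[o]m+o≡n (≮⇒≥ q)
  ...   | o , refl with trans (sym h) (trans (cong δ (trans (cong pc (+-comm K o))
                          (trans (stuck K o (trans (cong δ ends) δ-good)) ends))) δ-good)
  ...     | ()

  -- Both `good` and `bad` are terminal, so a run through both would be in both at step K + k.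
  not-bad : ∀ k → ¬ pc k ≡ bad
  not-bad k h with trans (sym (trans (stuck k K (trans (cong δ h) δ-bad)) h))
                   (trans (cong pc (+-comm K k)) (trans (stuck K k (trans (cong δ ends) δ-good)) ends))
  ... | ()

  incs decs : ℕ → Maybe Ins → Regs → Bool
  incs r (just (inc r′ _)) _   = r ≡ᵇ r′
  incs r _ _                   = false
  decs r (just (dec r′ _ _)) R = (r ≡ᵇ r′) ∧ not (R r′ ≡ᵇ 0)
  decs r _ _                   = false

  idles : Maybe Ins → Regs → Bool
  idles (just (dec r _ _)) R = R r ≡ᵇ 0
  idles _ _                  = false

  I₀ : Pr → Cell → Bool
  I₀ (fl first) x   = posOf x ≡ᵇ 0
  I₀ (fl under) x   = suc (posOf x) ≡ᵇ rowOf x * 4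
  I₀ (fl ext) x     = rowOf x * 4 ≤ᵇ posOf x
  I₀ (fl origin) x  = posOf x ≡ᵇ centre (par-of (rowOf x)) (rowOf x)
  I₀ (fl live) x    = rowOf x <ᵇ K
  I₀ (fl nop) x     = idles (δ (pc (rowOf x))) (R (rowOf x))
  I₀ (fl (par e)) x = par-of (rowOf x) ≟ᵇ e
  I₀ (fl (col l)) x = colour x ≟ᶜ l
  I₀ (bit r) x      = shows (par-of (rowOf x)) (rowOf x) (posOf x) (R (rowOf x) r)
  I₀ (zer r) x      = R (rowOf x) r ≡ᵇ 0
  I₀ (inc r) x      = incs r (δ (pc (rowOf x))) (R (rowOf x))
  I₀ (dec r) x      = decs r (δ (pc (rowOf x))) (R (rowOf x))
  I₀ (keep r) x     = not (I₀ (inc r) x ∨ I₀ (dec r) x)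
  I₀ (at p) x       = encode (at p) ≡ᵇ encode (at (pc (rowOf x)))

  -- Of row K only the first cell is included. It is the target of the last turn, and since no cell
  -- of row K is `live`, it demands no successor.
  N : ℕ
  N = proj₁ (path-row K)

  D : Set
  D = Fin (suc N)

  cell : D → Cell
  cell x = path (toℕ x)

  I : Pr → D → Bool
  I p x = I₀ p (cell x)

  J : ℕ → D → D → Bool
  J n x y = link n (cell x) (cell y)

  T : Fin 3 → D → D → Bool
  T i x y = same i (cell x) (cell y)

  open Semantics I J T

  successor : ∀ x → rowOf (cell x) < K → ∃ λ y → cell y ≡ nextCell (cell x)
  successor x h = fromℕ< (s≤s below) , cong path (toℕ-fromℕ< (s≤s below))
    where
    below : toℕ x < N
    below = ≤∧≢⇒< (s≤s⁻¹ (toℕ<n x)) λ q →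
      <-irrefl (cong rowOf (trans (cong path q) (proj₂ (path-row K)))) h

  ≤ᵇ-true : ∀ a b → a ≤ b → (a ≤ᵇ b) ≡ true
  ≤ᵇ-true zero b _    = refl
  ≤ᵇ-true (suc a) b h = <ᵇ-true h

  true-≤ᵇ : ∀ a b → (a ≤ᵇ b) ≡ true → a ≤ b
  true-≤ᵇ zero b _    = z≤n
  true-≤ᵇ (suc a) b h = true-<ᵇ a b h
    where true-<ᵇ : ∀ a b → (a <ᵇ b) ≡ true → a < b
          true-<ᵇ zero (suc b) _    = s≤s z≤n
          true-<ᵇ (suc a) (suc b) h = s≤s (true-<ᵇ a b h)

  true-≡ᵇ : ∀ {a b} → a ≡ b → (a ≡ᵇ b) ≡ true
  true-≡ᵇ {a} refl = ≡ᵇ-refl a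

  toLab : ∀ {e l} x → ⟦ lab e l ⟧ x → Lab e l (cell x)
  toLab x (p , q) = mkLab (≟ᵇ-true _ _ p) (≟ᶜ-true _ _ q)

  fromLab : ∀ {e l} x → Lab e l (cell x) → ⟦ lab e l ⟧ x
  fromLab x (mkLab refl refl) = ≟ᵇ-refl (par-of (rowOf (cell x))) , ≟ᶜ-refl (colour (cell x))

  next-ok : ∀ e l x → ⟦ flag live ∧ᵘ lab e l ∧ᵘ inside l ⟧ x →
            ∃ λ y → ⟦ snd (lab e (rot l)) ∧ᵇ next ∧ᵇ tra (band e (flip (rot l))) ∧ᵇ tra (band (not e) l) ⟧₂ x y
  next-ok e l x (v , h , i) with successor x (true-≤ᵇ _ _ v)
  ... | y , q with next-model e l (cell x) (toLab x h) (not-ext l i)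
    where not-ext : ∀ l → ⟦ inside l ⟧ x → ¬ (l ≡ c3 × I (fl ext) x ≡ true)
          not-ext c3 n (_ , m) = n m
  ...   | r rewrite sym q = y , fromLab y (proj₁ r) , proj₁ (proj₂ r) , proj₁ (proj₂ (proj₂ r)) , proj₂ (proj₂ (proj₂ r))

  turn-ok : ∀ e x → ⟦ flag live ∧ᵘ lab e c3 ∧ᵘ flag ext ⟧ x →
            ∃ λ y → ⟦ snd (lab (not e) c0 ∧ᵘ flag first ∧ᵘ ¬ᵘ flag ext) ∧ᵇ tra (wide e) ⟧₂ x y
  turn-ok e x (v , h , i) with successor x (true-≤ᵇ _ _ v)
  ... | y , q with turn-model e (cell x) (toLab x h) i
  ...   | r rewrite sym q = y , (fromLab y (proj₁ r) , true-≡ᵇ (proj₁ (proj₂ r)) , not-ext) , proj₂ (proj₂ (proj₂ r))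
    where not-ext : ¬ ⟦ flag ext ⟧ y
          not-ext m with true-≤ᵇ (rowOf (cell y) * 4) (posOf (cell y)) m
          ... | le rewrite proj₁ (proj₂ r) | proj₁ (proj₂ (proj₂ r)) with le
          ... | ()

  grid⊨ : ∀ e → Th⊨ (gridTh e)
  grid⊨ e =
      (λ l _ → (λ x y a (b , t) → vert-model e l (cell x) (cell y) (toLab x a) (toLab y b) t)
             , (λ x y a (b , t) → vert⁻-model e l (cell x) (cell y) (toLab x a) (toLab y b) t)
             , (λ x y a (b , t) → vert⁺-model e l (cell x) (cell y) (toLab x a) (toLab y b) t)
             , next-ok e l)
    , (λ x y a (b , t) → narrow-model e (cell x) (cell y) (toLab x a) (toLab y b) t)
    , (λ x y a (b , t) → widen-model e (cell x) (cell y) (toLab x a) (toLab y b) t)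
    , turn-ok e

  above⁻¹ : ∀ n x y → above n (cell x) (cell y) ≡ true →
            rowOf (cell y) ≡ suc (rowOf (cell x)) × posOf (cell x) + posOf (cell y) ≡ n + rowOf (cell x) * 4
  above⁻¹ n x y = true-above n (cell x) (cell y)

  next⁻¹ : ∀ x y → ⟦ next ⟧₂ x y → rowOf (cell y) ≡ rowOf (cell x) × posOf (cell y) ≡ suc (posOf (cell x))
  next⁻¹ x y = true-succeeds (cell x) (cell y)

  at-injective : ∀ {p q} → encode (at p) ≡ encode (at q) → p ≡ q
  at-injective {p} {q} h with trans (sym (decode-encode (at p))) (trans (cong decode h) (decode-encode (at q)))
  ... | refl = refl

  flags⊨ : Th⊨ flagTh
  flags⊨ =
      (λ x y a v → first-under x y (≡ᵇ-true _ _ a) (above⁻¹ 3 x y v))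
    , (λ x y a v m → a (true-≡ᵇ (under-first x y (≡ᵇ-true _ _ m) (above⁻¹ 3 x y v))))
    , (λ x y a n → ext-next x y a (next⁻¹ x y n))
    , (λ x y a n m → a (next-ext x y m (next⁻¹ x y n)))
    , (λ x y _ n m → not-first x y (≡ᵇ-true _ _ m) (next⁻¹ x y n))
    , (λ x y (a , b) n → origin-0 x y (≡ᵇ-true _ _ a) (true-≤ᵇ _ _ b) (next⁻¹ x y n))
    , (λ x y a v → origin-suc x y (≡ᵇ-true _ _ a) (above⁻¹ 3 x y v))
    , (λ x a → idle-live x a)
    , (λ x a _ → not-bad (rowOf (cell x)) (sym (at-injective (≡ᵇ-true _ _ a))))
    where
    module _ (x y : D) where
      k = rowOf (cell x)
      p = posOf (cell x)
      k′ = rowOf (cell y)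
      p′ = posOf (cell y)
      first-under : p ≡ 0 → k′ ≡ suc k × p + p′ ≡ 3 + k * 4 → (suc p′ ≡ᵇ k′ * 4) ≡ true
      first-under a (r , h) rewrite a | r = true-≡ᵇ (cong suc h)
      under-first : suc p′ ≡ k′ * 4 → k′ ≡ suc k × p + p′ ≡ 3 + k * 4 → p ≡ 0
      under-first m (r , h) = +-cancelʳ-≡ p′ p 0 (trans h (sym (suc-injective (trans m (cong (_* 4) r)))))
      ext-next : ⟦ flag under ∨ᵘ flag ext ⟧ x → k′ ≡ k × p′ ≡ suc p → (k′ * 4 ≤ᵇ p′) ≡ true
      ext-next (inj₁ u) (r , h) rewrite r | h = ≤ᵇ-true (k * 4) (suc p) (≤-reflexive (sym (≡ᵇ-true _ _ u)))
      ext-next (inj₂ u) (r , h) rewrite r | h = ≤ᵇ-true (k * 4) (suc p) (m≤n⇒m≤1+n (true-≤ᵇ _ _ u))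
      next-ext : (k′ * 4 ≤ᵇ p′) ≡ true → k′ ≡ k × p′ ≡ suc p → ⟦ flag under ∨ᵘ flag ext ⟧ x
      next-ext m (r , h) with m≤n⇒m<n∨m≡n (subst₂ _≤_ (cong (_* 4) r) h (true-≤ᵇ (k′ * 4) p′ m))
      ... | inj₁ q = inj₂ (≤ᵇ-true (k * 4) p (s≤s⁻¹ q))
      ... | inj₂ q = inj₁ (true-≡ᵇ (sym q))
      not-first : p′ ≡ 0 → k′ ≡ k × p′ ≡ suc p → ⊥
      not-first a (_ , h) with trans (sym a) h
      ... | ()
      origin-0 : p ≡ 0 → k * 4 ≤ p → k′ ≡ k × p′ ≡ suc p → (p′ ≡ᵇ centre (par-of k′) k′) ≡ true
      origin-0 a b (r , h) rewrite h | a | r with k | b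
      ... | zero | _ = refl
      origin-suc : p ≡ centre (par-of k) k → k′ ≡ suc k × p + p′ ≡ 3 + k * 4 → (p′ ≡ᵇ centre (par-of k′) k′) ≡ true
      origin-suc a (r , h) rewrite r = true-≡ᵇ (+-cancelˡ-≡ p p′ _ (trans h (trans (sym (centre-mirror k))
        (cong (_+ centre (par-of (suc k)) (suc k)) (sym a)))))
    idle-live : ∀ x → ⟦ flag nop ⟧ x → ⟦ flag live ⟧ x
    idle-live x h with δ (pc (rowOf (cell x))) in q
    ... | just (dec _ _ _) = <ᵇ-true (alive _ q)

  swaps-ok : ∀ r γ δ → (∀ x y → ⟦ γ ⟧ x → ⟦ δ ⟧₂ x y → I (bit r) y ≡ not (I (bit r) x)) → Th⊨ (swaps r γ δ)
  swaps-ok r γ δ h =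
      (λ x y (g , b) d m → clash (trans (h x y g d) (cong not b)) m)
    , (λ x y (g , b) d → trans (h x y g d) (cong not (≢true⇒false b)))

  exec-keep : ∀ i c r → not (incs r i (proj₂ c) ∨ decs r i (proj₂ c)) ≡ true → proj₂ (exec i c) r ≡ proj₂ c r
  exec-keep nothing c r _ = refl
  exec-keep (just (inc r′ _)) c r h with r ≡ᵇ r′ | h
  ... | false | _ = refl
  ... | true  | ()
  exec-keep (just (dec r′ _ _)) c r h with proj₂ c r′
  ... | zero = refl
  ... | suc v with r ≡ᵇ r′ | h
  ...   | false | _ = refl
  ...   | true  | ()

  exec-inc : ∀ i c r → incs r i (proj₂ c) ≡ true → proj₂ (exec i c) r ≡ suc (proj₂ c r)
  exec-inc (just (inc r′ _)) c r h with ≡ᵇ-true r r′ h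
  ... | refl rewrite h = refl

  exec-dec-eq : ∀ i c r → decs r i (proj₂ c) ≡ true → proj₂ c r ≡ suc (proj₂ (exec i c) r)
  exec-dec-eq (just (dec r′ _ _)) c r h with ≡ᵇ-true r r′ (proj₁ (∧-true h))
  ... | refl with proj₂ c r in v
  ...   | zero rewrite ≡ᵇ-refl r with h
  ...     | ()
  exec-dec-eq (just (dec r′ _ _)) c r h | refl | suc v rewrite ≡ᵇ-refl r = refl

  -- The number `n` is 3 for `vert`, 2 for `vert⁻` and 4 for `vert⁺`; the last hypothesis says that
  -- the change of the register makes up for its difference from 3.
  bit-suc : ∀ r x y n → rowOf (cell y) ≡ suc (rowOf (cell x)) →
    posOf (cell x) + posOf (cell y) ≡ n + rowOf (cell x) * 4 →
    (let k = rowOf (cell x) in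
     (par-of k ≡ false → n + R (suc k) r ≡ 3 + R k r) × (par-of k ≡ true → n + R k r ≡ 3 + R (suc k) r)) →
    I (bit r) y ≡ not (I (bit r) x)
  bit-suc r x y n q h (f , g) rewrite q =
    shows-suc k (posOf (cell x)) (posOf (cell y)) (R k r) (R (suc k) r) (λ e → go (f e)) (λ e → go (g e))
    where
    k = rowOf (cell x)
    go : ∀ {a b} → n + a ≡ 3 + b → posOf (cell x) + posOf (cell y) + a ≡ 3 + k * 4 + b
    go {a} {b} e = trans (cong (_+ a) h) (trans (swap n (k * 4) a) (trans (cong (_+ k * 4) e) (swap 3 b (k * 4))))
      where swap : ∀ a b c → a + b + c ≡ a + c + b
            swap = solve-∀

  live-inc : ∀ r x → ⟦ atom (inc r) ⟧ x → ⟦ flag live ⟧ x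
  live-inc r x h with δ (pc (rowOf (cell x))) in q
  ... | just (inc _ _) = <ᵇ-true (alive _ q)

  live-dec : ∀ r x → ⟦ atom (dec r) ⟧ x → ⟦ flag live ⟧ x
  live-dec r x h with δ (pc (rowOf (cell x))) in q
  ... | just (dec _ _ _) = <ᵇ-true (alive _ q)

  frame⊨ : ∀ r r′ → Th⊨ (frameTh r r′)
  frame⊨ r r′ with r ≡ᵇ r′ in ne
  ... | true  = live-inc r
  ... | false = (λ x h → go x (δ (pc (rowOf (cell x)))) h) , (λ x h → go′ x (δ (pc (rowOf (cell x)))) h)
    where
    go : ∀ x i → let R = R (rowOf (cell x)) in incs r i R ≡ true → not (incs r′ i R ∨ decs r′ i R) ≡ true
    go x (just (inc r″ _)) h with ≡ᵇ-true r r″ h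
    ... | refl rewrite ≡ᵇ-false-sym r r′ ne = refl
    go′ : ∀ x i → let R = R (rowOf (cell x)) in decs r i R ≡ true → not (incs r′ i R ∨ decs r′ i R) ≡ true
    go′ x (just (dec r″ _ _)) h with ≡ᵇ-true r r″ (proj₁ (∧-true h))
    ... | refl rewrite ≡ᵇ-false-sym r r′ ne = refl

  register⊨ : ∀ r → Th⊨ (registerTh rs r)
  register⊨ r =
      (λ x a → first-bit x (≡ᵇ-true _ _ a))
    , border-bit
    , swaps-ok r (atom (keep r)) vert (λ x y a v → let q , h = above⁻¹ 3 x y v in
        bit-suc r x y 3 q h (let e = exec-keep (δ (pc (rowOf (cell x)))) (conf (rowOf (cell x))) r a in
          (λ _ → cong (3 +_) e) , (λ _ → cong (3 +_) (sym e))))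
    , swaps-ok r (toward r) vert⁻ (λ x y a v → let q , h = above⁻¹ 2 x y v in bit-suc r x y 2 q h (minus x a))
    , swaps-ok r (away r) vert⁺ (λ x y a v → let q , h = above⁻¹ 4 x y v in bit-suc r x y 4 q h (plus x a))
    , (λ x (o , e , b) m → clash (trans (even x o e) (cong not m)) b)
    , (λ x (o , e , b) → ¬false (λ z → b (trans (even x o e) (cong not z))))
    , (λ x (o , e , b) → trans (sym (odd x o e)) b)
    , (λ x (o , e , b) m → b (trans (odd x o e) m))
    , (λ x y h n → trans (cong (λ k → R k r ≡ᵇ 0) (proj₁ (next⁻¹ x y n))) h)
    , (λ x y h n m → h (trans (cong (λ k → R k r ≡ᵇ 0) (sym (proj₁ (next⁻¹ x y n)))) m))
    , live-inc r
    , live-dec r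
    , nop-keep
    , (λ r′ _ → frame⊨ r r′)
    where
    bound : ∀ x → R (rowOf (cell x)) r ≤ rowOf (cell x)
    bound x = iter-bound (rowOf (cell x)) s r
    first-bit : ∀ x → posOf (cell x) ≡ 0 → I (bit r) x ≡ true
    first-bit x h rewrite h = shows-first (par-of (rowOf (cell x))) (rowOf (cell x)) _ (bound x)
    border-bit : ∀ x → ⟦ flag under ∨ᵘ flag ext ∧ᵘ ¬ᵘ flag first ⟧ x → ¬ I (bit r) x ≡ true
    border-bit x (inj₂ (e , n)) = false⇒≢true (shows-ext (rowOf (cell x)) (posOf (cell x)) _ (bound x)
      (n≢0⇒n>0 (λ z → n (true-≡ᵇ z))) (true-≤ᵇ _ _ e))
    border-bit x (inj₁ u) = go (rowOf (cell x)) (bound x) (≡ᵇ-true _ _ u)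
      where go : ∀ k → R k r ≤ k → suc (posOf (cell x)) ≡ k * 4 → ¬ shows (par-of k) k (posOf (cell x)) (R k r) ≡ true
            go (suc k) b h = false⇒≢true (shows-under k _ _ b (≤-reflexive (sym (suc-injective h))))
    inc-eq : ∀ x → ⟦ atom (inc r) ⟧ x → R (suc (rowOf (cell x))) r ≡ suc (R (rowOf (cell x)) r)
    inc-eq x h = exec-inc (δ (pc (rowOf (cell x)))) (conf (rowOf (cell x))) r h
    dec-eq : ∀ x → ⟦ atom (dec r) ⟧ x → R (rowOf (cell x)) r ≡ suc (R (suc (rowOf (cell x))) r)
    dec-eq x h = exec-dec-eq (δ (pc (rowOf (cell x)))) (conf (rowOf (cell x))) r h
    minus : ∀ x → ⟦ toward r ⟧ x → let k = rowOf (cell x) in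
      (par-of k ≡ false → 2 + R (suc k) r ≡ 3 + R k r) × (par-of k ≡ true → 2 + R k r ≡ 3 + R (suc k) r)
    minus x (inj₁ (e , i)) = (λ _ → cong (2 +_) (inc-eq x i)) , λ t → clash (≟ᵇ-true _ _ e) t
    minus x (inj₂ (e , i)) = (λ f → clash f (≟ᵇ-true _ _ e)) , λ _ → cong (2 +_) (dec-eq x i)
    plus : ∀ x → ⟦ away r ⟧ x → let k = rowOf (cell x) in
      (par-of k ≡ false → 4 + R (suc k) r ≡ 3 + R k r) × (par-of k ≡ true → 4 + R k r ≡ 3 + R (suc k) r)
    plus x (inj₁ (e , i)) = (λ f → clash f (≟ᵇ-true _ _ e)) , λ _ → cong (3 +_) (sym (inc-eq x i))
    plus x (inj₂ (e , i)) = (λ _ → cong (3 +_) (sym (dec-eq x i))) , λ t → clash (≟ᵇ-true _ _ e) t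
    ¬false : ∀ {b} → ¬ b ≡ false → b ≡ true
    ¬false {true} _  = refl
    ¬false {false} n = ⊥-elim (n refl)
    even : ∀ x → ⟦ flag origin ⟧ x → ⟦ flag (par false) ⟧ x → I (bit r) x ≡ not (I (zer r) x)
    even x o e = go (≟ᵇ-true _ _ e) (≡ᵇ-true _ _ o)
      where go : par-of (rowOf (cell x)) ≡ false → posOf (cell x) ≡ centre (par-of (rowOf (cell x))) (rowOf (cell x)) →
                 I (bit r) x ≡ not (I (zer r) x)
            go e o rewrite o | e = shows-centre-even (rowOf (cell x)) _
    odd : ∀ x → ⟦ flag origin ⟧ x → ⟦ flag (par true) ⟧ x → I (bit r) x ≡ I (zer r) x
    odd x o e = go (≟ᵇ-true _ _ e) (≡ᵇ-true _ _ o)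
      where go : par-of (rowOf (cell x)) ≡ true → posOf (cell x) ≡ centre (par-of (rowOf (cell x))) (rowOf (cell x)) →
                 I (bit r) x ≡ I (zer r) x
            go e o rewrite o | e = shows-centre-odd (rowOf (cell x)) _
    nop-keep : ∀ x → ⟦ flag nop ⟧ x → ⟦ atom (keep r) ⟧ x
    nop-keep x h with δ (pc (rowOf (cell x)))
    ... | just (dec r′ _ _) rewrite h with r ≡ᵇ r′
    ...   | true  = refl
    ...   | false = refl

  base⊨ : Th⊨ (baseTh rs)
  base⊨ = (λ e _ → grid⊨ e) , flags⊨ , (λ r _ → register⊨ r)

  ins⊨ : ∀ p i → δ p ≡ just i → Th⊨ (insTh p i)
  ins⊨ p i h = go i h
    where
    here? : ∀ x → ⟦ atom (at p) ⟧ x → p ≡ pc (rowOf (cell x))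
    here? x a = at-injective (≡ᵇ-true _ _ a)
    at-is : ∀ y {q} → pc (rowOf (cell y)) ≡ q → I (at q) y ≡ true
    at-is y refl = ≡ᵇ-refl (encode (at (pc (rowOf (cell y)))))
    stay : ∀ x y → ⟦ atom (at p) ⟧ x → ⟦ next ⟧₂ x y → ⟦ atom (at p) ⟧ y
    stay x y a n = at-is y (trans (cong pc (proj₁ (next⁻¹ x y n))) (sym (here? x a)))
    moved : ∀ x y {q} {d} → ⟦ vert ⟧₂ x y → δ p ≡ d → ⟦ atom (at p) ⟧ x →
            proj₁ (exec d (conf (rowOf (cell x)))) ≡ q → ⟦ atom (at q) ⟧ y
    moved x y v refl a e = at-is y (trans (cong pc (proj₁ (above⁻¹ 3 x y v)))
      (trans (cong (λ d → proj₁ (exec (δ d) (conf (rowOf (cell x))))) (sym (here? x a))) e))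
    instr : ∀ x {d} → ⟦ atom (at p) ⟧ x → δ p ≡ d → δ (pc (rowOf (cell x))) ≡ d
    instr x a e = trans (cong δ (sym (here? x a))) e
    go : ∀ i → δ p ≡ just i → Th⊨ (insTh p i)
    go (inc r j) h =
        (λ x a → trans (cong (λ d → incs r d (R (rowOf (cell x)))) (instr x a h)) (≡ᵇ-refl r))
      , (λ x y a v → moved x y v h a refl)
      , stay
    go (dec r j j′) h =
        (λ x (a , z) → trans (cong (λ d → idles d (R (rowOf (cell x)))) (instr x a h)) z)
      , (λ x (a , z) → trans (cong (λ d → decs r d (R (rowOf (cell x)))) (instr x a h))
                         (true-∧ (≡ᵇ-refl r) (cong not (≢true⇒false z))))
      , (λ x y (a , z) v → moved x y v h a (jump0 (conf (rowOf (cell x))) z))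
      , (λ x y (a , z) v → moved x y v h a (jump+ (conf (rowOf (cell x))) z))
      , stay
      where
      jump0 : ∀ c → (proj₂ c r ≡ᵇ 0) ≡ true → proj₁ (exec (just (dec r j j′)) c) ≡ j′
      jump0 c z with proj₂ c r
      ... | zero = refl
      jump+ : ∀ c → ¬ (proj₂ c r ≡ᵇ 0) ≡ true → proj₁ (exec (just (dec r j j′)) c) ≡ j
      jump+ c z with proj₂ c r
      ... | zero  = ⊥-elim (z refl)
      ... | suc _ = refl

  start⊨ : Clause⊨ (startClause s)
  start⊨ = zero , (refl , refl) , refl , refl , ≡ᵇ-refl (encode (at s))

  structure : Structure
  structure = record
    { Dom = D ; elem = zero ; P0 = λ _ → false ; P1 = λ n → I (decode n) ; P2 = J ; T = T
    ; T-trans = λ i x y w → same-trans i (cell x) (cell y) (cell w) }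

  satisfied : ∀ t → Th⊨ t → Satisfiable (sentence t)
  satisfied t h = structure , V , proj₂ (Truth.Th↔ structure V I (λ p x → cong (λ q → I q x) (decode-encode p)) t) h
    where V = Valuate.valuation structure (λ f → any? (λ x → dec-≡true (f x)))


-- The pairing function is kept opaque, since closed codes are astronomically large.
opaque
  pr : ℕ → ℕ → ℕ
  pr a b = tri (b + a) + b

  pr≡ : ∀ a b → pr a b ≡ tri (b + a) + b
  pr≡ a b = refl

  pair≡pr : ∀ a b → pair a b ≡ pr a b
  pair≡pr a b = cong (λ s → tri s + b) (+-comm a b)

#2 : FL2 → ℕ
#2 (nul p)   = pr 0 p
#2 (un p)    = pr 1 p
#2 (bin p)   = pr 2 p
#2 (tr i)    = pr 3 (toℕ i)
#2 (neg φ)   = pr 4 (#2 φ)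
#2 (and φ ψ) = pr 5 (pr (#2 φ) (#2 ψ))
#2 (or φ ψ)  = pr 6 (pr (#2 φ) (#2 ψ))

#1 : FL1 → ℕ
#1 (nul p)   = pr 0 p
#1 (un p)    = pr 1 p
#1 (neg φ)   = pr 2 (#1 φ)
#1 (and φ ψ) = pr 3 (pr (#1 φ) (#1 ψ))
#1 (or φ ψ)  = pr 4 (pr (#1 φ) (#1 ψ))
#1 (ex ψ)    = pr 5 (#2 ψ)
#1 (all ψ)   = pr 6 (#2 ψ)

#0 : FL0 → ℕ
#0 (nul p)   = pr 0 p
#0 (neg φ)   = pr 1 (#0 φ)
#0 (and φ ψ) = pr 2 (pr (#0 φ) (#0 ψ))
#0 (or φ ψ)  = pr 3 (pr (#0 φ) (#0 ψ))
#0 (ex ψ)    = pr 4 (#1 ψ)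
#0 (all ψ)   = pr 5 (#1 ψ)

pair-cong : ∀ {a b c d} → a ≡ c → b ≡ d → pair a b ≡ pr c d
pair-cong {a} {b} refl refl = pair≡pr a b

code2≡ : ∀ φ → code2 φ ≡ #2 φ
code2≡ (nul p)   = pair≡pr 0 p
code2≡ (un p)    = pair≡pr 1 p
code2≡ (bin p)   = pair≡pr 2 p
code2≡ (tr i)    = pair≡pr 3 (toℕ i)
code2≡ (neg φ)   = pair-cong refl (code2≡ φ)
code2≡ (and φ ψ) = pair-cong refl (pair-cong (code2≡ φ) (code2≡ ψ))
code2≡ (or φ ψ)  = pair-cong refl (pair-cong (code2≡ φ) (code2≡ ψ))

code1≡ : ∀ φ → code1 φ ≡ #1 φ
code1≡ (nul p)   = pair≡pr 0 p
code1≡ (un p)    = pair≡pr 1 p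
code1≡ (neg φ)   = pair-cong refl (code1≡ φ)
code1≡ (and φ ψ) = pair-cong refl (pair-cong (code1≡ φ) (code1≡ ψ))
code1≡ (or φ ψ)  = pair-cong refl (pair-cong (code1≡ φ) (code1≡ ψ))
code1≡ (ex ψ)    = pair-cong refl (code2≡ ψ)
code1≡ (all ψ)   = pair-cong refl (code2≡ ψ)

code0≡ : ∀ φ → code0 φ ≡ #0 φ
code0≡ (nul p)   = pair≡pr 0 p
code0≡ (neg φ)   = pair-cong refl (code0≡ φ)
code0≡ (and φ ψ) = pair-cong refl (pair-cong (code0≡ φ) (code0≡ ψ))
code0≡ (or φ ψ)  = pair-cong refl (pair-cong (code0≡ φ) (code0≡ ψ))
code0≡ (ex ψ)    = pair-cong refl (code1≡ ψ)
code0≡ (all ψ)   = pair-cong refl (code1≡ ψ)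

-- Injectivity of the Gödel numbering

tri-mono : ∀ {a b} → a ≤ b → tri a ≤ tri b
tri-mono z≤n     = z≤n
tri-mono (s≤s h) = +-mono-≤ (s≤s h) (tri-mono h)

-- The pairs with sum s receive codes below `tri (suc s)`, where the codes for the next sum begin.
pr-gap : ∀ a b c d → b + a < d + c → pr a b < pr c d
pr-gap a b c d h rewrite pr≡ a b | pr≡ c d = begin-strict
  tri (b + a) + b               ≤⟨ +-monoʳ-≤ (tri (b + a)) (m≤m+n b a) ⟩
  tri (b + a) + (b + a)         <⟨ n<1+n _ ⟩
  suc (tri (b + a) + (b + a))   ≡⟨ cong suc (+-comm (tri (b + a)) (b + a)) ⟩
  tri (suc (b + a))             ≤⟨ tri-mono h ⟩
  tri (d + c)                   ≤⟨ m≤m+n _ d ⟩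
  tri (d + c) + d               ∎
  where open ≤-Reasoning

pr-injective : ∀ a b c d → pr a b ≡ pr c d → a ≡ c × b ≡ d
pr-injective a b c d h with <-cmp (b + a) (d + c)
... | tri< q _ _ = ⊥-elim (<-irrefl h (pr-gap a b c d q))
... | tri> _ _ q = ⊥-elim (<-irrefl (sym h) (pr-gap c d a b q))
... | tri≈ _ q _ = +-cancelˡ-≡ b a c (trans q (cong (_+ c) (sym b≡d))) , b≡d
  where b≡d : b ≡ d
        b≡d = +-cancelˡ-≡ (tri (b + a)) b d
          (trans (sym (pr≡ a b)) (trans h (trans (pr≡ c d) (cong (λ s → tri s + d) (sym q)))))

-- Splitting a code into constructor tag and body spares the comparison of unlike constructors:
-- equal tags already force the same constructor.
tag2 body2 : FL2 → ℕ
tag2 (nul _)   = 0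
tag2 (un _)    = 1
tag2 (bin _)   = 2
tag2 (tr _)    = 3
tag2 (neg _)   = 4
tag2 (and _ _) = 5
tag2 (or _ _)  = 6
body2 (nul p)   = p
body2 (un p)    = p
body2 (bin p)   = p
body2 (tr i)    = toℕ i
body2 (neg φ)   = #2 φ
body2 (and φ ψ) = pr (#2 φ) (#2 ψ)
body2 (or φ ψ)  = pr (#2 φ) (#2 ψ)

#2-pr : ∀ φ → #2 φ ≡ pr (tag2 φ) (body2 φ)
#2-pr (nul _)   = refl
#2-pr (un _)    = refl
#2-pr (bin _)   = refl
#2-pr (tr _)    = refl
#2-pr (neg _)   = refl
#2-pr (and _ _) = refl
#2-pr (or _ _)  = refl

#2-split : ∀ φ ψ → #2 φ ≡ #2 ψ → tag2 φ ≡ tag2 ψ × body2 φ ≡ body2 ψ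
#2-split φ ψ h = pr-injective _ _ _ _ (trans (sym (#2-pr φ)) (trans h (#2-pr ψ)))

#2-injective : ∀ φ ψ → #2 φ ≡ #2 ψ → φ ≡ ψ
#2-same : ∀ φ ψ → tag2 φ ≡ tag2 ψ → body2 φ ≡ body2 ψ → φ ≡ ψ
#2-injective φ ψ h = #2-same φ ψ (proj₁ (#2-split φ ψ h)) (proj₂ (#2-split φ ψ h))
#2-same (nul _) (nul _) refl h = cong nul h
#2-same (un _) (un _) refl h   = cong un h
#2-same (bin _) (bin _) refl h = cong bin h
#2-same (tr _) (tr _) refl h   = cong tr (toℕ-injective h)
#2-same (neg φ) (neg ψ) refl h = cong neg (#2-injective φ ψ h)
#2-same (and φ φ′) (and ψ ψ′) refl h with pr-injective _ _ _ _ h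
... | a , b = cong₂ and (#2-injective φ ψ a) (#2-injective φ′ ψ′ b)
#2-same (or φ φ′) (or ψ ψ′) refl h with pr-injective _ _ _ _ h
... | a , b = cong₂ or (#2-injective φ ψ a) (#2-injective φ′ ψ′ b)

tag1 body1 : FL1 → ℕ
tag1 (nul _)   = 0
tag1 (un _)    = 1
tag1 (neg _)   = 2
tag1 (and _ _) = 3
tag1 (or _ _)  = 4
tag1 (ex _)    = 5
tag1 (all _)   = 6
body1 (nul p)   = p
body1 (un p)    = p
body1 (neg φ)   = #1 φ
body1 (and φ ψ) = pr (#1 φ) (#1 ψ)
body1 (or φ ψ)  = pr (#1 φ) (#1 ψ)
body1 (ex ψ)    = #2 ψ
body1 (all ψ)   = #2 ψ

#1-pr : ∀ φ → #1 φ ≡ pr (tag1 φ) (body1 φ)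
#1-pr (nul _)   = refl
#1-pr (un _)    = refl
#1-pr (neg _)   = refl
#1-pr (and _ _) = refl
#1-pr (or _ _)  = refl
#1-pr (ex _)    = refl
#1-pr (all _)   = refl

#1-split : ∀ φ ψ → #1 φ ≡ #1 ψ → tag1 φ ≡ tag1 ψ × body1 φ ≡ body1 ψ
#1-split φ ψ h = pr-injective _ _ _ _ (trans (sym (#1-pr φ)) (trans h (#1-pr ψ)))

#1-injective : ∀ φ ψ → #1 φ ≡ #1 ψ → φ ≡ ψ
#1-same : ∀ φ ψ → tag1 φ ≡ tag1 ψ → body1 φ ≡ body1 ψ → φ ≡ ψ
#1-injective φ ψ h = #1-same φ ψ (proj₁ (#1-split φ ψ h)) (proj₂ (#1-split φ ψ h))
#1-same (nul _) (nul _) refl h = cong nul h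
#1-same (un _) (un _) refl h   = cong un h
#1-same (neg φ) (neg ψ) refl h = cong neg (#1-injective φ ψ h)
#1-same (ex φ) (ex ψ) refl h   = cong ex (#2-injective φ ψ h)
#1-same (all φ) (all ψ) refl h = cong all (#2-injective φ ψ h)
#1-same (and φ φ′) (and ψ ψ′) refl h with pr-injective _ _ _ _ h
... | a , b = cong₂ and (#1-injective φ ψ a) (#1-injective φ′ ψ′ b)
#1-same (or φ φ′) (or ψ ψ′) refl h with pr-injective _ _ _ _ h
... | a , b = cong₂ or (#1-injective φ ψ a) (#1-injective φ′ ψ′ b)

tag0 body0 : FL0 → ℕ
tag0 (nul _)   = 0
tag0 (neg _)   = 1
tag0 (and _ _) = 2
tag0 (or _ _)  = 3
tag0 (ex _)    = 4
tag0 (all _)   = 5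
body0 (nul p)   = p
body0 (neg φ)   = #0 φ
body0 (and φ ψ) = pr (#0 φ) (#0 ψ)
body0 (or φ ψ)  = pr (#0 φ) (#0 ψ)
body0 (ex ψ)    = #1 ψ
body0 (all ψ)   = #1 ψ

#0-pr : ∀ φ → #0 φ ≡ pr (tag0 φ) (body0 φ)
#0-pr (nul _)   = refl
#0-pr (neg _)   = refl
#0-pr (and _ _) = refl
#0-pr (or _ _)  = refl
#0-pr (ex _)    = refl
#0-pr (all _)   = refl

#0-split : ∀ φ ψ → #0 φ ≡ #0 ψ → tag0 φ ≡ tag0 ψ × body0 φ ≡ body0 ψ
#0-split φ ψ h = pr-injective _ _ _ _ (trans (sym (#0-pr φ)) (trans h (#0-pr ψ)))

#0-injective : ∀ φ ψ → #0 φ ≡ #0 ψ → φ ≡ ψ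
#0-same : ∀ φ ψ → tag0 φ ≡ tag0 ψ → body0 φ ≡ body0 ψ → φ ≡ ψ
#0-injective φ ψ h = #0-same φ ψ (proj₁ (#0-split φ ψ h)) (proj₂ (#0-split φ ψ h))
#0-same (nul _) (nul _) refl h = cong nul h
#0-same (neg φ) (neg ψ) refl h = cong neg (#0-injective φ ψ h)
#0-same (ex φ) (ex ψ) refl h   = cong ex (#1-injective φ ψ h)
#0-same (all φ) (all ψ) refl h = cong all (#1-injective φ ψ h)
#0-same (and φ φ′) (and ψ ψ′) refl h with pr-injective _ _ _ _ h
... | a , b = cong₂ and (#0-injective φ ψ a) (#0-injective φ′ ψ′ b)
#0-same (or φ φ′) (or ψ ψ′) refl h with pr-injective _ _ _ _ h
... | a , b = cong₂ or (#0-injective φ ψ a) (#0-injective φ′ ψ′ b)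

code0-injective : ∀ φ ψ → code0 φ ≡ code0 ψ → φ ≡ ψ
code0-injective φ ψ h = #0-injective φ ψ (trans (sym (code0≡ φ)) (trans h (code0≡ ψ)))

-- Loop programs

infixr 5 _⨾_

data Cmd : Set where
  incr : Fin 9 → Cmd
  loop : Fin 9 → Cmd → Cmd
  _⨾_  : Cmd → Cmd → Cmd

infix 4 _⊢_⇓_

data _⊢_⇓_ : Cmd → Vec ℕ 9 → Vec ℕ 9 → Set where
  run-incr : ∀ {r S} → incr r ⊢ S ⇓ S [ r ]≔ suc (lookup S r)
  run-stop : ∀ {r c S} → lookup S r ≡ 0 → loop r c ⊢ S ⇓ S
  run-loop : ∀ {r c S S′ S″ n} → lookup S r ≡ suc n → c ⊢ S [ r ]≔ n ⇓ S′ → loop r c ⊢ S′ ⇓ S″ → loop r c ⊢ S ⇓ S″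
  _then_   : ∀ {c d S S′ S″} → c ⊢ S ⇓ S′ → d ⊢ S′ ⇓ S″ → c ⨾ d ⊢ S ⇓ S″

infixr 5 _then_

to : ∀ {c S S′ S″} → S′ ≡ S″ → c ⊢ S ⇓ S′ → c ⊢ S ⇓ S″
to refl h = h

-- `io` is register 0, where `initial` places the input of the given program. `var` holds the number
-- of a predicate `at (boot n)`, `acc` the code of the sentence built so far and `cnt` the rounds
-- left; `left` and `right` feed `pairing`.
io var acc cnt aux left right tmp tmp′ : Fin 9
io    = zero
var   = suc zero
acc   = suc (suc zero)
cnt   = suc (suc (suc zero))
aux   = suc (suc (suc (suc zero)))
left  = suc (suc (suc (suc (suc zero))))
right = suc (suc (suc (suc (suc (suc zero)))))
tmp   = suc (suc (suc (suc (suc (suc (suc zero))))))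
tmp′  = suc (suc (suc (suc (suc (suc (suc (suc zero)))))))

⟪_,_,_,_,_,_,_,_,_⟫ : (i v X n a x y s t : ℕ) → Vec ℕ 9
⟪ i , v , X , n , a , x , y , s , t ⟫ = i ∷ v ∷ X ∷ n ∷ a ∷ x ∷ y ∷ s ∷ t ∷ []

move : Fin 9 → Fin 9 → Cmd
move r s = loop r (incr s)

-- The first line forms the sum in `left` and starts `tmp` with the second component. Each round of
-- the second line adds the current sum to `tmp` and lowers it by 1, with `tmp′` restoring it, so
-- that a triangular number accumulates.
pairing : Cmd
pairing = loop right (incr left ⨾ incr tmp)
        ⨾ loop left (incr tmp ⨾ loop left (incr tmp ⨾ incr tmp′) ⨾ move tmp′ left)
        ⨾ move tmp right

module _ {i v X n a : ℕ} where

  right-left-tmp : ∀ x y s t → loop right (incr left ⨾ incr tmp) ⊢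
    ⟪ i , v , X , n , a , x , y , s , t ⟫ ⇓ ⟪ i , v , X , n , a , y + x , 0 , y + s , t ⟫
  right-left-tmp x zero s t    = run-stop refl
  right-left-tmp x (suc y) s t = run-loop refl (run-incr then run-incr)
    (to (cong₂ (λ p q → ⟪ i , v , X , n , a , p , 0 , q , t ⟫) (+-suc y x) (+-suc y s)) (right-left-tmp (suc x) y (suc s) t))

  left-tmp-tmp′ : ∀ x y s t → loop left (incr tmp ⨾ incr tmp′) ⊢
    ⟪ i , v , X , n , a , x , y , s , t ⟫ ⇓ ⟪ i , v , X , n , a , 0 , y , x + s , x + t ⟫
  left-tmp-tmp′ zero y s t    = run-stop refl
  left-tmp-tmp′ (suc x) y s t = run-loop refl (run-incr then run-incr)
    (to (cong₂ (λ p q → ⟪ i , v , X , n , a , 0 , y , p , q ⟫) (+-suc x s) (+-suc x t)) (left-tmp-tmp′ x y (suc s) (suc t)))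

  tmp′-left : ∀ x y s t → move tmp′ left ⊢
    ⟪ i , v , X , n , a , x , y , s , t ⟫ ⇓ ⟪ i , v , X , n , a , t + x , y , s , 0 ⟫
  tmp′-left x y s zero    = run-stop refl
  tmp′-left x y s (suc t) = run-loop refl run-incr
    (to (cong (λ p → ⟪ i , v , X , n , a , p , y , s , 0 ⟫) (+-suc t x)) (tmp′-left (suc x) y s t))

  tmp-right : ∀ x y s t → move tmp right ⊢
    ⟪ i , v , X , n , a , x , y , s , t ⟫ ⇓ ⟪ i , v , X , n , a , x , s + y , 0 , t ⟫
  tmp-right x y zero t    = run-stop refl
  tmp-right x y (suc s) t = run-loop refl run-incr
    (to (cong (λ p → ⟪ i , v , X , n , a , x , p , 0 , t ⟫) (+-suc s y)) (tmp-right x (suc y) s t))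

  triangle : ∀ x y s → loop left (incr tmp ⨾ loop left (incr tmp ⨾ incr tmp′) ⨾ move tmp′ left) ⊢
    ⟪ i , v , X , n , a , x , y , s , 0 ⟫ ⇓ ⟪ i , v , X , n , a , 0 , y , tri x + s , 0 ⟫
  triangle zero y s    = run-stop refl
  triangle (suc x) y s = run-loop refl (run-incr then left-tmp-tmp′ x y (suc s) 0 then
      to (cong (λ p → ⟪ i , v , X , n , a , p , y , x + suc s , 0 ⟫) (trans (+-identityʳ (x + 0)) (+-identityʳ x))) (tmp′-left 0 y (x + suc s) (x + 0)))
    (to (cong (λ p → ⟪ i , v , X , n , a , 0 , y , p , 0 ⟫) (shuffle (tri x) x s)) (triangle x y (x + suc s)))
    where shuffle : ∀ t x s → t + (x + suc s) ≡ suc x + t + s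
          shuffle = solve-∀

  pairing-ok : ∀ x y → pairing ⊢
    ⟪ i , v , X , n , a , x , y , 0 , 0 ⟫ ⇓ ⟪ i , v , X , n , a , 0 , pr x y , 0 , 0 ⟫
  pairing-ok x y = right-left-tmp x y 0 0 then triangle (y + x) 0 (y + 0) then
    to (cong (λ p → ⟪ i , v , X , n , a , 0 , p , 0 , 0 ⟫) (trans (+-identityʳ _)
        (trans (cong (tri (y + x) +_) (+-identityʳ y)) (sym (pr≡ x y)))))
      (tmp-right 0 0 (tri (y + x) + (y + 0)) 0)

incs : Fin 9 → ℕ → Cmd
-- This loop stands in for the empty command; it stops at once because `tmp` is 0 whenever it is
-- reached.
incs r zero    = loop tmp (incr tmp)
incs r (suc k) = incr r ⨾ incs r k

-- The constant is either a constructor tag or the code of a fixed subformula standing to the left.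
wrap : ℕ → Cmd
wrap k = incs left k ⨾ pairing

module _ {i v X n : ℕ} where

  incs-left : ∀ {a} k x y → incs left k ⊢
    ⟪ i , v , X , n , a , x , y , 0 , 0 ⟫ ⇓ ⟪ i , v , X , n , a , k + x , y , 0 , 0 ⟫
  incs-left zero x y    = run-stop refl
  incs-left {a} (suc k) x y = run-incr then
    to (cong (λ p → ⟪ i , v , X , n , a , p , y , 0 , 0 ⟫) (+-suc k x)) (incs-left k (suc x) y)

  incs-right : ∀ {a} k x y → incs right k ⊢
    ⟪ i , v , X , n , a , x , y , 0 , 0 ⟫ ⇓ ⟪ i , v , X , n , a , x , k + y , 0 , 0 ⟫
  incs-right zero x y    = run-stop refl
  incs-right {a} (suc k) x y = run-incr then
    to (cong (λ p → ⟪ i , v , X , n , a , x , p , 0 , 0 ⟫) (+-suc k y)) (incs-right k x (suc y))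

  wrap-ok : ∀ {a y} k → wrap k ⊢
    ⟪ i , v , X , n , a , 0 , y , 0 , 0 ⟫ ⇓ ⟪ i , v , X , n , a , 0 , pr k y , 0 , 0 ⟫
  wrap-ok {a} {y} k = to (cong (λ p → ⟪ i , v , X , n , a , p , y , 0 , 0 ⟫) (+-identityʳ k)) (incs-left k 0 y)
    then pairing-ok k y

  save-ok : ∀ y a → move right aux ⊢
    ⟪ i , v , X , n , a , 0 , y , 0 , 0 ⟫ ⇓ ⟪ i , v , X , n , y + a , 0 , 0 , 0 , 0 ⟫
  save-ok zero a    = run-stop refl
  save-ok (suc y) a = run-loop refl run-incr
    (to (cong (λ p → ⟪ i , v , X , n , p , 0 , 0 , 0 , 0 ⟫) (+-suc y a)) (save-ok y (suc a)))

  aux-left : ∀ a x y → move aux left ⊢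
    ⟪ i , v , X , n , a , x , y , 0 , 0 ⟫ ⇓ ⟪ i , v , X , n , 0 , a + x , y , 0 , 0 ⟫
  aux-left zero x y    = run-stop refl
  aux-left (suc a) x y = run-loop refl run-incr
    (to (cong (λ p → ⟪ i , v , X , n , 0 , p , y , 0 , 0 ⟫) (+-suc a x)) (aux-left a (suc x) y))

  join-ok : ∀ {a y} → move aux left ⨾ pairing ⊢
    ⟪ i , v , X , n , a , 0 , y , 0 , 0 ⟫ ⇓ ⟪ i , v , X , n , 0 , 0 , pr a y , 0 , 0 ⟫
  join-ok {a} {y} = to (cong (λ p → ⟪ i , v , X , n , 0 , p , y , 0 , 0 ⟫) (+-identityʳ a)) (aux-left a 0 y)
    then pairing-ok a y

  right-left : ∀ x y → move right left ⊢
    ⟪ i , v , X , n , 0 , x , y , 0 , 0 ⟫ ⇓ ⟪ i , v , X , n , 0 , y + x , 0 , 0 , 0 ⟫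
  right-left x zero    = run-stop refl
  right-left x (suc y) = run-loop refl run-incr
    (to (cong (λ p → ⟪ i , v , X , n , 0 , p , 0 , 0 , 0 ⟫) (+-suc y x)) (right-left (suc x) y))

load : Cmd
load = loop var (incr right ⨾ incr tmp) ⨾ move tmp var

load-ok : ∀ {i X n a} v → load ⊢ ⟪ i , v , X , n , a , 0 , 0 , 0 , 0 ⟫ ⇓ ⟪ i , v , X , n , a , 0 , v , 0 , 0 ⟫
load-ok {i} {X} {n} {a} v = to (cong₂ (λ p q → ⟪ i , 0 , X , n , a , 0 , p , q , 0 ⟫) (+-identityʳ v) (+-identityʳ v)) (out v 0 0)
  then to (cong (λ p → ⟪ i , p , X , n , a , 0 , v , 0 , 0 ⟫) (+-identityʳ v)) (back v 0)
  where
  out : ∀ v y s → loop var (incr right ⨾ incr tmp) ⊢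
    ⟪ i , v , X , n , a , 0 , y , s , 0 ⟫ ⇓ ⟪ i , 0 , X , n , a , 0 , v + y , v + s , 0 ⟫
  out zero y s    = run-stop refl
  out (suc v) y s = run-loop refl (run-incr then run-incr)
    (to (cong₂ (λ p q → ⟪ i , 0 , X , n , a , 0 , p , q , 0 ⟫) (+-suc v y) (+-suc v s)) (out v (suc y) (suc s)))
  back : ∀ {y} s v → move tmp var ⊢
    ⟪ i , v , X , n , a , 0 , y , s , 0 ⟫ ⇓ ⟪ i , s + v , X , n , a , 0 , y , 0 , 0 ⟫
  back zero v    = run-stop refl
  back {y} (suc s) v = run-loop refl run-incr
    (to (cong (λ p → ⟪ i , p , X , n , a , 0 , y , 0 , 0 ⟫) (+-suc s v)) (back s (suc v)))

conjoin : Cmd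
-- The constant 2 is the tag of `and` in `#0`.
conjoin = move right left ⨾ move acc right ⨾ pairing ⨾ wrap 2

push : Cmd
push = conjoin ⨾ move right acc

module _ {i v n : ℕ} where

  acc-right : ∀ {x} X y → move acc right ⊢
    ⟪ i , v , X , n , 0 , x , y , 0 , 0 ⟫ ⇓ ⟪ i , v , 0 , n , 0 , x , X + y , 0 , 0 ⟫
  acc-right zero y    = run-stop refl
  acc-right {x} (suc X) y = run-loop refl run-incr
    (to (cong (λ p → ⟪ i , v , 0 , n , 0 , x , p , 0 , 0 ⟫) (+-suc X y)) (acc-right X (suc y)))

  right-acc : ∀ X y → move right acc ⊢
    ⟪ i , v , X , n , 0 , 0 , y , 0 , 0 ⟫ ⇓ ⟪ i , v , y + X , n , 0 , 0 , 0 , 0 , 0 ⟫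
  right-acc X zero    = run-stop refl
  right-acc X (suc y) = run-loop refl run-incr
    (to (cong (λ p → ⟪ i , v , p , n , 0 , 0 , 0 , 0 , 0 ⟫) (+-suc y X)) (right-acc (suc X) y))

  conjoin-ok : ∀ X y → conjoin ⊢
    ⟪ i , v , X , n , 0 , 0 , y , 0 , 0 ⟫ ⇓ ⟪ i , v , 0 , n , 0 , 0 , pr 2 (pr y X) , 0 , 0 ⟫
  conjoin-ok X y = to (cong (λ p → ⟪ i , v , X , n , 0 , p , 0 , 0 , 0 ⟫) (+-identityʳ y)) (right-left 0 y)
    then to (cong (λ p → ⟪ i , v , 0 , n , 0 , y , p , 0 , 0 ⟫) (+-identityʳ X)) (acc-right X 0)
    then pairing-ok y X then wrap-ok 2

  push-ok : ∀ X y → push ⊢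
    ⟪ i , v , X , n , 0 , 0 , y , 0 , 0 ⟫ ⇓ ⟪ i , v , pr 2 (pr y X) , n , 0 , 0 , 0 , 0 , 0 ⟫
  push-ok X y = conjoin-ok X y then
    to (cong (λ p → ⟪ i , v , p , n , 0 , 0 , 0 , 0 , 0 ⟫) (+-identityʳ _)) (right-acc 0 (pr 2 (pr y X)))


-- The self-referential sentence

-- The clauses of `insTh` for the step from `boot (suc n)` to `boot n`, flattened into the
-- conjunction with `t` so that three uses of `push` extend the code of `t`.
bootClauses : ℕ → Th → Th
bootClauses n t =
     cl (unary (atom (at (boot (suc n)))) (atom (inc 0)))
  ∧ᵗ cl (forces (atom (at (boot (suc n)))) vert (snd (atom (at (boot n)))))
  ∧ᵗ cl (forces (atom (at (boot (suc n)))) next (snd (atom (at (boot (suc n))))))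
  ∧ᵗ t

booted : Th → ℕ → Th
booted t zero    = t
booted t (suc n) = bootClauses n (booted t n)

-- The number `n` enters only as the length of the boot chain, so the code of the result can be
-- computed from `n` and the code of `t`.
theory : Th → ℕ → Th
theory t n = cl (startClause (boot n)) ∧ᵗ booted t n

-- `var` describes `boot n`. The offset 9 in the guard leads to `boot (suc n)`, and `j` selects the
-- state in the conclusion: 9 for the same state along `next`, 0 for the following state along
-- `vert`. The code of the quantified part waits in `aux`.
forcesCode : ℕ → ℕ → Cmd
forcesCode k j = load ⨾ incs right j ⨾ wrap 1 ⨾ wrap k ⨾ wrap 6 ⨾ wrap 6 ⨾ move right aux
  ⨾ load ⨾ incs right 9 ⨾ wrap 1 ⨾ wrap 2 ⨾ (move aux left ⨾ pairing) ⨾ wrap 4 ⨾ wrap 5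

unaryCode : Cmd
unaryCode = load ⨾ incs right 9 ⨾ wrap 1 ⨾ wrap 2 ⨾ wrap (#1 (un (encode (inc 0)))) ⨾ wrap 4 ⨾ wrap 5

-- The clauses are produced in reverse order, because the innermost conjunct has to be pushed first.
bootStep : Cmd
bootStep = forcesCode (#2 (neg (bin 3))) 9 ⨾ push ⨾ forcesCode (#2 (neg (bin 0))) 0 ⨾ push
  ⨾ unaryCode ⨾ push ⨾ incs var 9

startCode : Cmd
startCode = move var right ⨾ wrap 1 ⨾ wrap (#1 (un (encode (fl ext)))) ⨾ wrap 3
  ⨾ wrap (#1 (un (encode (fl first)))) ⨾ wrap 3 ⨾ wrap (#1 (U₁ (lab false c0))) ⨾ wrap 3 ⨾ wrap 4

-- The diagonal substitution: the input is copied twice, once into `acc` as the code of a theory and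
-- once into `cnt` as the number to be written by the boot chain. The step from `boot 0` to `main 0`
-- has already put 1 into `var`, so 7 more give 8, the number of `at (boot 0)`.
selfApply : Cmd
selfApply = incs var 7 ⨾ loop io (incr acc ⨾ incr cnt) ⨾ loop cnt bootStep ⨾ startCode ⨾ conjoin ⨾ move right io

module _ {i X n : ℕ} where

  incs-var : ∀ k v → incs var k ⊢
    ⟪ i , v , X , n , 0 , 0 , 0 , 0 , 0 ⟫ ⇓ ⟪ i , k + v , X , n , 0 , 0 , 0 , 0 , 0 ⟫
  incs-var zero v    = run-stop refl
  incs-var (suc k) v = run-incr then
    to (cong (λ p → ⟪ i , p , X , n , 0 , 0 , 0 , 0 , 0 ⟫) (+-suc k v)) (incs-var k (suc v))

  forcesCode-ok : ∀ k j v → forcesCode k j ⊢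
    ⟪ i , v , X , n , 0 , 0 , 0 , 0 , 0 ⟫ ⇓
    ⟪ i , v , X , n , 0 , 0 , pr 5 (pr 4 (pr (pr 6 (pr 6 (pr k (pr 1 (j + v))))) (pr 2 (pr 1 (9 + v))))) , 0 , 0 ⟫
  forcesCode-ok k j v = load-ok v then incs-right j 0 v then wrap-ok 1 then wrap-ok k then wrap-ok 6 then wrap-ok 6
    then to (cong (λ p → ⟪ i , v , X , n , p , 0 , 0 , 0 , 0 ⟫) (+-identityʳ _)) (save-ok _ 0)
    then load-ok v then incs-right 9 0 v then wrap-ok 1 then wrap-ok 2 then join-ok then wrap-ok 4 then wrap-ok 5

  unaryCode-ok : ∀ v → unaryCode ⊢
    ⟪ i , v , X , n , 0 , 0 , 0 , 0 , 0 ⟫ ⇓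
    ⟪ i , v , X , n , 0 , 0 , pr 5 (pr 4 (pr (#1 (un (encode (inc 0)))) (pr 2 (pr 1 (9 + v))))) , 0 , 0 ⟫
  unaryCode-ok v = load-ok v then incs-right 9 0 v then wrap-ok 1 then wrap-ok 2 then wrap-ok _ then wrap-ok 4 then wrap-ok 5

bootStep-ok : ∀ {i n} t m → bootStep ⊢
  ⟪ i , indexed 8 m , #0 (sentence t) , n , 0 , 0 , 0 , 0 , 0 ⟫ ⇓
  ⟪ i , indexed 8 (suc m) , #0 (sentence (bootClauses m t)) , n , 0 , 0 , 0 , 0 , 0 ⟫
bootStep-ok t m = forcesCode-ok _ 9 _ then push-ok _ _ then forcesCode-ok _ 0 _ then push-ok _ _
  then unaryCode-ok _ then push-ok _ _ then incs-var 9 _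

boot-loop : ∀ {i} t m n → loop cnt bootStep ⊢
  ⟪ i , indexed 8 m , #0 (sentence (booted t m)) , n , 0 , 0 , 0 , 0 , 0 ⟫ ⇓
  ⟪ i , indexed 8 (n + m) , #0 (sentence (booted t (n + m))) , 0 , 0 , 0 , 0 , 0 , 0 ⟫
boot-loop t m zero = run-stop refl
boot-loop {i} t m (suc n) = run-loop refl (bootStep-ok (booted t m) m)
  (to (cong (λ k → ⟪ i , indexed 8 k , #0 (sentence (booted t k)) , 0 , 0 , 0 , 0 , 0 , 0 ⟫) (+-suc n m)) (boot-loop t (suc m) n))

copy-io : ∀ {v} i X n → loop io (incr acc ⨾ incr cnt) ⊢
  ⟪ i , v , X , n , 0 , 0 , 0 , 0 , 0 ⟫ ⇓ ⟪ 0 , v , i + X , i + n , 0 , 0 , 0 , 0 , 0 ⟫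
copy-io zero X n = run-stop refl
copy-io {v} (suc i) X n = run-loop refl (run-incr then run-incr)
  (to (cong₂ (λ p q → ⟪ 0 , v , p , q , 0 , 0 , 0 , 0 , 0 ⟫) (+-suc i X) (+-suc i n)) (copy-io i (suc X) (suc n)))

var-right : ∀ {i X} v y → move var right ⊢
  ⟪ i , v , X , 0 , 0 , 0 , y , 0 , 0 ⟫ ⇓ ⟪ i , 0 , X , 0 , 0 , 0 , v + y , 0 , 0 ⟫
var-right zero y = run-stop refl
var-right {i} {X} (suc v) y = run-loop refl run-incr
  (to (cong (λ p → ⟪ i , 0 , X , 0 , 0 , 0 , p , 0 , 0 ⟫) (+-suc v y)) (var-right v (suc y)))

right-io : ∀ i y → move right io ⊢
  ⟪ i , 0 , 0 , 0 , 0 , 0 , y , 0 , 0 ⟫ ⇓ ⟪ y + i , 0 , 0 , 0 , 0 , 0 , 0 , 0 , 0 ⟫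
right-io i zero    = run-stop refl
right-io i (suc y) = run-loop refl run-incr
  (to (cong (λ p → ⟪ p , 0 , 0 , 0 , 0 , 0 , 0 , 0 , 0 ⟫) (+-suc y i)) (right-io (suc i) y))

selfApply-ok : ∀ t → let c = #0 (sentence t) in selfApply ⊢
  ⟪ c , 1 , 0 , 0 , 0 , 0 , 0 , 0 , 0 ⟫ ⇓ ⟪ #0 (sentence (theory t c)) , 0 , 0 , 0 , 0 , 0 , 0 , 0 , 0 ⟫
selfApply-ok t = incs-var 7 1
  then to (cong₂ (λ p q → ⟪ 0 , 8 , p , q , 0 , 0 , 0 , 0 , 0 ⟫) (+-identityʳ c) (+-identityʳ c)) (copy-io c 0 0)
  then to (cong (λ k → ⟪ 0 , indexed 8 k , #0 (sentence (booted t k)) , 0 , 0 , 0 , 0 , 0 , 0 ⟫) (+-identityʳ c)) (boot-loop t 0 c)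
  then start-ok (indexed 8 c) then conjoin-ok _ _
  then to (cong (λ p → ⟪ p , 0 , 0 , 0 , 0 , 0 , 0 , 0 , 0 ⟫) (+-identityʳ _)) (right-io 0 _)
  where
  c = #0 (sentence t)
  start-ok : ∀ {X} v → startCode ⊢ ⟪ 0 , v , X , 0 , 0 , 0 , 0 , 0 , 0 ⟫ ⇓
    ⟪ 0 , 0 , X , 0 , 0 , 0 , pr 4 (pr 3 (pr (#1 (U₁ (lab false c0))) (pr 3 (pr (#1 (un (encode (fl first))))
      (pr 3 (pr (#1 (un (encode (fl ext)))) (pr 1 v))))))) , 0 , 0 ⟫
  start-ok {X} v = to (cong (λ p → ⟪ 0 , 0 , X , 0 , 0 , 0 , p , 0 , 0 ⟫) (+-identityʳ v)) (var-right v 0)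
    then wrap-ok 1 then wrap-ok _ then wrap-ok 3 then wrap-ok _ then wrap-ok 3 then wrap-ok _ then wrap-ok 3 then wrap-ok 4

-- Compilation to counter machines

size : Cmd → ℕ
size (incr r)   = 1
size (loop r c) = suc (size c)
size (c ⨾ d)    = size c + size d

compile : Cmd → ℕ → PC → List Ins
compile (incr r) b e   = inc (toℕ r) e ∷ []
compile (loop r c) b e = dec (toℕ r) (main (suc b)) e ∷ compile c (suc b) (main b)
compile (c ⨾ d) b e    = compile c b (main (size c + b)) ++ compile d (size c + b) e

nth-++ˡ : ∀ {A : Set} (xs ys : List A) i {x} → nth xs i ≡ just x → nth (xs ++ ys) i ≡ just x
nth-++ˡ (x ∷ xs) ys zero h    = h
nth-++ˡ (x ∷ xs) ys (suc i) h = nth-++ˡ xs ys i h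

nth-compile : ∀ c {b e} ys i → nth (compile c b e ++ ys) (size c + i) ≡ nth ys i
nth-compile (incr r) ys i   = refl
nth-compile (loop r c) ys i = nth-compile c ys i
nth-compile (c ⨾ d) {b} {e} ys i rewrite ++-assoc (compile c b (main (size c + b))) (compile d (size c + b) e) ys
  | +-assoc (size c) (size d) i = trans (nth-compile c (compile d (size c + b) e ++ ys) (size d + i)) (nth-compile d ys i)

infix 4 _≈_

-- Registers are functions that different computations build in different ways, so they are compared
-- pointwise.
_≈_ : PC × Regs → PC × Regs → Set
(p , R) ≈ (p′ , R′) = p ≡ p′ × (∀ r → R r ≡ R′ r)

≈-trans : ∀ {c d e} → c ≈ d → d ≈ e → c ≈ e
≈-trans (p , f) (q , g) = trans p q , λ r → trans (f r) (g r)

update-cong : ∀ {R R′ : Regs} r {v v′} → v ≡ v′ → (∀ q → R q ≡ R′ q) → ∀ q → update R r v q ≡ update R′ r v′ q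
update-cong r e h q with q ≡ᵇ r
... | true  = e
... | false = h q

exec-cong : ∀ i {c d} → c ≈ d → exec i c ≈ exec i d
exec-cong nothing h = h
exec-cong (just (inc r j)) (_ , h) = refl , update-cong r (cong suc (h r)) h
exec-cong (just (dec r j k)) {_ , R} {_ , R′} (_ , h) with R r | R′ r | h r
... | zero  | _ | refl = refl , h
... | suc v | _ | refl = refl , update-cong r refl h

⌊_⌋ : ∀ {n} → Vec ℕ n → Regs
⌊ [] ⌋ _          = 0
⌊ x ∷ S ⌋ zero    = x
⌊ x ∷ S ⌋ (suc r) = ⌊ S ⌋ r

⌊⌋-lookup : ∀ {n} (S : Vec ℕ n) r → ⌊ S ⌋ (toℕ r) ≡ lookup S r
⌊⌋-lookup (x ∷ S) zero    = refl
⌊⌋-lookup (x ∷ S) (suc r) = ⌊⌋-lookup S r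

⌊⌋-update : ∀ {n} (S : Vec ℕ n) r v q → update ⌊ S ⌋ (toℕ r) v q ≡ ⌊ S [ r ]≔ v ⌋ q
⌊⌋-update (x ∷ S) zero v zero       = refl
⌊⌋-update (x ∷ S) zero v (suc q)    = refl
⌊⌋-update (x ∷ S) (suc r) v zero    = refl
⌊⌋-update (x ∷ S) (suc r) v (suc q) = ⌊⌋-update S r v q

module Reach (δ : PC → Maybe Ins) where
  open Run δ

  Reaches : PC × Regs → PC × Regs → Set
  Reaches c d = ∃ λ k → iter k c ≈ d

  iter-cong : ∀ k {c d} → c ≈ d → iter k c ≈ iter k d
  iter-cong zero h = h
  iter-cong (suc k) {c} {d} h with iter k c | iter k d | iter-cong k h
  ... | p , R | _ , R′ | refl , f = exec-cong (δ p) (refl , f)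

  iter-+ : ∀ j k c → iter (j + k) c ≡ iter j (iter k c)
  iter-+ zero k c    = refl
  iter-+ (suc j) k c = cong (λ d → exec (δ (proj₁ d)) d) (iter-+ j k c)

  now : ∀ {c d} → c ≈ d → Reaches c d
  now h = 0 , h

  infixr 5 _▷_

  _▷_ : ∀ {c d e} → Reaches c d → Reaches d e → Reaches c e
  _▷_ {c} {d} {e} (k , h) (j , g) =
    j + k , ≈-trans (subst (_≈ iter j d) (sym (iter-+ j k c)) (iter-cong j h)) g

  one : ∀ {p R i} → δ p ≡ just i → Reaches (p , R) (exec (just i) (p , R))
  one {p} {R} {i} h = 1 , subst (λ d → exec d (p , R) ≈ exec (just i) (p , R)) (sym h) (refl , λ _ → refl)

  Placed : List Ins → ℕ → Set
  Placed is b = ∀ j {i} → nth is j ≡ just i → δ (main (j + b)) ≡ just i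

  -- The induction runs over the evaluation rather than the command, since a loop re-enters its own
  -- code at `main b`.
  simulate : ∀ {c S S′} → c ⊢ S ⇓ S′ → ∀ b e → Placed (compile c b e) b →
             Reaches (main b , ⌊ S ⌋) (e , ⌊ S′ ⌋)
  simulate {incr r} {S} run-incr b e pl = one (pl 0 refl) ▷ now (refl , λ q →
    trans (update-cong {⌊ S ⌋} {⌊ S ⌋} (toℕ r) (cong suc (⌊⌋-lookup S r)) (λ _ → refl) q) (⌊⌋-update S r _ q))
  simulate {c ⨾ d} (g then h) b e pl =
      simulate g b (main (size c + b)) (λ j q → pl j (nth-++ˡ (compile c b (main (size c + b))) (compile d (size c + b) e) j q))
    ▷ simulate h (size c + b) e (λ j {i} q → trans (cong (λ k → δ (main k)) (shuffle j (size c) b))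
        (pl (size c + j) (trans (nth-compile c (compile d (size c + b) e) j) q)))
    where shuffle : ∀ j s b → j + (s + b) ≡ s + j + b
          shuffle = solve-∀
  simulate {loop r c} {S} (run-stop z) b e pl = one (pl 0 refl) ▷ now (go (⌊ S ⌋ (toℕ r)) (trans (⌊⌋-lookup S r) z))
    where go : ∀ v → v ≡ 0 → exec-dec (toℕ r) (main (suc b)) e ⌊ S ⌋ v ≈ (e , ⌊ S ⌋)
          go _ refl = refl , λ _ → refl
  simulate {loop r c} {S} (run-loop {n = n} z g h) b e pl =
      one (pl 0 refl)
    ▷ now (go (⌊ S ⌋ (toℕ r)) (trans (⌊⌋-lookup S r) z))
    ▷ simulate g (suc b) (main b) (λ j q → trans (cong (λ k → δ (main k)) (+-suc j b)) (pl (suc j) q))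
    ▷ simulate h b e pl
    where go : ∀ v → v ≡ suc n → exec-dec (toℕ r) (main (suc b)) e ⌊ S ⌋ v ≈ (main (suc b) , ⌊ S [ r ]≔ n ⌋)
          go _ refl = refl , ⌊⌋-update S r n

-- The machine that questions `P` about its own sentence

module Machine (P : Program) where

  target : ℕ → PC
  target j with nth P j
  ... | nothing = exit
  ... | just _  = prog j

  translate : Instr → Ins
  translate (INC r j)   = inc r (target j)
  translate (DEC r j k) = dec r (target j) (target k)

  abstract
    mainCode : List Ins
    mainCode = compile selfApply 0 (target 0)

    mainCode-is : mainCode ≡ compile selfApply 0 (target 0)
    mainCode-is = refl

  progCode : List Ins
  progCode = map translate P

  label : (ℕ → PC) → List Ins → List (PC × Ins)
  label f []       = []
  label f (i ∷ is) = (f 0 , i) ∷ label (λ n → f (suc n)) is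

  ∈-label : ∀ f is n {i} → nth is n ≡ just i → (f n , i) ∈ label f is
  ∈-label f (i ∷ is) zero refl  = here refl
  ∈-label f (i ∷ is) (suc n) h  = there (∈-label (λ n → f (suc n)) is n h)

  label-∈ : ∀ f is {p i} → (p , i) ∈ label f is → ∃ λ n → p ≡ f n × nth is n ≡ just i
  label-∈ f (i ∷ is) (here refl) = 0 , refl , refl
  label-∈ f (i ∷ is) (there h) with label-∈ (λ n → f (suc n)) is h
  ... | n , q , e = suc n , q , e

  -- The instructions described by `core`. The boot chain beyond `boot 0` must stay outside, because
  -- its length is the code of `core`. At `exit` a nonzero answer leads to `bad` and the answer 0 to
  -- `good`.
  listed : List (PC × Ins)
  listed = (exit , dec 0 bad good) ∷ (boot 0 , inc 1 (main 0)) ∷ label main mainCode ++ label prog progCode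

  registers : List ℕ
  registers = map (λ q → reg (proj₂ q)) listed

  core : Th
  core = baseTh registers ∧ᵗ ⋀ listed (λ q → insTh (proj₁ q) (proj₂ q))

  abstract
    input : ℕ
    input = #0 (sentence core)

    input-is : input ≡ #0 (sentence core)
    input-is = refl

  whole : Th
  whole = theory core input

  δ : PC → Maybe Ins
  δ good           = nothing
  δ bad            = nothing
  δ exit           = just (dec 0 bad good)
  δ (main n)       = nth mainCode n
  δ (prog n)       = nth progCode n
  δ (boot zero)    = just (inc 1 (main 0))
  -- The chain is cut off at `input`, in accordance with the boot clauses that `whole` contains.
  δ (boot (suc n)) = if n <ᵇ input then just (inc 0 (boot n)) else nothing

  δ-listed : ∀ {p i} → (p , i) ∈ listed → δ p ≡ just i
  δ-listed (here refl)         = refl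
  δ-listed (there (here refl)) = refl
  δ-listed (there (there h)) with ∈-++⁻ (label main mainCode) h
  ... | inj₁ g with label-∈ main mainCode g
  ...   | n , refl , e = e
  δ-listed (there (there h)) | inj₂ g with label-∈ prog progCode g
  ...   | n , refl , e = e

  δ-boot : ∀ {n} → n < input → δ (boot (suc n)) ≡ just (inc 0 (boot n))
  δ-boot {n} h rewrite <ᵇ-true h = refl

  listed-δ : ∀ p i → δ p ≡ just i → (p , i) ∈ listed ⊎ ∃ λ n → n < input × p ≡ boot (suc n) × i ≡ inc 0 (boot n)
  listed-δ exit _ refl           = inj₁ (here refl)
  listed-δ (main n) i h          = inj₁ (there (there (∈-++⁺ˡ (∈-label main mainCode n h))))
  listed-δ (prog n) i h          = inj₁ (there (there (∈-++⁺ʳ (label main mainCode) (∈-label prog progCode n h))))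
  listed-δ (boot zero) _ refl    = inj₁ (there (here refl))
  listed-δ (boot (suc n)) i h with n <? input
  ... | yes q = inj₂ (n , q , refl , just-injective (trans (sym h) (δ-boot q)))
  ... | no q rewrite <ᵇ-false (≮⇒≥ q) with h
  ...   | ()

  reg-listed : ∀ p i → δ p ≡ just i → reg i ∈ registers
  reg-listed p i h with listed-δ p i h
  ... | inj₁ m                  = ∈-map⁺ (λ q → reg (proj₂ q)) m
  -- The boot chain increments register 0, which is listed because `exit` tests it.
  ... | inj₂ (n , _ , _ , refl) = here refl

  open Run δ
  open Reach δ

  bootRun : ∀ n R → n ≤ input → Reaches (boot n , R) (boot 0 , update R 0 (n + R 0))
  bootRun zero R _    = now (refl , λ { zero → refl ; (suc q) → refl })
  bootRun (suc n) R h = one (δ-boot h) ▷ bootRun n (update R 0 (suc (R 0))) (≤-trans (n≤1+n n) h) ▷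
    now (refl , λ { zero → +-suc n (R 0) ; (suc q) → refl })

  zeros : ∀ n q → ⌊ replicate n 0 ⌋ q ≡ 0
  zeros zero q          = refl
  zeros (suc n) zero    = refl
  zeros (suc n) (suc q) = zeros n q

  toMain : ∀ n → n ≤ input → Reaches (boot n , λ _ → 0) (main 0 , ⌊ ⟪ n , 1 , 0 , 0 , 0 , 0 , 0 , 0 , 0 ⟫ ⌋)
  toMain n h = bootRun n (λ _ → 0) h ▷ one refl
    ▷ now (refl , λ { zero → +-identityʳ n ; (suc zero) → refl ; (suc (suc q)) → sym (zeros 7 q) })

  fromMain : ∀ {m n} → selfApply ⊢ ⟪ m , 1 , 0 , 0 , 0 , 0 , 0 , 0 , 0 ⟫ ⇓ ⟪ n , 0 , 0 , 0 , 0 , 0 , 0 , 0 , 0 ⟫ →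
             Reaches (main 0 , ⌊ ⟪ m , 1 , 0 , 0 , 0 , 0 , 0 , 0 , 0 ⟫ ⌋) (target 0 , proj₂ (initial n))
  fromMain {m} {n} h =
      simulate h 0 (target 0) (λ j q → trans (cong (nth mainCode) (+-identityʳ j)) (trans (cong (λ l → nth l j) mainCode-is) q))
    ▷ now (refl , λ { zero → refl ; (suc q) → zeros 8 q })

  -- As `input` is the code of `core`, `selfApply` turns it into the code of `theory core input`,
  -- which is the sentence describing this very run.
  toProgram : Reaches (boot input , λ _ → 0) (target 0 , proj₂ (initial (code0 (sentence whole))))
  toProgram = toMain input ≤-refl ▷ fromMain (computed (#0 (sentence core)) input-is (selfApply-ok core))
    where
    computed : ∀ n → input ≡ n → selfApply ⊢ ⟪ n , 1 , 0 , 0 , 0 , 0 , 0 , 0 , 0 ⟫ ⇓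
                 ⟪ #0 (sentence (theory core n)) , 0 , 0 , 0 , 0 , 0 , 0 , 0 , 0 ⟫ →
               selfApply ⊢ ⟪ input , 1 , 0 , 0 , 0 , 0 , 0 , 0 , 0 ⟫ ⇓ ⟪ code0 (sentence whole) , 0 , 0 , 0 , 0 , 0 , 0 , 0 , 0 ⟫
    computed _ refl h = to (cong (λ m → ⟪ m , 0 , 0 , 0 , 0 , 0 , 0 , 0 , 0 ⟫) (sym (code0≡ (sentence whole)))) h

  target-halt : ∀ p → nth P p ≡ nothing → target p ≡ exit
  target-halt p h rewrite h = refl

  target-prog : ∀ p {i} → nth P p ≡ just i → target p ≡ prog p
  target-prog p h rewrite h = refl

  nth-map : ∀ is n {i} → nth is n ≡ just i → nth (map translate is) n ≡ just (translate i)
  nth-map (_ ∷ is) zero refl = refl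
  nth-map (_ ∷ is) (suc n) h = nth-map is n h

  step-halt : ∀ p R → nth P p ≡ nothing → step P (p , R) ≡ (p , R)
  step-halt p R h rewrite h = refl

  step-exec : ∀ p q R {i} → nth P p ≡ just i →
    exec (just (translate i)) (q , R) ≈ (target (proj₁ (step P (p , R))) , proj₂ (step P (p , R)))
  step-exec p q R {i} h with nth P p
  step-exec p q R {INC r j} refl | _ = refl , λ _ → refl
  step-exec p q R {DEC r j k} refl | _ with R r
  ... | zero  = refl , λ _ → refl
  ... | suc v = refl , λ _ → refl

  programRun : ∀ k p R → Halted P (run P k (p , R)) → Reaches (target p , R) (exit , proj₂ (run P k (p , R)))
  programRun zero p R h = now (target-halt p h , λ _ → refl)
  programRun (suc k) p R h = go (nth P p) refl
    where
    go : ∀ i → nth P p ≡ i → Reaches (target p , R) (exit , proj₂ (run P (suc k) (p , R)))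
    go nothing e = subst (λ d → Reaches (target p , R) (exit , proj₂ (run P k d))) (sym (step-halt p R e))
      (programRun k p R (subst (λ d → Halted P (run P k d)) (step-halt p R e) h))
    go (just i) e = now (target-prog p e , λ _ → refl) ▷ one (nth-map P p e) ▷ now (step-exec p (prog p) R e)
      ▷ programRun k (proj₁ (step P (p , R))) (proj₂ (step P (p , R))) h

  verdict : ∀ {s N n} → Reaches s (target 0 , proj₂ (initial N)) → Computes P N n →
            ∃ λ k → proj₁ (iter k s) ≡ (if n ≡ᵇ 0 then good else bad)
  verdict {s} {N} {n} r (k , h , out) = finish (r ▷ programRun k 0 _ h ▷ one refl)
    where
    R = proj₂ (run P k (initial N))
    go : ∀ v → v ≡ n → proj₁ (exec-dec 0 bad good R v) ≡ (if n ≡ᵇ 0 then good else bad)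
    go zero refl    = refl
    go (suc _) refl = refl
    finish : Reaches s (exec-dec 0 bad good R (R 0)) → ∃ λ k → proj₁ (iter k s) ≡ (if n ≡ᵇ 0 then good else bad)
    finish (j , e , _) = j , trans e (go (R 0) out)

  outcome : ∀ {n} → Computes P (code0 (sentence whole)) n →
            ∃ λ k → proj₁ (iter k (boot input , λ _ → 0)) ≡ (if n ≡ᵇ 0 then good else bad)
  outcome = verdict toProgram

  module _ {D : Set} (I : Pr → D → Bool) (J : ℕ → D → D → Bool) (T : Fin 3 → D → D → Bool) where
    open Semantics I J T

    booted⁻ : ∀ t m → Th⊨ (booted t m) → Th⊨ t × (∀ n → n < m → Th⊨ (insTh (boot (suc n)) (inc 0 (boot n))))
    booted⁻ t zero h = h , λ n ()
    booted⁻ t (suc m) (a , b , d , h) with booted⁻ t m h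
    ... | g , f = g , λ n q → case n (m≤n⇒m<n∨m≡n (s≤s⁻¹ q))
      where case : ∀ n → n < m ⊎ n ≡ m → Th⊨ (insTh (boot (suc n)) (inc 0 (boot n)))
            case n (inj₁ q)    = f n q
            case n (inj₂ refl) = a , b , d

    booted⁺ : ∀ t m → Th⊨ t → (∀ n → n < m → Th⊨ (insTh (boot (suc n)) (inc 0 (boot n)))) → Th⊨ (booted t m)
    booted⁺ t zero h f = h
    booted⁺ t (suc m) h f with f m ≤-refl
    ... | a , b , d = a , b , d , booted⁺ t m h (λ n q → f n (m≤n⇒m≤1+n q))

  unsatisfiable : ∀ k → proj₁ (iter k (boot input , λ _ → 0)) ≡ bad → ¬ Satisfiable (sentence whole)
  unsatisfiable k e (M , V , v) = Refute.unreachable I P2 T T-trans registers (proj₁ core⊨) δ ins⊨ reg-listed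
    (boot input) (proj₁ whole⊨) k e
    where
    open Structure M
    I : Pr → Dom → Bool
    I p = P1 (encode p)
    open Truth M V I (λ _ _ → refl)
    whole⊨ : Th⊨ whole
    whole⊨ = proj₁ (Th↔ whole) v
    core⊨ : Th⊨ core
    core⊨ = proj₁ (booted⁻ I P2 T core input (proj₂ whole⊨))
    ins⊨ : ∀ p i → δ p ≡ just i → Th⊨ (insTh p i)
    ins⊨ p i h with listed-δ p i h
    ... | inj₁ m                     = proj₂ core⊨ (p , i) m
    ... | inj₂ (n , q , refl , refl) = proj₂ (booted⁻ I P2 T core input (proj₂ whole⊨)) n q

  satisfiable : ∀ k → proj₁ (iter k (boot input , λ _ → 0)) ≡ good → Satisfiable (sentence whole)
  satisfiable k e = satisfied whole (start⊨ , booted⁺ I J T core input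
      (base⊨ , λ q m → ins⊨ (proj₁ q) (proj₂ q) (δ-listed m)) (λ n q → ins⊨ (boot (suc n)) (inc 0 (boot n)) (δ-boot q)))
    where open Model δ refl refl (boot input) k e registers

-- No case distinction on satisfiability is made. If the code were in `SAT`, the answer 1 would
-- refute φ; so it is not, the answer must be 0, and this answer provides a model. Injectivity of
-- `code0` identifies the sentence behind membership in `SAT` with φ.
diagonal : ∀ {P} φ → (Computes P (code0 φ) 1 → ¬ Satisfiable φ) → (Computes P (code0 φ) 0 → Satisfiable φ) →
           ¬ Decides P SAT
diagonal φ refute build decides = not-sat (φ , refl , build (proj₂ (decides (code0 φ)) not-sat))
  where
  not-sat : ¬ SAT (code0 φ)
  not-sat (ψ , e , s) = refute (proj₁ (decides (code0 φ)) (ψ , e , s)) (subst Satisfiable (code0-injective ψ φ e) s)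

theorem13 : ¬ Decidable-set SAT
theorem13 (P , decides) = diagonal (sentence whole)
  (λ h → unsatisfiable (proj₁ (outcome h)) (proj₂ (outcome h)))
  (λ h → satisfiable (proj₁ (outcome h)) (proj₂ (outcome h))) decides
  where open Machine P
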